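{- There is a polynomial-time online algorithm that computes an $O(\log|E|)$-approximate solution to the linear program (LP) given in the context. That is, it computes online a feasible solution whose cost $\sum_e a(e)x_e$ is at most $O(\log|E|)$ times the optimal value of (LP). Here $E$, with $|E|=m$, is the ground set of the original matroid from which the interval-model instance is obtained.
   Context: Original instance. There is a matroid on a finite ground set $E$ with $|E|=m$ and rank $r$, a number $T$ of time steps with $[T]=\{1,\dots,T\}$, an acquisition cost $a(e)\ge0$ for each $e\in E$, and a holding cost $c_t(e)\ge 0$ for each $e\in E$ and $t\in[T]$. The acquisition costs are known up front. The holding costs $c_t(\cdot)$ are revealed only at time $t$. Interval-model instance. It is obtained online from the original instance as follows. Each $e\in E$ is replaced by copies $e_1,e_2,\dots$, parallel to each other in the matroid. With $t_0=0$, the copy $e_i$ is alive exactly on the interval $I_{e_i}=[t_{i-1}+1,t_i]$. Here $t_i=t_{i-1}+1$ if $c_{t_{i-1}+1}(e)\ge a(e)$. Otherwise $t_i$ is the largest time such that $\sum_{t=t_{i-1}+1}^{t_i}c_t(e)\le a(e)$. The copy $e_i$ has acquisition cost $a(e_i)=a(e)+c_{t_{i-1}+1}(e)$, and there are no holding costs. Thus the intervals of the copies of a given original element partition $[T]$, and at most $|E|=m$ elements are alive at any time. Let $\mathcal{M}$ be the resulting matroid (with the parallel copies), also of rank $r$. Below, "element" means an element of $\mathcal{M}$, with its interval $I_e$ and acquisition cost $a(e)$. (LP) has variables $x_e$ and $z_{et}$ (for elements $e$ and $t\in I_e$; set $z_{et}=0$ for $t\notin I_e$). It reads: minimize $\sum_e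 a(e)x_e$ subject to $(z_{et})_e\in\mathcal{P}_B(\mathcal{M})$ for every $t\in[T]$; $z_{et}\le x_e$ for all $e$ and all $t\in I_e$; and $x_e,z_{et}\in[0,1]$. Here $\mathcal{P}_B(\mathcal{M})$ is the base polytope, i.e. the set of vectors $z\ge0$ with $z(S)\le\mathrm{rank}(S)$ for every set $S$ of elements and total sum $r$. Online setting. At each time $t$ the algorithm learns which intervals have ended, which new elements become alive at time $t$, and their acquisition costs. It does not know when the interval of a currently alive element will end. It maintains values $x_e$ that are only ever raised, and after processing time $t$ the current $x$ must be feasible for the constraints of (LP) for all time steps up to $t$ (with suitable $z$). The cost is that of the final $x$.
   Formalization: The acquisition and holding costs are rational instead of real, and the solutions x, z of (LP), including those against which the cost is compared, take rational values. -}

module Defs where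

open import Algebra.Definitions.RawMonoid using (sum)
open import Data.Bool.Base using (Bool; true; false; if_then_else_)
open import Data.Empty using (⊥-elim)
open import Data.Fin.Base using (Fin; zero; suc; toℕ)
open import Data.Fin.Properties using (all?)
  renaming (_≟_ to _≟ᶠ_; suc-injective to sucᶠ-injective)
open import Data.Fin.Subset
  using (Subset; inside; outside; _∈_; _∉_; _⊆_; _∪_; ⁅_⁆; ∣_∣; ⊤; ⊥)
open import Data.Fin.Subset.Properties
  using ( _∈?_; _⊆?_; x∈p∪q⁺; x∈p∪q⁻; x∈⁅x⁆; x∈⁅y⁆⇒x≡y; ∉⊥; ⊥⊆; ⊆-antisym
        ; ∪-identityˡ; ∣⊥∣≡0 )
open import Data.Integer.Base as ℤ using (+_)
open import Data.List.Base
  using (List; []; _∷_; _++_; map; filter; concatMap; allFin; length; lookup; upTo; head; foldr)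
open import Data.List.Extrema.Nat using (max)
open import Data.Maybe.Base using (maybe′)
open import Data.Nat.Base as ℕ using (ℕ; zero; suc; _≤_; _<_; _+_; _^_)
open import Data.Nat.ListAction using () renaming (sum to sumℕ)
open import Data.Nat.Logarithm using (⌈log₂_⌉)
import Data.Nat.Properties as ℕ
open import Data.Product.Base using (∃-syntax; _×_; _,_)
open import Data.Rational.Base as ℚ using (ℚ; 0ℚ; 1ℚ; ↥_; ↧ₙ_)
import Data.Rational.Properties as ℚ
open import Data.Sum.Base using (inj₁; inj₂)
open import Data.Vec.Base as Vec using (Vec; []; _∷_; here; there)
open import Function.Base using (_∘_)
open import Relation.Binary.PropositionalEquality
  using (_≡_; _≢_; refl; sym; trans; cong; subst; subst₂)
open import Relation.Nullary
  using (¬_; yes; no; does; _×-dec_; _→-dec_; contradiction)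
open import Relation.Unary using (Decidable)

------------------------------------------------------------------------
-- Rationals

∑ : ∀ {n} → (Fin n → ℚ) → ℚ
∑ = sum ℚ.+-0-rawMonoid

fromℕ : ℕ → ℚ
fromℕ n = + n ℚ./ 1

------------------------------------------------------------------------
-- Matroids

record Matroid (n : ℕ) : Set₁ where
  field
    Independent  : Subset n → Set
    independent? : Decidable Independent
    empty        : Independent ⊥
    hereditary   : ∀ {p q} → p ⊆ q → Independent q → Independent p
    exchange     : ∀ {p q} → Independent p → Independent q → ∣ p ∣ < ∣ q ∣ →
                   ∃[ e ] (e ∈ q × e ∉ p × Independent (p ∪ ⁅ e ⁆))

allSubsets : ∀ n → List (Subset n)
allSubsets zero    = [] ∷ []
allSubsets (suc n) = map (outside ∷_) (allSubsets n) ++ map (inside ∷_) (allSubsets n)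

rank : ∀ {n} → Matroid n → Subset n → ℕ
rank {n} M S =
  max 0 (map ∣_∣ (filter (λ p → p ⊆? S ×-dec independent? p) (allSubsets n)))
  where open Matroid M

_⟨_⟩ : ∀ {n} → (Fin n → ℚ) → Subset n → ℚ
z ⟨ S ⟩ = ∑ (λ e → if Vec.lookup S e then z e else 0ℚ)

record _∈P_ {n : ℕ} (z : Fin n → ℚ) (M : Matroid n) : Set where
  field
    nonneg : ∀ e → 0ℚ ℚ.≤ z e
    ranks  : ∀ S → z ⟨ S ⟩ ℚ.≤ fromℕ (rank M S)
    total  : ∑ z ≡ fromℕ (rank M ⊤)

------------------------------------------------------------------------
-- Parallel extensions: element k of the new ground set is a copy of π k,
-- and distinct copies of one element are parallel to each other (copies
-- of a loop are loops).

module _ {m : ℕ} where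

  image : ∀ {n} → (Fin n → Fin m) → Subset n → Subset m
  image π []            = ⊥
  image π (inside  ∷ S) = ⁅ π zero ⁆ ∪ image (π ∘ suc) S
  image π (outside ∷ S) = image (π ∘ suc) S

  InjectiveOn : ∀ {n} → (Fin n → Fin m) → Subset n → Set
  InjectiveOn π S = ∀ i j → i ∈ S → j ∈ S → π i ≡ π j → i ≡ j

  private
    ∈-image⁺ : ∀ {n} (π : Fin n → Fin m) {S i} → i ∈ S → π i ∈ image π S
    ∈-image⁺ π {inside  ∷ S} here      = x∈p∪q⁺ (inj₁ (x∈⁅x⁆ _))
    ∈-image⁺ π {inside  ∷ S} (there p) = x∈p∪q⁺ {p = ⁅ π zero ⁆} (inj₂ (∈-image⁺ (π ∘ suc) p))
    ∈-image⁺ π {outside ∷ S} (there p) = ∈-image⁺ (π ∘ suc) p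

    ∈-image⁻ : ∀ {n} (π : Fin n → Fin m) S {e} → e ∈ image π S → ∃[ i ] (i ∈ S × π i ≡ e)
    ∈-image⁻ π []            p = ⊥-elim (∉⊥ p)
    ∈-image⁻ π (outside ∷ S) p with ∈-image⁻ (π ∘ suc) S p
    ... | i , i∈S , eq = suc i , there i∈S , eq
    ∈-image⁻ π (inside ∷ S)  p with x∈p∪q⁻ ⁅ π zero ⁆ _ p
    ... | inj₁ q = zero , here , sym (x∈⁅y⁆⇒x≡y _ q)
    ... | inj₂ q with ∈-image⁻ (π ∘ suc) S q
    ...   | i , i∈S , eq = suc i , there i∈S , eq

    image-mono : ∀ {n} (π : Fin n → Fin m) {p q} → p ⊆ q → image π p ⊆ image π q
    image-mono π {p} {q} p⊆q e∈ with ∈-image⁻ π p e∈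
    ... | i , i∈p , refl = ∈-image⁺ π (p⊆q i∈p)

    image-∪ : ∀ {n} (π : Fin n → Fin m) S i → image π (S ∪ ⁅ i ⁆) ⊆ image π S ∪ ⁅ π i ⁆
    image-∪ π S i e∈ with ∈-image⁻ π (S ∪ ⁅ i ⁆) e∈
    ... | j , j∈ , refl with x∈p∪q⁻ S ⁅ i ⁆ j∈
    ...   | inj₁ j∈S = x∈p∪q⁺ (inj₁ (∈-image⁺ π j∈S))
    ...   | inj₂ j∈i rewrite x∈⁅y⁆⇒x≡y i j∈i = x∈p∪q⁺ {p = image π S} (inj₂ (x∈⁅x⁆ _))

    image-⊥ : ∀ {n} (π : Fin n → Fin m) → image π ⊥ ⊆ ⊥
    image-⊥ π e∈ with ∈-image⁻ π ⊥ e∈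
    ... | _ , i∈⊥ , _ = ⊥-elim (∉⊥ i∈⊥)

    ∣⁅x⁆∪p∣ : ∀ {n} (x : Fin n) p → x ∉ p → ∣ ⁅ x ⁆ ∪ p ∣ ≡ suc ∣ p ∣
    ∣⁅x⁆∪p∣ zero    (inside  ∷ p) x∉p = contradiction here x∉p
    ∣⁅x⁆∪p∣ zero    (outside ∷ p) x∉p = cong (suc ∘ ∣_∣) (∪-identityˡ p)
    ∣⁅x⁆∪p∣ (suc x) (inside  ∷ p) x∉p = cong suc (∣⁅x⁆∪p∣ x p (x∉p ∘ there))
    ∣⁅x⁆∪p∣ (suc x) (outside ∷ p) x∉p = ∣⁅x⁆∪p∣ x p (x∉p ∘ there)

    tail-inj : ∀ {n s} {π : Fin (suc n) → Fin m} {S} →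
               InjectiveOn π (s ∷ S) → InjectiveOn (π ∘ suc) S
    tail-inj inj i j i∈ j∈ eq = sucᶠ-injective (inj _ _ (there i∈) (there j∈) eq)

    ∣image∣ : ∀ {n} (π : Fin n → Fin m) S → InjectiveOn π S → ∣ image π S ∣ ≡ ∣ S ∣
    ∣image∣ π []            inj = ∣⊥∣≡0 m
    ∣image∣ π (outside ∷ S) inj = ∣image∣ (π ∘ suc) S (tail-inj inj)
    ∣image∣ π (inside  ∷ S) inj =
      trans (∣⁅x⁆∪p∣ (π zero) _ fresh) (cong suc (∣image∣ (π ∘ suc) S (tail-inj inj)))
      where
      fresh : π zero ∉ image (π ∘ suc) S
      fresh p with ∈-image⁻ (π ∘ suc) S p
      ... | i , i∈S , eq with inj _ _ (there i∈S) here eq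
      ...   | ()

  parallelExtension : ∀ {n} → Matroid m → (Fin n → Fin m) → Matroid n
  parallelExtension {n} M π = record
    { Independent  = λ S → InjectiveOn π S × Independent (image π S)
    ; independent? = λ S →
        (all? λ i → all? λ j →
          (i ∈? S) →-dec ((j ∈? S) →-dec ((π i ≟ᶠ π j) →-dec (i ≟ᶠ j))))
        ×-dec independent? (image π S)
    ; empty        = (λ i j i∈ _ _ → ⊥-elim (∉⊥ i∈)) , hereditary (image-⊥ π) empty
    ; hereditary   = λ p⊆q (inj , ind) →
        (λ i j i∈ j∈ → inj i j (p⊆q i∈) (p⊆q j∈)) , hereditary (image-mono π p⊆q) ind
    ; exchange     = exch
    }
    where
    open Matroid M
    exch : ∀ {p q} → InjectiveOn π p × Independent (image π p) →
           InjectiveOn π q × Independent (image π q) → ∣ p ∣ < ∣ q ∣ →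
           ∃[ e ] (e ∈ q × e ∉ p ×
                   InjectiveOn π (p ∪ ⁅ e ⁆) × Independent (image π (p ∪ ⁅ e ⁆)))
    exch {p} {q} (injp , indp) (injq , indq) p<q
      with exchange indp indq (subst₂ _<_ (sym (∣image∣ π p injp)) (sym (∣image∣ π q injq)) p<q)
    ... | e , e∈q , e∉p , ind with ∈-image⁻ π q e∈q
    ... | i , i∈q , refl =
          i , i∈q , (λ i∈p → e∉p (∈-image⁺ π i∈p)) , inj , hereditary (image-∪ π p i) ind
      where
      inj : InjectiveOn π (p ∪ ⁅ i ⁆)
      inj j k j∈ k∈ eq with x∈p∪q⁻ p ⁅ i ⁆ j∈ | x∈p∪q⁻ p ⁅ i ⁆ k∈
      ... | inj₁ j∈p | inj₁ k∈p = injp j k j∈p k∈p eq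
      ... | inj₁ j∈p | inj₂ k∈i rewrite x∈⁅y⁆⇒x≡y i k∈i =
            contradiction (subst (_∈ image π p) eq (∈-image⁺ π j∈p)) e∉p
      ... | inj₂ j∈i | inj₁ k∈p rewrite x∈⁅y⁆⇒x≡y i j∈i =
            contradiction (subst (_∈ image π p) (sym eq) (∈-image⁺ π k∈p)) e∉p
      ... | inj₂ j∈i | inj₂ k∈i = trans (x∈⁅y⁆⇒x≡y i j∈i) (sym (x∈⁅y⁆⇒x≡y i k∈i))

------------------------------------------------------------------------
-- Original instances.  The time steps are 1, …, T; values of c at other
-- times play no role.  Costs are rational, so that they are finite inputs.

record Instance (m : ℕ) : Set₁ where
  field
    matroid  : Matroid m
    T        : ℕ
    a        : Fin m → ℚ
    c        : ℕ → Fin m → ℚ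
    a-nonneg : ∀ e → 0ℚ ℚ.≤ a e
    c-nonneg : ∀ t e → 0ℚ ℚ.≤ c t e

-- The copies of e are numbered from 0: copy i of e is alive on the
-- interval [ boundary e i + 1 , boundary e (i + 1) ].

record Copy (m : ℕ) : Set where
  field
    origin    : Fin m
    index     : ℕ
    birth end : ℕ
    cost      : ℚ

module IntervalModel {m : ℕ} (P : Instance m) where
  open Instance P

  -- holding e s t = c s e + … + c t e, which is 0 when t < s
  holding : Fin m → ℕ → ℕ → ℚ
  holding e s t = ∑ {suc t ℕ.∸ s} (λ i → c (s + toℕ i) e)

  -- The last step of the interval starting at s.  If c s e < a e and
  -- s ≤ T, then s itself is in the list, so the default s is harmless.
  lastStep : Fin m → ℕ → ℕ
  lastStep e s with a e ℚ.≤? c s e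
  ... | yes _ = s
  ... | no  _ = max s (filter (λ t → holding e s t ℚ.≤? a e) (upTo (suc T)))

  boundary : Fin m → ℕ → ℕ
  boundary e zero    = 0
  boundary e (suc i) = lastStep e (suc (boundary e i))

  copy : Fin m → ℕ → Copy m
  copy e i = record
    { origin = e
    ; index  = i
    ; birth  = suc (boundary e i)
    ; end    = boundary e (suc i)
    ; cost   = a e ℚ.+ c (suc (boundary e i)) e
    }

  -- Boundaries increase strictly until they reach T, so there are at
  -- most T copies.
  copiesOf : Fin m → List (Copy m)
  copiesOf e = map (copy e) (filter (λ i → boundary e i ℕ.<? T) (upTo T))

  copies : List (Copy m)
  copies = concatMap copiesOf (allFin m)

  Element : Set
  Element = Fin (length copies)

  element : Element → Copy m
  element = lookup copies

  𝓜 : Matroid (length copies)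
  𝓜 = parallelExtension matroid (Copy.origin ∘ element)

  Alive : Element → ℕ → Set
  Alive k t = Copy.birth (element k) ≤ t × t ≤ Copy.end (element k)

  cost : (Element → ℚ) → ℚ
  cost x = ∑ (λ k → Copy.cost (element k) ℚ.* x k)

  -- (x , z) satisfies the constraints of (LP) for the time steps 1, …, τ.
  record FeasibleUpTo (τ : ℕ) (x : Element → ℚ) (z : Element → ℕ → ℚ) : Set where
    field
      base : ∀ t → 1 ≤ t → t ≤ τ → (λ k → z k t) ∈P 𝓜
      z≤x  : ∀ k t → 1 ≤ t → t ≤ τ → Alive k t → z k t ℚ.≤ x k
      z≡0  : ∀ k t → 1 ≤ t → t ≤ τ → ¬ Alive k t → z k t ≡ 0ℚ
      0≤x  : ∀ k → 0ℚ ℚ.≤ x k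
      x≤1  : ∀ k → x k ℚ.≤ 1ℚ
      0≤z  : ∀ k t → 1 ≤ t → t ≤ τ → 0ℚ ℚ.≤ z k t
      z≤1  : ∀ k t → 1 ≤ t → t ≤ τ → z k t ℚ.≤ 1ℚ

  Feasible : (Element → ℚ) → (Element → ℕ → ℚ) → Set
  Feasible = FeasibleUpTo T

------------------------------------------------------------------------
-- Algorithms.  Programs of a while-language over binary trees with
-- rational leaves, equipped with a membership oracle.  `nil` is false and
-- everything else is true; an ill-typed operation gives `nil`.

data Data : Set where
  nil  : Data
  num  : ℚ → Data
  pair : Data → Data → Data

bits : ℕ → ℕ
bits n = ⌈log₂ suc n ⌉

size : Data → ℕ
size nil        = 1
size (num q)    = 1 + bits ℤ.∣ ↥ q ∣ + bits (↧ₙ q)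
size (pair d e) = 1 + size d + size e

data Op₁ : Set where
  fst snd neg inv : Op₁

data Op₂ : Set where
  cons add mul leq : Op₂

truth : Bool → Data
truth true  = num 1ℚ
truth false = nil

inverse : ℚ → ℚ
inverse q with q ℚ.≟ 0ℚ
... | yes _   = 0ℚ
... | no  q≢0 = ℚ.1/_ q {{ℚ.≢-nonZero q≢0}}

⟦_⟧₁ : Op₁ → Data → Data
⟦ fst ⟧₁ (pair d e) = d
⟦ snd ⟧₁ (pair d e) = e
⟦ neg ⟧₁ (num q)    = num (ℚ.- q)
⟦ inv ⟧₁ (num q)    = num (inverse q)
⟦ _   ⟧₁ _          = nil

⟦_⟧₂ : Op₂ → Data → Data → Data
⟦ cons ⟧₂ d       e       = pair d e
⟦ add  ⟧₂ (num p) (num q) = num (p ℚ.+ q)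
⟦ mul  ⟧₂ (num p) (num q) = num (p ℚ.* q)
⟦ leq  ⟧₂ (num p) (num q) = truth (does (p ℚ.≤? q))
⟦ _    ⟧₂ _       _       = nil

-- Tm n: programs with n free variables (de Bruijn indices).
-- `while s c b` starts from the value of s and, as long as c is true of the
-- current value, replaces it by the value of b; in c and b the current
-- value is variable 0.
data Tm (n : ℕ) : Set where
  var   : Fin n → Tm n
  const : Data → Tm n
  op₁   : Op₁ → Tm n → Tm n
  op₂   : Op₂ → Tm n → Tm n → Tm n
  query : Tm n → Tm n
  cond  : Tm n → Tm n → Tm n → Tm n
  bind  : Tm n → Tm (suc n) → Tm n
  while : Tm n → Tm (suc n) → Tm (suc n) → Tm n

-- ρ ⊢ t ⇓ v ∣ k: in environment ρ, t evaluates to v at cost k.  Every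
-- evaluation of a subterm is charged the size of its value, and arithmetic,
-- comparison and copying are polynomial in the sizes of the operands and
-- the result.  So cost and Turing-machine time with the same oracle are
-- polynomially related.
module Semantics (oracle : Data → Bool) where

  infix 4 _⊢_⇓_∣_ _⊢_,_,_↻_∣_

  mutual
    data _⊢_⇓_∣_ {n : ℕ} (ρ : Vec Data n) : Tm n → Data → ℕ → Set where
      ⇓var   : ∀ {i} → ρ ⊢ var i ⇓ Vec.lookup ρ i ∣ size (Vec.lookup ρ i)
      ⇓const : ∀ {d} → ρ ⊢ const d ⇓ d ∣ size d
      ⇓op₁   : ∀ {o t v k} → ρ ⊢ t ⇓ v ∣ k →
               ρ ⊢ op₁ o t ⇓ ⟦ o ⟧₁ v ∣ size (⟦ o ⟧₁ v) + k
      ⇓op₂   : ∀ {o t u v w k l} → ρ ⊢ t ⇓ v ∣ k → ρ ⊢ u ⇓ w ∣ l →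
               ρ ⊢ op₂ o t u ⇓ ⟦ o ⟧₂ v w ∣ size (⟦ o ⟧₂ v w) + (k + l)
      ⇓query : ∀ {t v k} → ρ ⊢ t ⇓ v ∣ k →
               ρ ⊢ query t ⇓ truth (oracle v) ∣ size (truth (oracle v)) + k
      ⇓then  : ∀ {b t u v w k l} → ρ ⊢ b ⇓ v ∣ k → v ≢ nil → ρ ⊢ t ⇓ w ∣ l →
               ρ ⊢ cond b t u ⇓ w ∣ size w + (k + l)
      ⇓else  : ∀ {b t u w k l} → ρ ⊢ b ⇓ nil ∣ k → ρ ⊢ u ⇓ w ∣ l →
               ρ ⊢ cond b t u ⇓ w ∣ size w + (k + l)
      ⇓bind  : ∀ {t u v w k l} → ρ ⊢ t ⇓ v ∣ k → (v ∷ ρ) ⊢ u ⇓ w ∣ l →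
               ρ ⊢ bind t u ⇓ w ∣ size w + (k + l)
      ⇓while : ∀ {s c b v w k l} → ρ ⊢ s ⇓ v ∣ k → ρ ⊢ c , b , v ↻ w ∣ l →
               ρ ⊢ while s c b ⇓ w ∣ size w + (k + l)

    data _⊢_,_,_↻_∣_ {n : ℕ} (ρ : Vec Data n) (c b : Tm (suc n)) :
                     Data → Data → ℕ → Set where
      stop : ∀ {v k} → (v ∷ ρ) ⊢ c ⇓ nil ∣ k → ρ ⊢ c , b , v ↻ v ∣ k
      next : ∀ {v v′ w d k l h} → (v ∷ ρ) ⊢ c ⇓ d ∣ k → d ≢ nil →
             (v ∷ ρ) ⊢ b ⇓ v′ ∣ l → ρ ⊢ c , b , v′ ↻ w ∣ h →
             ρ ⊢ c , b , v ↻ w ∣ k + (l + h)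

------------------------------------------------------------------------
-- Online algorithms for the interval model

list : List Data → Data
list = foldr pair nil

nth : Data → ℕ → Data
nth d zero    = ⟦ fst ⟧₁ d
nth d (suc i) = nth (⟦ snd ⟧₁ d) i

value : Data → ℚ
value (num q) = q
value _       = 0ℚ

-- Subsets are passed to the oracle as characteristic vectors.
toSubset : ∀ m → Data → Subset m
toSubset zero    _            = []
toSubset (suc m) (pair nil d) = outside ∷ toSubset m d
toSubset (suc m) (pair _   d) = inside  ∷ toSubset m d
toSubset (suc m) _            = ⊥

-- An online algorithm is a program mapping the current state (variable 0)
-- and the message of the current time step (variable 1) to the new state
-- and the new values of x.
OnlineAlgorithm : Set
OnlineAlgorithm = Tm 2

module Online {m : ℕ} (P : Instance m) where
  open Instance P
  open IntervalModel P

  -- The information revealed at time t: for each e ∈ E, the acquisition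
  -- cost of the copy of e becoming alive at t, or `nil` if there is none.
  -- As the intervals of the copies of e partition 1, …, T, the previous copy
  -- of e ended at t - 1 if and only if a new one becomes alive at t.
  message : ℕ → Data
  message t = list (map news (allFin m))
    where
    news : Fin m → Data
    news e = maybe′ (num ∘ Copy.cost) nil
               (head (filter (λ κ → Copy.birth κ ℕ.≟ t) (copiesOf e)))

  inputSize : ℕ → ℕ
  inputSize t = sumℕ (map (size ∘ message ∘ suc) (upTo t))

  open Semantics (does ∘ Matroid.independent? matroid ∘ toSubset m) public

  -- The run of A on P; it is unique because evaluation is deterministic.
  record Run (A : OnlineAlgorithm) : Set where
    field
      state output : ℕ → Data
      time         : ℕ → ℕ
      state-0      : state 0 ≡ num (fromℕ m)
      output-0     : output 0 ≡ nil
      step         : ∀ t → t < T →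
                     (state t ∷ message (suc t) ∷ []) ⊢ A
                       ⇓ pair (state (suc t)) (output (suc t)) ∣ time (suc t)

    -- The value of x at copy i of e after time t is entry i of entry e of
    -- the output; entries that are not present count as 0.
    x : ℕ → Element → ℚ
    x t k = value (nth (nth (output t) (toℕ (Copy.origin (element k))))
                       (Copy.index (element k)))

    -- The polynomials n ↦ n ^ d + d dominate all polynomials.
    PolynomialTime : ℕ → Set
    PolynomialTime d = ∀ t → 1 ≤ t → t ≤ T → time t ≤ inputSize t ^ d + d

    Raising : Set
    Raising = ∀ t → t < T → ∀ k → x t k ℚ.≤ x (suc t) k

    FeasibleOnline : Set
    FeasibleOnline = ∀ t → t ≤ T → ∃[ z ] FeasibleUpTo t (x t) z

    -- The cost of the final x is at most ratio times that of every feasible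
    -- solution, that is, at most ratio times the optimal value of (LP).
    Competitive : ℚ → Set
    Competitive ratio = ∀ x* z* → Feasible x* z* → cost (x T) ℚ.≤ ratio ℚ.* cost x*

-- log₂ (1 + m), rounded up: for m ≥ 2 this is within a constant factor of
-- log m; for m = 1, where log m = 0, it is 1.
log : ℕ → ℕ
log m = ⌈log₂ suc m ⌉

-- Let M = 2m.  The current copy of e has a level, which determines a number
-- k ∈ {0, 1, 2, 4, …}, and x_e = min (1, 4k / M).  As long as the vector k / M
-- violates a constraint x(D) ≥ r - rank (E ∖ D), the residual costs of all
-- copies in D decrease at the same rate, and a copy whose residual cost
-- reaches 0 is recharged and rises to the next level, until k ≥ M.  Per unit
-- of decrease the dual grows by r - rank (E ∖ D) and the primal cost,
-- interpolated between levels, by a constant multiple of that.  A copy pays at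
-- most its cost per level and has O(log m) levels, which bounds the dual load.
--
-- Violated constraints are found by multiplicative weights.  In each of m²
-- rounds a basis of least weight is chosen greedily, where the weight 2 ^ key
-- of an element doubles after every k uses.  By Abel summation over the
-- thresholds v, either {key > v} is a violated constraint for some v, or the
-- potential ∑ 2 ^ key (k + c), c counting the uses since the last doubling,
-- grows by at most a factor 1 + 1 / M.  In the latter case, no element is used
-- in more than a fraction 4k / M of the rounds, and the average of the bases
-- is the required point of the base polytope.
--
-- Loops that at most add to their accumulator keep sizes polynomial.  Only the
-- two loops above need invariants: their counters are polynomial in m, and the
-- residual costs are integral over the product of the denominators seen.

module Submission where

open import Defs
open import Algebra.Bundles using (CommutativeRing)
open import Data.Bool.Base using (Bool; true; false; if_then_else_; _∧_; not)
open import Data.Empty using (⊥; ⊥-elim)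
open import Data.Fin.Base using (Fin; zero; suc; toℕ)
import Data.Fin.Properties as Fin
open import Data.Fin.Subset as Subset using (Subset)
import Data.Fin.Subset.Properties as Subset
open import Data.Integer.Base as ℤ using (ℤ)
import Data.Integer.GCD as ℤ
import Data.Integer.Properties as ℤ
open import Data.List.Base as List using (List; []; _∷_; map; foldl; allFin; upTo; reverse; applyUpTo; _++_; length; replicate; filter; head; lookup)
open import Data.List.Extrema.Nat using (⊥≤max; max≤v⁺; xs≤max)
open import Data.List.Membership.Propositional using (_∈_)
open import Data.List.Membership.Propositional.Properties using (∈-allFin; ∈-upTo⁺; ∈-upTo⁻; ∈-map⁺; ∈-map⁻; ∈-++⁺ˡ; ∈-++⁺ʳ; ∈-filter⁺; ∈-filter⁻; ∈-concatMap⁺; ∈-concatMap⁻; ∈-lookup)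
import Data.List.Properties as List
open import Data.List.Relation.Binary.Disjoint.Propositional using (Disjoint)
open import Data.List.Relation.Unary.All as All using (All; []; _∷_)
import Data.List.Relation.Unary.All.Properties as All
open import Data.List.Relation.Unary.AllPairs as AllPairs using ([]; _∷_)
import Data.List.Relation.Unary.AllPairs.Properties as AllPairs
open import Data.List.Relation.Unary.Any as Any using (here; there)
import Data.List.Relation.Unary.Any.Properties as Any
open import Data.List.Relation.Unary.Unique.Propositional using (Unique)
import Data.List.Relation.Unary.Unique.Propositional.Properties as Unique
open import Data.Maybe.Base using (Maybe; just; nothing; maybe′; fromMaybe)
open import Data.Nat.Base
import Data.Nat.Coprimality as Coprime
open import Data.Nat.Induction using (<-wellFounded)
open import Data.Nat.ListAction using () renaming (sum to sumℕ)
open import Data.Nat.ListAction.Properties using (sum-++)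
open import Data.Nat.Logarithm using (⌈log₂_⌉; ⌈log₂⌉-mono-≤; ⌈log₂2^n⌉≡n)
open import Data.Nat.Logarithm.Core using (⌈log2⌉)
open import Data.Nat.Properties
open import Data.Nat.Tactic.RingSolver using (solve-∀)
open import Data.Product.Base using (Σ-syntax; ∃-syntax; _×_; _,_; proj₁; proj₂)
open import Data.Rational.Base as ℚ using (ℚ; 0ℚ; 1ℚ; ↥_; ↧_; ↧ₙ_)
import Data.Rational.Properties as ℚ
import Data.Rational.Unnormalised.Base as ℚᵘ
import Data.Rational.Unnormalised.Properties as ℚᵘ
open import Data.Sum.Base using (_⊎_; inj₁; inj₂)
open import Data.Unit.Base using (tt) renaming (⊤ to Unit)
open import Data.Vec.Base as Vec using (Vec; []; _∷_)
import Data.Vec.Properties as Vec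
open import Function.Base using (_∘_)
open import Induction.WellFounded using (acc)
open import Relation.Binary.PropositionalEquality
open import Relation.Nullary using (¬_; Dec; yes; no; does; contradiction; _×-dec_)
open import Relation.Nullary.Decidable.Core using (dec⇒maybe)
import Tactic.RingSolver as Ring
open import Tactic.RingSolver.Core.AlmostCommutativeRing using (fromCommutativeRing; AlmostCommutativeRing)

open import Algebra.Properties.Semiring.Sum +-*-semiring as ∑ᴺ using () renaming (sum to sumᴺ)
import Algebra.Properties.Semiring.Sum (CommutativeRing.semiring ℚ.+-*-commutativeRing) as ∑ℚ

-- Polynomials

-- The comparison is made directly with an arbitrary feasible `x*`. Summed over all copies, `gap`,
-- which is μ times the dual load times `x*` minus the interpolated primal cost, starts at 0 and
-- never decreases: `x*` satisfies every violated constraint that is used, so its side grows at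
-- least as fast. Replacing each dual load by its bound a(e) * Λ then gives the ratio.
--
-- The constants have three sources. Raising a level adds at most k + 1 to the capacity, not k,
-- because the lowest level has k = 0; the extra ones sum to at most m, which at most doubles the
-- charge and gives μ = 2M = 4m. An unsaturated element lies in at most 2m * k of the m * m bases,
-- which is the share 2k / m = 4k / M granted by x. A copy reaches at most level Λ = 2 + log m.
-- Together this is 8 * Λ, and Λ ≤ 3 * log m.
--
-- An element with k = 0 has no room in the packing and cannot start with a finite weight. It
-- receives a key above all keys that the others can reach, so that a basis using it exposes a
-- violated constraint.

infixl 6 _⊕_
infixl 7 _⊗_
infix 9 _[_]ᵖ

data Pol : Set where
  𝕏       : Pol
  C       : ℕ → Pol
  _⊕_ _⊗_ : Pol → Pol → Pol

⟦_⟧ : Pol → ℕ → ℕ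
⟦ 𝕏 ⟧     n = n
⟦ C c ⟧   n = c
⟦ p ⊕ q ⟧ n = ⟦ p ⟧ n + ⟦ q ⟧ n
⟦ p ⊗ q ⟧ n = ⟦ p ⟧ n * ⟦ q ⟧ n

_[_]ᵖ : Pol → Pol → Pol
𝕏       [ r ]ᵖ = r
C c     [ r ]ᵖ = C c
(p ⊕ q) [ r ]ᵖ = p [ r ]ᵖ ⊕ q [ r ]ᵖ
(p ⊗ q) [ r ]ᵖ = p [ r ]ᵖ ⊗ q [ r ]ᵖ

⟦[]ᵖ⟧ : ∀ p r n → ⟦ p [ r ]ᵖ ⟧ n ≡ ⟦ p ⟧ (⟦ r ⟧ n)
⟦[]ᵖ⟧ 𝕏       r n = refl
⟦[]ᵖ⟧ (C c)   r n = refl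
⟦[]ᵖ⟧ (p ⊕ q) r n = cong₂ _+_ (⟦[]ᵖ⟧ p r n) (⟦[]ᵖ⟧ q r n)
⟦[]ᵖ⟧ (p ⊗ q) r n = cong₂ _*_ (⟦[]ᵖ⟧ p r n) (⟦[]ᵖ⟧ q r n)

⟦⟧-mono : ∀ p {m n} → m ≤ n → ⟦ p ⟧ m ≤ ⟦ p ⟧ n
⟦⟧-mono 𝕏       m≤n = m≤n
⟦⟧-mono (C c)   m≤n = ≤-refl
⟦⟧-mono (p ⊕ q) m≤n = +-mono-≤ (⟦⟧-mono p m≤n) (⟦⟧-mono q m≤n)
⟦⟧-mono (p ⊗ q) m≤n = *-mono-≤ (⟦⟧-mono p m≤n) (⟦⟧-mono q m≤n)

coefficient degree : Pol → ℕ
coefficient 𝕏       = 1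
coefficient (C c)   = c
coefficient (p ⊕ q) = coefficient p + coefficient q
coefficient (p ⊗ q) = coefficient p * coefficient q
degree 𝕏       = 1
degree (C c)   = 0
degree (p ⊕ q) = degree p + degree q
degree (p ⊗ q) = degree p + degree q

⟦⟧-degree : ∀ p n → ⟦ p ⟧ n ≤ coefficient p * suc n ^ degree p
⟦⟧-degree 𝕏 n = begin
  n                 ≤⟨ n≤1+n n ⟩
  suc n             ≡⟨ sym (*-identityʳ (suc n)) ⟩
  suc n * 1         ≡⟨ sym (*-identityˡ _) ⟩
  1 * (suc n * 1)   ∎
  where open ≤-Reasoning
⟦⟧-degree (C c) n = ≤-reflexive (sym (*-identityʳ c))
⟦⟧-degree (p ⊕ q) n = begin
  ⟦ p ⟧ n + ⟦ q ⟧ n                                ≤⟨ +-mono-≤ (⟦⟧-degree p n) (⟦⟧-degree q n) ⟩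
  cp * suc n ^ dp + cq * suc n ^ dq                ≤⟨ +-mono-≤ (*-monoʳ-≤ cp (^-monoʳ-≤ (suc n) (m≤m+n dp dq)))
                                                               (*-monoʳ-≤ cq (^-monoʳ-≤ (suc n) (m≤n+m dq dp))) ⟩
  cp * suc n ^ (dp + dq) + cq * suc n ^ (dp + dq)  ≡⟨ sym (*-distribʳ-+ (suc n ^ (dp + dq)) cp cq) ⟩
  (cp + cq) * suc n ^ (dp + dq)                    ∎
  where
  open ≤-Reasoning
  cp = coefficient p
  cq = coefficient q
  dp = degree p
  dq = degree q
⟦⟧-degree (p ⊗ q) n = begin
  ⟦ p ⟧ n * ⟦ q ⟧ n                     ≤⟨ *-mono-≤ (⟦⟧-degree p n) (⟦⟧-degree q n) ⟩
  cp * suc n ^ dp * (cq * suc n ^ dq)   ≡⟨ [m*n]*[o*p]≡[m*o]*[n*p] cp _ cq _ ⟩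
  cp * cq * (suc n ^ dp * suc n ^ dq)   ≡⟨ cong (cp * cq *_) (sym (^-distribˡ-+-* (suc n) dp dq)) ⟩
  cp * cq * suc n ^ (dp + dq)           ∎
  where
  open ≤-Reasoning
  cp = coefficient p
  cq = coefficient q
  dp = degree p
  dq = degree q

n<2^n : ∀ n → n < 2 ^ n
n<2^n zero    = s≤s z≤n
n<2^n (suc n) = begin-strict
  suc n             ≤⟨ n<2^n n ⟩
  2 ^ n             <⟨ m<m+n (2 ^ n) (m^n>0 2 n) ⟩
  2 ^ n + 2 ^ n     ≡⟨ cong (λ h → 2 ^ n + h) (sym (+-identityʳ _)) ⟩
  2 * 2 ^ n         ∎
  where open ≤-Reasoning

⟦⟧-monomial : ∀ p → ∃[ d ] (∀ n → ⟦ p ⟧ n ≤ n ^ d + d)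
⟦⟧-monomial p = d , bound
  where
  open ≤-Reasoning
  c = coefficient p
  g = degree p
  -- For n ≥ 2 the coefficient is absorbed by c ≤ n ^ c and the successor by n + 1 ≤ n ^ 2, which
  -- gives the exponent c + 2g. The summand c * 2 ^ g covers n = 0 and n = 1.
  d = c * 2 ^ g + (c + 2 * g)
  small≤d : c * 2 ^ g ≤ d
  small≤d = m≤m+n _ _
  bound : ∀ n → ⟦ p ⟧ n ≤ n ^ d + d
  bound zero = begin
    ⟦ p ⟧ 0       ≤⟨ ⟦⟧-degree p 0 ⟩
    c * 1 ^ g     ≤⟨ *-monoʳ-≤ c (^-monoˡ-≤ g (s≤s z≤n)) ⟩
    c * 2 ^ g     ≤⟨ small≤d ⟩
    d             ≤⟨ m≤n+m d (0 ^ d) ⟩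
    0 ^ d + d     ∎
  bound (suc zero) = begin
    ⟦ p ⟧ 1       ≤⟨ ⟦⟧-degree p 1 ⟩
    c * 2 ^ g     ≤⟨ small≤d ⟩
    d             ≤⟨ m≤n+m d (1 ^ d) ⟩
    1 ^ d + d     ∎
  bound n@(suc (suc k)) = begin
    ⟦ p ⟧ n               ≤⟨ ⟦⟧-degree p n ⟩
    c * suc n ^ g         ≤⟨ *-mono-≤ (≤-trans (<⇒≤ (n<2^n c)) (^-monoˡ-≤ c {2} {n} (s≤s (s≤s z≤n)))) (^-monoˡ-≤ g suc-n≤) ⟩
    n ^ c * (n ^ 2) ^ g   ≡⟨ cong (n ^ c *_) (^-*-assoc n 2 g) ⟩
    n ^ c * n ^ (2 * g)   ≡⟨ sym (^-distribˡ-+-* n c (2 * g)) ⟩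
    n ^ (c + 2 * g)       ≤⟨ ^-monoʳ-≤ n (m≤n+m (c + 2 * g) (c * 2 ^ g)) ⟩
    n ^ d                 ≤⟨ m≤m+n _ d ⟩
    n ^ d + d             ∎
    where
    suc-n≤ : suc n ≤ n ^ 2
    suc-n≤ = begin
      suc n              ≤⟨ +-monoˡ-≤ n {1} {n} (s≤s z≤n) ⟩
      n + n              ≡⟨ cong (n +_) (sym (+-identityʳ n)) ⟩
      2 * n              ≤⟨ *-monoˡ-≤ n {2} {n} (s≤s (s≤s z≤n)) ⟩
      n * n              ≡⟨ cong (n *_) (sym (*-identityʳ n)) ⟩
      n ^ 2              ∎

-- Sizes of data

n≤2^⌈log₂n⌉ : ∀ n → n ≤ 2 ^ ⌈log₂ n ⌉
n≤2^⌈log₂n⌉ n = go n (<-wellFounded n)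
  where
  open ≤-Reasoning
  go : ∀ n a → n ≤ 2 ^ ⌈log2⌉ n a
  go zero          a        = z≤n
  go (suc zero)    a        = ≤-refl
  go (suc (suc n)) (acc rs) = begin
    2 + n                           ≡⟨ cong (2 +_) (sym (⌊n/2⌋+⌈n/2⌉≡n n)) ⟩
    2 + (⌊ n /2⌋ + ⌈ n /2⌉)         ≤⟨ s≤s (s≤s (+-monoˡ-≤ _ (⌊n/2⌋≤⌈n/2⌉ n))) ⟩
    2 + (⌈ n /2⌉ + ⌈ n /2⌉)         ≡⟨ cong suc (sym (+-suc ⌈ n /2⌉ ⌈ n /2⌉)) ⟩
    suc ⌈ n /2⌉ + suc ⌈ n /2⌉       ≡⟨ cong (suc ⌈ n /2⌉ +_) (sym (+-identityʳ _)) ⟩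
    2 * suc ⌈ n /2⌉                 ≤⟨ *-monoʳ-≤ 2 (go (suc ⌈ n /2⌉) (rs (⌈n/2⌉<n n))) ⟩
    2 * 2 ^ ⌈log2⌉ (suc ⌈ n /2⌉) (rs (⌈n/2⌉<n n)) ∎

bits-mono : ∀ {m n} → m ≤ n → bits m ≤ bits n
bits-mono m≤n = ⌈log₂⌉-mono-≤ (s≤s m≤n)

private
  -- Both m * n and m + n are less than (m + 1) * (n + 1), and the logarithm turns this product into
  -- a sum.
  bits-below : ∀ {k} m n → suc k ≤ suc m * suc n → bits k ≤ bits m + bits n
  bits-below {k} m n k≤ = begin
    ⌈log₂ suc k ⌉                       ≤⟨ ⌈log₂⌉-mono-≤ k≤ ⟩
    ⌈log₂ suc m * suc n ⌉               ≤⟨ ⌈log₂⌉-mono-≤ (*-mono-≤ (n≤2^⌈log₂n⌉ (suc m)) (n≤2^⌈log₂n⌉ (suc n))) ⟩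
    ⌈log₂ 2 ^ bits m * 2 ^ bits n ⌉     ≡⟨ cong ⌈log₂_⌉ (sym (^-distribˡ-+-* 2 (bits m) (bits n))) ⟩
    ⌈log₂ 2 ^ (bits m + bits n) ⌉       ≡⟨ ⌈log₂2^n⌉≡n (bits m + bits n) ⟩
    bits m + bits n                     ∎
    where open ≤-Reasoning

bits-* : ∀ m n → bits (m * n) ≤ bits m + bits n
bits-* m n = bits-below m n (s≤s (begin
  m * n           ≤⟨ m≤n+m (m * n) m ⟩
  m + m * n       ≡⟨ sym (*-suc m n) ⟩
  m * suc n       ≤⟨ m≤n+m _ n ⟩
  n + m * suc n   ∎))
  where open ≤-Reasoning

bits-+ : ∀ m n → bits (m + n) ≤ bits m + bits n
bits-+ m n = bits-below m n (s≤s (begin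
  m + n           ≡⟨ +-comm m n ⟩
  n + m           ≤⟨ +-monoʳ-≤ n (m≤m*n m (suc n)) ⟩
  n + m * suc n   ∎))
  where open ≤-Reasoning

-- Normalising a fraction divides by a gcd, so results of arithmetic may be bounded through their
-- unreduced numerators and denominators.
∣↥/∣≤ : ∀ i d .{{_ : NonZero d}} → ℤ.∣ ↥ (i ℚ./ d) ∣ ≤ ℤ.∣ i ∣
∣↥/∣≤ i d = begin
  ℤ.∣ ↥ (i ℚ./ d) ∣                           ≤⟨ m≤m*n _ g {{gcd≢0}} ⟩
  ℤ.∣ ↥ (i ℚ./ d) ∣ * g                       ≡⟨ sym (ℤ.abs-* (↥ (i ℚ./ d)) (ℤ.gcd i (ℤ.+ d))) ⟩
  ℤ.∣ ↥ (i ℚ./ d) ℤ.* ℤ.gcd i (ℤ.+ d) ∣         ≡⟨ cong ℤ.∣_∣ (ℚ.↥-/ i d) ⟩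
  ℤ.∣ i ∣                                     ∎
  where
  open ≤-Reasoning
  g = ℤ.∣ ℤ.gcd i (ℤ.+ d) ∣
  gcd≢0 : NonZero g
  gcd≢0 = ≢-nonZero λ g≡0 → ≢-nonZero⁻¹ d
    (ℤ.+-injective (ℤ.gcd[i,j]≡0⇒j≡0 {i} (cong ℤ.+_ g≡0)))

↧/≤ : ∀ i d .{{_ : NonZero d}} → ↧ₙ (i ℚ./ d) ≤ d
↧/≤ i d = begin
  ↧ₙ (i ℚ./ d)                                ≤⟨ m≤m*n _ g {{gcd≢0}} ⟩
  ↧ₙ (i ℚ./ d) * g                            ≡⟨ sym (ℤ.abs-* (↧ (i ℚ./ d)) (ℤ.gcd i (ℤ.+ d))) ⟩
  ℤ.∣ ↧ (i ℚ./ d) ℤ.* ℤ.gcd i (ℤ.+ d) ∣         ≡⟨ cong ℤ.∣_∣ (ℚ.↧-/ i d) ⟩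
  d                                           ∎
  where
  open ≤-Reasoning
  g = ℤ.∣ ℤ.gcd i (ℤ.+ d) ∣
  gcd≢0 : NonZero g
  gcd≢0 = ≢-nonZero λ g≡0 → ≢-nonZero⁻¹ d
    (ℤ.+-injective (ℤ.gcd[i,j]≡0⇒j≡0 {i} (cong ℤ.+_ g≡0)))

1≤size : ∀ d → 1 ≤ size d
1≤size nil        = ≤-refl
1≤size (num q)    = s≤s z≤n
1≤size (pair d e) = s≤s z≤n

size-truth : ∀ b → size (truth b) ≤ 3
size-truth true  = ≤-refl
size-truth false = s≤s z≤n

private
  size-neg : ∀ q → size (num (ℚ.- q)) ≡ size (num q)
  size-neg q = cong₂ (λ m n → 1 + bits m + bits n)
    (trans (cong ℤ.∣_∣ (ℚ.↥-neg q)) (ℤ.∣-i∣≡∣i∣ (↥ q)))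
    (cong ℤ.∣_∣ (ℚ.↧-neg q))

  size-inverse : ∀ q → size (num (inverse q)) ≤ size (num q)
  size-inverse q with q ℚ.≟ 0ℚ
  ... | yes refl = ≤-refl
  ... | no  q≢0  = swap q {{ℚ.≢-nonZero q≢0}}
    where
    swap : ∀ q .{{_ : ℚ.NonZero q}} → size (num (ℚ.1/ q)) ≤ size (num q)
    swap (ℚ.mkℚ ℤ.+[1+ n ] d _) = s≤s (≤-reflexive (+-comm (bits (suc d)) (bits (suc n))))
    swap (ℚ.mkℚ ℤ.-[1+ n ] d _) = s≤s (≤-reflexive (+-comm (bits (suc d)) (bits (suc n))))

size-op₁ : ∀ o d → size (⟦ o ⟧₁ d) ≤ size d
size-op₁ fst nil        = ≤-refl
size-op₁ fst (num q)    = 1≤size (num q)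
size-op₁ fst (pair d e) = m≤n⇒m≤1+n (m≤m+n _ _)
size-op₁ snd nil        = ≤-refl
size-op₁ snd (num q)    = 1≤size (num q)
size-op₁ snd (pair d e) = m≤n⇒m≤1+n (m≤n+m _ _)
size-op₁ neg nil        = ≤-refl
size-op₁ neg (num q)    = ≤-reflexive (size-neg q)
size-op₁ neg (pair d e) = s≤s z≤n
size-op₁ inv nil        = ≤-refl
size-op₁ inv (num q)    = size-inverse q
size-op₁ inv (pair d e) = s≤s z≤n

private
  +-interchange : ∀ a b c d → (a + c) + (b + d) ≡ (a + b) + (c + d)
  +-interchange = solve-∀

size-mul : ∀ p q → size (num (p ℚ.* q)) ≤ size (num p) + size (num q)
size-mul p@record{} q@record{} = s≤s (begin
  bits ℤ.∣ ↥ (p ℚ.* q) ∣ + bits (↧ₙ (p ℚ.* q))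
    ≤⟨ +-mono-≤ (bits-mono (≤-trans (∣↥/∣≤ (↥ p ℤ.* ↥ q) (↧ₙ p * ↧ₙ q)) (≤-reflexive (ℤ.abs-* (↥ p) (↥ q)))))
                (bits-mono (↧/≤ (↥ p ℤ.* ↥ q) (↧ₙ p * ↧ₙ q))) ⟩
  bits (ℤ.∣ ↥ p ∣ * ℤ.∣ ↥ q ∣) + bits (↧ₙ p * ↧ₙ q)
    ≤⟨ +-mono-≤ (bits-* ℤ.∣ ↥ p ∣ ℤ.∣ ↥ q ∣) (bits-* (↧ₙ p) (↧ₙ q)) ⟩
  (bits ℤ.∣ ↥ p ∣ + bits ℤ.∣ ↥ q ∣) + (bits (↧ₙ p) + bits (↧ₙ q))
    ≡⟨ +-interchange (bits ℤ.∣ ↥ p ∣) (bits (↧ₙ p)) (bits ℤ.∣ ↥ q ∣) (bits (↧ₙ q)) ⟩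
  (bits ℤ.∣ ↥ p ∣ + bits (↧ₙ p)) + (bits ℤ.∣ ↥ q ∣ + bits (↧ₙ q))
    ≤⟨ +-monoʳ-≤ (bits ℤ.∣ ↥ p ∣ + bits (↧ₙ p)) (n≤1+n _) ⟩
  (bits ℤ.∣ ↥ p ∣ + bits (↧ₙ p)) + suc (bits ℤ.∣ ↥ q ∣ + bits (↧ₙ q)) ∎)
  where open ≤-Reasoning

-- Each denominator enters a numerator as well as the common denominator, hence the factor 2, in
-- contrast to `size-mul`. Iterated, the factor would be exponential, which is why `grade₂` admits
-- an accumulator as an operand of `mul` but not of `add`.
size-add : ∀ p q → size (num (p ℚ.+ q)) ≤ (size (num p) + size (num q)) + (size (num p) + size (num q))
size-add p@record{} q@record{} = s≤s (begin
  bits ℤ.∣ ↥ (p ℚ.+ q) ∣ + bits (↧ₙ (p ℚ.+ q))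
    ≤⟨ +-mono-≤ (bits-mono (≤-trans (∣↥/∣≤ n (↧ₙ p * ↧ₙ q)) (ℤ.∣i+j∣≤∣i∣+∣j∣ (↥ p ℤ.* ↧ q) (↥ q ℤ.* ↧ p))))
                (bits-mono (↧/≤ n (↧ₙ p * ↧ₙ q))) ⟩
  bits (ℤ.∣ ↥ p ℤ.* ↧ q ∣ + ℤ.∣ ↥ q ℤ.* ↧ p ∣) + bits (↧ₙ p * ↧ₙ q)
    ≤⟨ +-mono-≤ (bits-+ ℤ.∣ ↥ p ℤ.* ↧ q ∣ _) (bits-* (↧ₙ p) (↧ₙ q)) ⟩
  (bits ℤ.∣ ↥ p ℤ.* ↧ q ∣ + bits ℤ.∣ ↥ q ℤ.* ↧ p ∣) + (bits (↧ₙ p) + bits (↧ₙ q))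
    ≤⟨ +-monoˡ-≤ _ (+-mono-≤ (b* (↥ p) (↧ q)) (b* (↥ q) (↧ p))) ⟩
  ((pn + qd) + (qn + pd)) + (pd + qd)
    ≡⟨ cong (_+ (pd + qd)) (trans (cong ((pn + qd) +_) (+-comm qn pd)) (+-interchange pn pd qd qn)) ⟩
  ((pn + pd) + (qd + qn)) + (pd + qd)
    ≡⟨ cong (λ h → ((pn + pd) + h) + (pd + qd)) (+-comm qd qn) ⟩
  ((pn + pd) + (qn + qd)) + (pd + qd)
    ≤⟨ +-mono-≤ (+-monoʳ-≤ (pn + pd) (n≤1+n (qn + qd))) (+-mono-≤ (m≤n⇒m≤1+n (m≤n+m pd pn)) (m≤n⇒m≤1+n (m≤n+m qd qn))) ⟩
  ((pn + pd) + suc (qn + qd)) + (suc (pn + pd) + suc (qn + qd)) ∎)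
  where
  open ≤-Reasoning
  n = ↥ p ℤ.* ↧ q ℤ.+ ↥ q ℤ.* ↧ p
  pn = bits ℤ.∣ ↥ p ∣
  qn = bits ℤ.∣ ↥ q ∣
  pd = bits (↧ₙ p)
  qd = bits (↧ₙ q)
  b* : ∀ i j → bits ℤ.∣ i ℤ.* j ∣ ≤ bits ℤ.∣ i ∣ + bits ℤ.∣ j ∣
  b* i j = ≤-trans (≤-reflexive (cong bits (ℤ.abs-* i j))) (bits-* ℤ.∣ i ∣ ℤ.∣ j ∣)

-- A total language with bounded loops

data Ex (n : ℕ) : Set where
  var   : Fin n → Ex n
  const : Data → Ex n
  op₁   : Op₁ → Ex n → Ex n
  op₂   : Op₂ → Ex n → Ex n → Ex n
  query : Ex n → Ex n
  cond  : Ex n → Ex n → Ex n → Ex n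
  bind  : Ex n → Ex (suc n) → Ex n
  -- In the body, variable 0 is the accumulator, 1 the current item, 2 the
  -- list of the items after it and 3 the internal state of the loop.
  for   : Ex n → Ex n → Ex (4 + n) → Ex n

-- A layer above `Ex` for loops whose growth the grades cannot bound: the body of `iter` is
-- unrestricted, and the sizes of its accumulators are supplied through `Fits`.
data Pr (n : ℕ) : Set where
  exp  : Ex n → Pr n
  bind : Pr n → Pr (suc n) → Pr n
  iter : Ex n → Ex n → Pr (4 + n) → Pr n

ite : ∀ {A : Set} → Data → A → A → A
ite nil        x y = y
ite (num _)    x y = x
ite (pair _ _) x y = x

-- A number counts as true, while its `fst` and `snd` are `nil`. A number in the place of a list
-- therefore yields exactly one pass, with item and rest `nil`, as it does in `loop`.
iterate : (Data → Data → Data → Data → Data) → Data → Data → Data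
iterate f nil          a = a
iterate f xs@(num _)    a = f a nil nil (pair xs a)
iterate f xs@(pair d e) a = iterate f e (f a d e (pair xs a))

iterations : Data → ℕ
iterations nil        = 0
iterations (num _)    = 1
iterations (pair d e) = suc (iterations e)

iterations≤size : ∀ d → iterations d ≤ size d
iterations≤size nil        = z≤n
iterations≤size (num _)    = s≤s z≤n
iterations≤size (pair d e) = s≤s (≤-trans (iterations≤size e) (m≤n+m _ _))

module _ {n : ℕ} where

  loopBody : Tm (4 + n) → Tm (suc n)
  loopBody b =
    bind (op₁ snd (op₁ fst (var zero)))
      (bind (op₁ fst (op₁ fst (var (suc zero))))
        (bind (op₁ snd (var (suc (suc zero))))
          (op₂ cons (var (suc (suc zero))) b)))

  loop : Tm n → Tm n → Tm (4 + n) → Tm n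
  loop xs i b = op₁ snd (while (op₂ cons xs i) (op₁ fst (var zero)) (loopBody b))

⌜_⌝ : ∀ {n} → Ex n → Tm n
⌜ var i ⌝      = var i
⌜ const d ⌝    = const d
⌜ op₁ o e ⌝    = op₁ o ⌜ e ⌝
⌜ op₂ o e f ⌝  = op₂ o ⌜ e ⌝ ⌜ f ⌝
⌜ query e ⌝    = query ⌜ e ⌝
⌜ cond b t u ⌝ = cond ⌜ b ⌝ ⌜ t ⌝ ⌜ u ⌝
⌜ bind t u ⌝   = bind ⌜ t ⌝ ⌜ u ⌝
⌜ for xs i b ⌝ = loop ⌜ xs ⌝ ⌜ i ⌝ ⌜ b ⌝

⌜_⌝ₚ : ∀ {n} → Pr n → Tm n
⌜ exp e ⌝ₚ       = ⌜ e ⌝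
⌜ bind p q ⌝ₚ    = bind ⌜ p ⌝ₚ ⌜ q ⌝ₚ
⌜ iter xs i b ⌝ₚ = loop ⌜ xs ⌝ ⌜ i ⌝ ⌜ b ⌝ₚ

-- The grade of a term bounds the growth of its value relative to a number A
-- (the size of accumulators): it is polynomial in the sizes of the small
-- variables, exceeds A by at most such a polynomial, or is unrestricted.
-- Loop bodies that at most add to their accumulator preserve polynomial size.

data Grade : Set where
  small big wild : Grade

-- Sizes add under pairing and multiplication, so two `big` operands could reach 2A. A conditional
-- returns only one of its values, so there `_⊔ᵍ_` takes a maximum.
_⊔ᶜ_ : Grade → Grade → Grade
small ⊔ᶜ g     = g
g     ⊔ᶜ small = g
_     ⊔ᶜ _     = wild

_⊔ᵍ_ : Grade → Grade → Grade
wild  ⊔ᵍ _     = wild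
small ⊔ᵍ g     = g
big   ⊔ᵍ wild  = wild
big   ⊔ᵍ _     = big

-- Inside a loop, A becomes the size of the accumulator of that loop. If its initial value is `big`,
-- the new A can be chosen above the old one and `big` variables stay `big`. Otherwise nothing
-- relates the two, and only `small` variables keep their grade.
hide : Grade → Grade → Grade
hide big g     = g
hide _   small = small
hide _   _     = wild

bodyContext : ∀ {n} → Grade → Vec Grade n → Vec Grade (4 + n)
bodyContext g Γ = big ∷ small ∷ small ∷ big ∷ Vec.map (hide g) Γ

-- With a small number of passes, each of which adds a small amount, the result exceeds the initial
-- value by a small amount only and inherits its grade.
loopGrade : Grade → Grade → Grade → Grade
loopGrade small i    wild = wild
loopGrade small i    _    = i
loopGrade _     _    _    = wild

grade₂ : Op₂ → Grade → Grade → Grade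
grade₂ leq  g     h     = small
grade₂ add  small small = small
grade₂ add  _     _     = wild
grade₂ cons g     h     = g ⊔ᶜ h
grade₂ mul  g     h     = g ⊔ᶜ h

pol₂ : Op₂ → Pol → Pol → Pol
pol₂ leq  p q = C 3
pol₂ add  p q = C 1 ⊕ ((p ⊕ q) ⊕ (p ⊕ q))
pol₂ cons p q = C 1 ⊕ (p ⊕ q)
pol₂ mul  p q = C 1 ⊕ (p ⊕ q)

bodyArg : Pol → Pol
bodyArg p = 𝕏 ⊕ (C 1 ⊕ p)

gr : ∀ {n} → Vec Grade n → Ex n → Grade
gr Γ (var i)      = Vec.lookup Γ i
gr Γ (const d)    = small
gr Γ (op₁ o e)    = gr Γ e
gr Γ (op₂ o e f)  = grade₂ o (gr Γ e) (gr Γ f)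
gr Γ (query e)    = small
gr Γ (cond b t u) = gr Γ t ⊔ᵍ gr Γ u
gr Γ (bind t u)   = gr (gr Γ t ∷ Γ) u
gr Γ (for xs i b) = loopGrade (gr Γ xs) (gr Γ i) (gr (bodyContext (gr Γ i) Γ) b)

pol : ∀ {n} → Ex n → Pol
pol (var i)      = 𝕏
pol (const d)    = C (size d)
pol (op₁ o e)    = pol e
pol (op₂ o e f)  = pol₂ o (pol e) (pol f)
pol (query e)    = C 3
pol (cond b t u) = pol t ⊕ pol u
pol (bind t u)   = pol u [ 𝕏 ⊕ pol t ]ᵖ
pol (for xs i b) = pol i ⊕ pol xs ⊗ (pol b [ bodyArg (pol xs) ]ᵖ)

-- Soundness of the grades

Within : Grade → ℕ → ℕ → ℕ → Set
Within small A p n = n ≤ p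
Within big   A p n = n ≤ A + p
Within wild  A p n = Unit

EnvWithin : ∀ {n} → Vec Grade n → ℕ → ℕ → Vec Data n → Set
EnvWithin Γ A s ρ = ∀ i → Within (Vec.lookup Γ i) A s (size (Vec.lookup ρ i))

within-mono : ∀ g {A B p q n} → A ≤ B → p ≤ q → Within g A p n → Within g B q n
within-mono small A≤B p≤q n≤ = ≤-trans n≤ p≤q
within-mono big   A≤B p≤q n≤ = ≤-trans n≤ (+-mono-≤ A≤B p≤q)
within-mono wild  A≤B p≤q _  = tt

within-≤ : ∀ g {A p m n} → m ≤ n → Within g A p n → Within g A p m
within-≤ small m≤n n≤ = ≤-trans m≤n n≤
within-≤ big   m≤n n≤ = ≤-trans m≤n n≤
within-≤ wild  m≤n _  = tt

private
  within-small : ∀ g {A p n} → n ≤ p → Within g A p n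
  within-small small n≤p = n≤p
  within-small big   n≤p = ≤-trans n≤p (m≤n+m _ _)
  within-small wild  n≤p = tt

  within-⊔ˡ : ∀ g h {A p q n} → Within g A p n → Within (g ⊔ᵍ h) A (p + q) n
  within-⊔ˡ small h     w = within-small h (≤-trans w (m≤m+n _ _))
  within-⊔ˡ big   small {A} w = ≤-trans w (+-monoʳ-≤ A (m≤m+n _ _))
  within-⊔ˡ big   big   {A} w = ≤-trans w (+-monoʳ-≤ A (m≤m+n _ _))
  within-⊔ˡ big   wild  w = tt
  within-⊔ˡ wild  h     w = tt

  within-⊔ʳ : ∀ g h {A p q n} → Within h A q n → Within (g ⊔ᵍ h) A (p + q) n
  within-⊔ʳ small h     w = within-mono h ≤-refl (m≤n+m _ _) w
  within-⊔ʳ big   small {A} {p} {q} w = within-small big {A} (≤-trans w (m≤n+m q p))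
  within-⊔ʳ big   big   {A} {p} {q} w = ≤-trans w (+-monoʳ-≤ A (m≤n+m q p))
  within-⊔ʳ big   wild  w = tt
  within-⊔ʳ wild  h     w = tt

  within-⊔ᶜ : ∀ g h {A p q m n} → Within g A p m → Within h A q n →
              Within (g ⊔ᶜ h) A (1 + (p + q)) (1 + (m + n))
  within-⊔ᶜ small small v w = s≤s (+-mono-≤ v w)
  within-⊔ᶜ small big {A} {p} {q} {m} {n} v w = begin
    1 + (m + n)         ≤⟨ s≤s (+-mono-≤ v w) ⟩
    1 + (p + (A + q))   ≡⟨ cong suc (sym (+-assoc p A q)) ⟩
    1 + (p + A + q)     ≡⟨ cong (λ h → 1 + (h + q)) (+-comm p A) ⟩
    1 + (A + p + q)     ≡⟨ cong suc (+-assoc A p q) ⟩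
    1 + (A + (p + q))   ≡⟨ sym (+-suc A (p + q)) ⟩
    A + (1 + (p + q))   ∎
    where open ≤-Reasoning
  within-⊔ᶜ big small {A} {p} {q} {m} {n} v w = begin
    1 + (m + n)         ≤⟨ s≤s (+-mono-≤ v w) ⟩
    1 + (A + p + q)     ≡⟨ cong suc (+-assoc A p q) ⟩
    1 + (A + (p + q))   ≡⟨ sym (+-suc A (p + q)) ⟩
    A + (1 + (p + q))   ∎
    where open ≤-Reasoning
  within-⊔ᶜ small wild  v w = tt
  within-⊔ᶜ big   big   v w = tt
  within-⊔ᶜ big   wild  v w = tt
  within-⊔ᶜ wild  small v w = tt
  within-⊔ᶜ wild  big   v w = tt
  within-⊔ᶜ wild  wild  v w = tt

  size-mul′ : ∀ d e → size (⟦ mul ⟧₂ d e) ≤ 1 + (size d + size e)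
  size-mul′ (num p)    (num q)    = m≤n⇒m≤1+n (size-mul p q)
  size-mul′ nil        _          = s≤s z≤n
  size-mul′ (pair _ _) _          = s≤s z≤n
  size-mul′ (num _)    nil        = s≤s z≤n
  size-mul′ (num _)    (pair _ _) = s≤s z≤n

  size-add′ : ∀ d e → size (⟦ add ⟧₂ d e) ≤ 1 + ((size d + size e) + (size d + size e))
  size-add′ (num p)    (num q)    = m≤n⇒m≤1+n (size-add p q)
  size-add′ nil        _          = s≤s z≤n
  size-add′ (pair _ _) _          = s≤s z≤n
  size-add′ (num _)    nil        = s≤s z≤n
  size-add′ (num _)    (pair _ _) = s≤s z≤n

  size-leq′ : ∀ d e → size (⟦ leq ⟧₂ d e) ≤ 3
  size-leq′ (num p)    (num q)    = size-truth (does (p ℚ.≤? q))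
  size-leq′ nil        _          = s≤s z≤n
  size-leq′ (pair _ _) _          = s≤s z≤n
  size-leq′ (num _)    nil        = s≤s z≤n
  size-leq′ (num _)    (pair _ _) = s≤s z≤n

within-grade₂ : ∀ o g h {A} p q {s d e} →
                Within g A (⟦ p ⟧ s) (size d) → Within h A (⟦ q ⟧ s) (size e) →
                Within (grade₂ o g h) A (⟦ pol₂ o p q ⟧ s) (size (⟦ o ⟧₂ d e))
within-grade₂ cons g h p q v w = within-⊔ᶜ g h v w
within-grade₂ leq  g h p q {d = d} {e} v w = size-leq′ d e
within-grade₂ mul  g h p q {d = d} {e} v w =
  within-≤ (g ⊔ᶜ h) (size-mul′ d e) (within-⊔ᶜ g h v w)
within-grade₂ add  small small p q {d = d} {e} v w =
  ≤-trans (size-add′ d e) (s≤s (+-mono-≤ (+-mono-≤ v w) (+-mono-≤ v w)))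
within-grade₂ add  small big   p q v w = tt
within-grade₂ add  small wild  p q v w = tt
within-grade₂ add  big   h     p q v w = tt
within-grade₂ add  wild  h     p q v w = tt

module Loop (f : Data → Data → Data → Data → Data) (P : Data → Data → Set)
  (P-step : ∀ xs a → xs ≢ nil → P xs a →
            P (⟦ snd ⟧₁ xs) (f a (⟦ fst ⟧₁ xs) (⟦ snd ⟧₁ xs) (pair xs a))) where

  iterate-inv : ∀ xs a → P xs a → P nil (iterate f xs a)
  iterate-inv nil            a p = p
  iterate-inv xs@(num _)    a p = P-step xs a (λ ()) p
  iterate-inv xs@(pair d e) a p = iterate-inv e _ (P-step xs a (λ ()) p)

iterations-snd : ∀ xs → xs ≢ nil → iterations xs ≡ suc (iterations (⟦ snd ⟧₁ xs))
iterations-snd nil        ≢nil = contradiction refl ≢nil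
iterations-snd (num _)    _    = refl
iterations-snd (pair _ _) _    = refl

-- The bound on an accumulator that starts below a₀ and grows by at most p in
-- each of the remaining iterations.
Budget : ℕ → ℕ → ℕ → ℕ → Data → Data → Set
Budget sx a₀ p B xs v =
  size xs ≤ sx × (∃[ a ] (size v ≤ a × a₀ ≤ a × a + iterations xs * p ≤ B))

module _ (Oracle : Data → Bool) where

  eval : ∀ {n} → Ex n → Vec Data n → Data
  eval (var i)      ρ = Vec.lookup ρ i
  eval (const d)    ρ = d
  eval (op₁ o e)    ρ = ⟦ o ⟧₁ (eval e ρ)
  eval (op₂ o e f)  ρ = ⟦ o ⟧₂ (eval e ρ) (eval f ρ)
  eval (query e)    ρ = truth (Oracle (eval e ρ))
  eval (cond b t u) ρ = ite (eval b ρ) (eval t ρ) (eval u ρ)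
  eval (bind t u)   ρ = eval u (eval t ρ ∷ ρ)
  eval (for xs i b) ρ =
    iterate (λ a d e st → eval b (a ∷ d ∷ e ∷ st ∷ ρ)) (eval xs ρ) (eval i ρ)

  evalₚ : ∀ {n} → Pr n → Vec Data n → Data
  evalₚ (exp e)       ρ = eval e ρ
  evalₚ (bind p q)    ρ = evalₚ q (evalₚ p ρ ∷ ρ)
  evalₚ (iter xs i b) ρ =
    iterate (λ a d e st → evalₚ b (a ∷ d ∷ e ∷ st ∷ ρ)) (eval xs ρ) (eval i ρ)

  -- The grade of the body is applied with A equal to the current bound a. The growth is then at
  -- most the value of `pol b`, the same in every pass, so the total growth is linear in the number
  -- of passes.
  budget-step : ∀ {n} (Γ : Vec Grade n) (b : Ex (4 + n)) {sx a₀ B s} (ρ : Vec Data n) →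
    (gr (big ∷ small ∷ small ∷ big ∷ Γ) b ≢ wild) →
    (∀ ρ′ A s → EnvWithin (big ∷ small ∷ small ∷ big ∷ Γ) A s ρ′ →
       Within (gr (big ∷ small ∷ small ∷ big ∷ Γ) b) A (⟦ pol b ⟧ s) (size (eval b ρ′))) →
    (∀ a → a₀ ≤ a → EnvWithin Γ a s ρ) → suc sx ≤ s →
    ∀ xs v → xs ≢ nil → Budget sx a₀ (⟦ pol b ⟧ s) B xs v →
    Budget sx a₀ (⟦ pol b ⟧ s) B (⟦ snd ⟧₁ xs)
      (eval b (v ∷ ⟦ fst ⟧₁ xs ∷ ⟦ snd ⟧₁ xs ∷ pair xs v ∷ ρ))
  budget-step Γ b {sx} {a₀} {B} {s} ρ ¬wild body env sx<s xs v ≢nil (xs≤ , a , v≤ , a₀≤ , a≤B) =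
      ≤-trans (size-op₁ snd xs) xs≤
    , a + ⟦ pol b ⟧ s
    , grown (gr _ b) ¬wild (body _ a s env′)
    , ≤-trans a₀≤ (m≤m+n _ _)
    , ≤-trans (≤-reflexive shift) a≤B
    where
    xs≤s : size xs ≤ s
    xs≤s = ≤-trans xs≤ (≤-trans (n≤1+n _) sx<s)
    env′ : EnvWithin (big ∷ small ∷ small ∷ big ∷ Γ) a s
             (v ∷ ⟦ fst ⟧₁ xs ∷ ⟦ snd ⟧₁ xs ∷ pair xs v ∷ ρ)
    env′ zero                      = ≤-trans v≤ (m≤m+n _ _)
    env′ (suc zero)                = ≤-trans (size-op₁ fst xs) xs≤s
    env′ (suc (suc zero))          = ≤-trans (size-op₁ snd xs) xs≤s
    env′ (suc (suc (suc zero)))    = ≤-trans (+-mono-≤ (≤-trans (s≤s xs≤) sx<s) v≤) (≤-reflexive (+-comm s a))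
    env′ (suc (suc (suc (suc i)))) = env a a₀≤ i
    grown : ∀ g {p k} → g ≢ wild → Within g a p k → k ≤ a + p
    grown small _ w = ≤-trans w (m≤n+m _ _)
    grown big   _ w = w
    grown wild  c _ = contradiction refl c
    shift : (a + ⟦ pol b ⟧ s) + iterations (⟦ snd ⟧₁ xs) * ⟦ pol b ⟧ s ≡ a + iterations xs * ⟦ pol b ⟧ s
    shift = trans (+-assoc a _ _) (cong (λ h → a + h * ⟦ pol b ⟧ s) (sym (iterations-snd xs ≢nil)))

  private
    within-bind : ∀ g {A s t n} → Within g A t n → Within g A (s + t) n
    within-bind g = within-mono g ≤-refl (m≤n+m _ _)

  eval-within : ∀ {n} (Γ : Vec Grade n) (e : Ex n) (ρ : Vec Data n) A s →
                EnvWithin Γ A s ρ → Within (gr Γ e) A (⟦ pol e ⟧ s) (size (eval e ρ))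
  eval-within Γ (var i)      ρ A s env = env i
  eval-within Γ (const d)    ρ A s env = ≤-refl
  eval-within Γ (op₁ o e)    ρ A s env =
    within-≤ (gr Γ e) (size-op₁ o (eval e ρ)) (eval-within Γ e ρ A s env)
  eval-within Γ (op₂ o e f)  ρ A s env =
    within-grade₂ o (gr Γ e) (gr Γ f) (pol e) (pol f)
      (eval-within Γ e ρ A s env) (eval-within Γ f ρ A s env)
  eval-within Γ (query e)    ρ A s env = size-truth (Oracle (eval e ρ))
  eval-within Γ (cond b t u) ρ A s env = branch (eval b ρ)
    where
    l = within-⊔ˡ (gr Γ t) (gr Γ u) (eval-within Γ t ρ A s env)
    r = within-⊔ʳ (gr Γ t) (gr Γ u) (eval-within Γ u ρ A s env)
    branch : ∀ v → Within (gr Γ t ⊔ᵍ gr Γ u) A (⟦ pol t ⟧ s + ⟦ pol u ⟧ s) (size (ite v (eval t ρ) (eval u ρ)))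
    branch nil        = r
    branch (num _)    = l
    branch (pair _ _) = l
  eval-within Γ (bind t u)   ρ A s env =
    subst (λ p → Within (gr (gr Γ t ∷ Γ) u) A p (size (eval u (eval t ρ ∷ ρ)))) (sym (⟦[]ᵖ⟧ (pol u) (𝕏 ⊕ pol t) s))
      (eval-within (gr Γ t ∷ Γ) u (eval t ρ ∷ ρ) A (s + ⟦ pol t ⟧ s) env′)
    where
    env′ : EnvWithin (gr Γ t ∷ Γ) A (s + ⟦ pol t ⟧ s) (eval t ρ ∷ ρ)
    env′ zero    = within-bind (gr Γ t) (eval-within Γ t ρ A s env)
    env′ (suc i) = within-mono (Vec.lookup Γ i) ≤-refl (m≤m+n _ _) (env i)
  eval-within Γ (for xs i b) ρ A s env =
    final (gr Γ xs) (gr Γ i) (eval-within Γ xs ρ A s env) (eval-within Γ i ρ A s env)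
      (λ ρ′ A s → eval-within (bodyContext (gr Γ i) Γ) b ρ′ A s)
    where
    v = eval i ρ
    f : Data → Data → Data → Data → Data
    f a d e st = eval b (a ∷ d ∷ e ∷ st ∷ ρ)
    px = ⟦ pol xs ⟧ s
    pi = ⟦ pol i ⟧ s
    s′ = s + (1 + px)
    pb = ⟦ pol b ⟧ s′
    final : ∀ gx gi → Within gx A px (size (eval xs ρ)) → Within gi A pi (size v) →
            (∀ ρ′ A s → EnvWithin (bodyContext gi Γ) A s ρ′ →
               Within (gr (bodyContext gi Γ) b) A (⟦ pol b ⟧ s) (size (eval b ρ′))) →
            Within (loopGrade gx gi (gr (bodyContext gi Γ) b)) A (⟦ pol (for xs i b) ⟧ s)
                   (size (iterate f (eval xs ρ) v))
    final big   gi wx wi body = tt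
    final wild  gi wx wi body = tt
    final small gi wx wi body = go gi wi body
      where
      run : ∀ gi a₀ → (∀ a → a₀ ≤ a → EnvWithin (Vec.map (hide gi) Γ) a s′ ρ) → size v ≤ a₀ →
            gr (bodyContext gi Γ) b ≢ wild →
            (∀ ρ′ A s → EnvWithin (bodyContext gi Γ) A s ρ′ →
               Within (gr (bodyContext gi Γ) b) A (⟦ pol b ⟧ s) (size (eval b ρ′))) →
            size (iterate f (eval xs ρ) v) ≤ a₀ + px * ⟦ pol b [ bodyArg (pol xs) ]ᵖ ⟧ s
      run gi a₀ outer v≤ ¬wild body with
        Loop.iterate-inv f (Budget px a₀ pb (a₀ + px * pb))
          (budget-step (Vec.map (hide gi) Γ) b ρ ¬wild body outer (m≤n+m (suc px) s)) (eval xs ρ) v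
          (wx , a₀ , v≤ , ≤-refl , +-monoʳ-≤ a₀ (*-monoˡ-≤ pb (≤-trans (iterations≤size (eval xs ρ)) wx)))
      ... | _ , a , r≤ , _ , a≤ = ≤-trans r≤ (≤-trans (≤-trans (m≤m+n a 0) a≤)
              (≤-reflexive (cong (λ h → a₀ + px * h) (sym (⟦[]ᵖ⟧ (pol b) (bodyArg (pol xs)) s)))))
      outer : ∀ gi a₀ → (gi ≡ big → A ≤ a₀) → ∀ a → a₀ ≤ a → EnvWithin (Vec.map (hide gi) Γ) a s′ ρ
      outer gi a₀ A≤ a a₀≤a i rewrite Vec.lookup-map i (hide gi) Γ =
        hidden gi (Vec.lookup Γ i) A≤ (within-mono (Vec.lookup Γ i) ≤-refl (m≤m+n s _) (env i))
        where
        hidden : ∀ gi g {p n} → (gi ≡ big → A ≤ a₀) → Within g A p n → Within (hide gi g) a p n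
        hidden big   g     A≤ w = within-mono g (≤-trans (A≤ refl) a₀≤a) ≤-refl w
        hidden small small A≤ w = w
        hidden small big   A≤ w = tt
        hidden small wild  A≤ w = tt
        hidden wild  small A≤ w = w
        hidden wild  big   A≤ w = tt
        hidden wild  wild  A≤ w = tt
      conclude : ∀ gi gb {k} →
                 (gb ≢ wild → Within gi A (⟦ pol (for xs i b) ⟧ s) k) →
                 Within (loopGrade small gi gb) A (⟦ pol (for xs i b) ⟧ s) k
      conclude gi wild  w = tt
      conclude gi small w = w (λ ())
      conclude gi big   w = w (λ ())
      go : ∀ gi → Within gi A pi (size v) →
           (∀ ρ′ A s → EnvWithin (bodyContext gi Γ) A s ρ′ →
              Within (gr (bodyContext gi Γ) b) A (⟦ pol b ⟧ s) (size (eval b ρ′))) →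
           Within (loopGrade small gi (gr (bodyContext gi Γ) b)) A (⟦ pol (for xs i b) ⟧ s)
                  (size (iterate f (eval xs ρ) v))
      -- A `small` initial value starts the budget at its own bound. A `big` one starts it at A +
      -- pi, which keeps the outer A below the inner one.
      go small wi body = conclude small (gr (bodyContext small Γ) b)
        (λ ¬wild → run small pi (outer small pi (λ ())) wi ¬wild body)
      go big   wi body = conclude big (gr (bodyContext big Γ) b)
        (λ ¬wild → ≤-trans (run big (A + pi) (outer big (A + pi) (λ _ → m≤m+n A pi)) wi ¬wild body)
                           (≤-reflexive (+-assoc A pi _)))
      go wild  wi body = loopGrade-wild (gr (bodyContext wild Γ) b)
        where
        loopGrade-wild : ∀ gb {p k} → Within (loopGrade small wild gb) A p k
        loopGrade-wild small = tt
        loopGrade-wild big   = tt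
        loopGrade-wild wild  = tt

-- Well-formed terms and their cost polynomials

smalls : ∀ {n} → Vec Grade n
smalls = Vec.replicate _ small

NotWild : Grade → Set
NotWild wild = ⊥
NotWild _    = Unit

-- Only loop bodies are restricted, and they are graded with all outer variables `small`. This is
-- justified by `gr-smalls`: over small variables, every well-formed term is small, and so is
-- everything that gets bound.
WF : ∀ {n} → Ex n → Set
WF (var i)      = Unit
WF (const d)    = Unit
WF (op₁ o e)    = WF e
WF (op₂ o e f)  = WF e × WF f
WF (query e)    = WF e
WF (cond b t u) = WF b × WF t × WF u
WF (bind t u)   = WF t × WF u
WF (for xs i b) = WF xs × WF i × WF b × NotWild (gr (big ∷ small ∷ small ∷ big ∷ smalls) b)

WFₚ : ∀ {n} → Pr n → Set
WFₚ (exp e)       = WF e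
WFₚ (bind p q)    = WFₚ p × WFₚ q
WFₚ (iter xs i b) = WF xs × WF i × WFₚ b

gr-smalls : ∀ {n} (e : Ex n) → WF e → gr smalls e ≡ small
gr-smalls (var i)         _         = Vec.lookup-replicate i small
gr-smalls (const d)       _         = refl
gr-smalls (op₁ o e)       wf        = gr-smalls e wf
gr-smalls (op₂ cons e f)  (we , wf) rewrite gr-smalls e we = gr-smalls f wf
gr-smalls (op₂ add e f)   (we , wf) rewrite gr-smalls e we | gr-smalls f wf = refl
gr-smalls (op₂ mul e f)   (we , wf) rewrite gr-smalls e we = gr-smalls f wf
gr-smalls (op₂ leq e f)   _         = refl
gr-smalls (query e)       _         = refl
gr-smalls (cond b t u)    (_ , wt , wu) rewrite gr-smalls t wt = gr-smalls u wu
gr-smalls (bind t u)      (wt , wu) rewrite gr-smalls t wt = gr-smalls u wu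
gr-smalls {n} (for xs i b) (wx , wi , _ , notWild)
  rewrite gr-smalls xs wx | gr-smalls i wi | Vec.map-replicate (hide small) small n
  with gr (big ∷ small ∷ small ∷ big ∷ smalls) b
... | small = refl
... | big   = refl

-- Follows the derivation for `loopBody` node by node; every value in it is the state, the next
-- state or a part of one of them and thus has size at most Q. The sum is a parameter so that the
-- same expression serves for numbers and for `Pol`.
bodyCost : ∀ {A : Set} → (A → A → A) → A → A → A
bodyCost _+_ Q R = Q + ((Q + (Q + Q)) + (Q + ((Q + (Q + Q)) + (Q + ((Q + Q) + (Q + (Q + R)))))))

iterationCost : ℕ → ℕ → ℕ
iterationCost Q R = (Q + Q) + bodyCost _+_ Q R

loopCost : Pol → Pol → Pol → Pol → Pol → Pol
loopCost Q R cx ci nx =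
  Q ⊕ (Q ⊕ ((Q ⊕ (cx ⊕ ci)) ⊕ (C 1 ⊕ nx) ⊗ ((Q ⊕ Q) ⊕ bodyCost _⊕_ Q R)))

stateBound : Pol → Pol → Pol
stateBound px pa = C 1 ⊕ (px ⊕ pa)

ct : ∀ {n} → Ex n → Pol
ct (var i)      = 𝕏
ct (const d)    = C (size d)
ct (op₁ o e)    = pol (op₁ o e) ⊕ ct e
ct (op₂ o e f)  = pol (op₂ o e f) ⊕ (ct e ⊕ ct f)
ct (query e)    = C 3 ⊕ ct e
ct (cond b t u) = pol (cond b t u) ⊕ (ct b ⊕ (ct t ⊕ ct u))
ct (bind t u)   = pol (bind t u) ⊕ (ct t ⊕ ct u [ 𝕏 ⊕ pol t ]ᵖ)
ct (for xs i b) = loopCost Q (ct b [ 𝕏 ⊕ Q ]ᵖ) (ct xs) (ct i) (pol xs)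
  where Q = stateBound (pol xs) (pol (for xs i b))

-- The result of an `iter` is its last accumulator, which `Fits` bounds by S. As S ≤ s is assumed
-- wherever the polynomial is evaluated at s, the variable itself is a bound.
polₚ : ∀ {n} → Pr n → Pol
polₚ (exp e)       = pol e
polₚ (bind p q)    = polₚ q [ 𝕏 ⊕ polₚ p ]ᵖ
polₚ (iter xs i b) = 𝕏

ctₚ : ∀ {n} → Pr n → Pol
ctₚ (exp e)       = ct e
ctₚ (bind p q)    = polₚ (bind p q) ⊕ (ctₚ p ⊕ ctₚ q [ 𝕏 ⊕ polₚ p ]ᵖ)
ctₚ (iter xs i b) = loopCost Q (ctₚ b [ 𝕏 ⊕ Q ]ᵖ) (ct xs) (ct i) (pol xs)
  where Q = stateBound (pol xs) 𝕏

-- Cost of compiled terms and programs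

module _ (Oracle : Data → Bool) where
  open Semantics Oracle

  infix 4 _⊢_⇓_within_
  _⊢_⇓_within_ : ∀ {n} → Vec Data n → Tm n → Data → ℕ → Set
  ρ ⊢ t ⇓ v within b = ∃[ k ] ((ρ ⊢ t ⇓ v ∣ k) × k ≤ b)

  module _ {n : ℕ} (ρ : Vec Data n) (b : Tm (4 + n)) (f : Data → Data → Data → Data → Data)
    (P : Data → Data → Set)
    (P-step : ∀ xs a → xs ≢ nil → P xs a →
              P (⟦ snd ⟧₁ xs) (f a (⟦ fst ⟧₁ xs) (⟦ snd ⟧₁ xs) (pair xs a)))
    (Q R : ℕ) (P-size : ∀ xs a → P xs a → size (pair xs a) ≤ Q)
    (body : ∀ xs a → xs ≢ nil → P xs a →
            (a ∷ ⟦ fst ⟧₁ xs ∷ ⟦ snd ⟧₁ xs ∷ pair xs a ∷ ρ)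
              ⊢ b ⇓ f a (⟦ fst ⟧₁ xs) (⟦ snd ⟧₁ xs) (pair xs a) within R) where

    private
      test : ∀ xs a → P xs a → (pair xs a ∷ ρ) ⊢ op₁ fst (var zero) ⇓ xs within Q + Q
      test xs a p = _ , ⇓op₁ ⇓var ,
        +-mono-≤ (≤-trans (size-op₁ fst (pair xs a)) (P-size xs a p)) (P-size xs a p)

      pass : ∀ xs a → xs ≢ nil → P xs a →
             (pair xs a ∷ ρ) ⊢ loopBody b
               ⇓ pair (⟦ snd ⟧₁ xs) (f a (⟦ fst ⟧₁ xs) (⟦ snd ⟧₁ xs) (pair xs a)) within bodyCost _+_ Q R
      pass xs a ≢nil p with body xs a ≢nil p
      ... | k , d , k≤ =
        _ , ⇓bind (⇓op₁ (⇓op₁ ⇓var)) (⇓bind (⇓op₁ (⇓op₁ ⇓var)) (⇓bind (⇓op₁ ⇓var) (⇓op₂ ⇓var d))) ,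
        +-mono-≤ new (+-mono-≤ (+-mono-≤ s (+-mono-≤ x st))
          (+-mono-≤ new (+-mono-≤ (+-mono-≤ f′ (+-mono-≤ x st))
            (+-mono-≤ new (+-mono-≤ (+-mono-≤ a′ st) (+-mono-≤ new (+-mono-≤ s k≤)))))))
        where
        new = P-size _ _ (P-step xs a ≢nil p)
        st  = P-size xs a p
        x   = ≤-trans (size-op₁ fst (pair xs a)) st
        a′  = ≤-trans (size-op₁ snd (pair xs a)) st
        s   = ≤-trans (size-op₁ snd xs) x
        f′  = ≤-trans (size-op₁ fst xs) x

    -- The successor accounts for the failing test that ends the loop, which is charged as a full
    -- iteration.
    iterate-cost : ∀ xs a → P xs a →
      ∃[ k ] ((ρ ⊢ op₁ fst (var zero) , loopBody b , pair xs a ↻ pair nil (iterate f xs a) ∣ k)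
              × k ≤ suc (iterations xs) * iterationCost Q R)
    iterate-cost nil a p with test nil a p
    ... | k , d , k≤ = k , stop d , ≤-trans k≤ (≤-trans (m≤m+n (Q + Q) _) (m≤m+n _ 0))
    iterate-cost xs@(num q) a p
      with test xs a p | pass xs a (λ ()) p | iterate-cost nil _ (P-step xs a (λ ()) p)
    ... | k , d , k≤ | l , e , l≤ | h , r , h≤ =
      k + (l + h) , next d (λ ()) e r ,
      ≤-trans (≤-reflexive (sym (+-assoc k l h))) (+-mono-≤ (+-mono-≤ k≤ l≤) h≤)
    iterate-cost xs@(pair x y) a p
      with test xs a p | pass xs a (λ ()) p | iterate-cost y _ (P-step xs a (λ ()) p)
    ... | k , d , k≤ | l , e , l≤ | h , r , h≤ =
      k + (l + h) , next d (λ ()) e r ,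
      ≤-trans (≤-reflexive (sym (+-assoc k l h))) (+-mono-≤ (+-mono-≤ k≤ l≤) h≤)

    loop-cost : ∀ {txs ti xs i cx ci nx} → ρ ⊢ txs ⇓ xs within cx → ρ ⊢ ti ⇓ i within ci →
      P xs i → iterations xs ≤ nx →
      ρ ⊢ loop txs ti b ⇓ iterate f xs i
        within Q + (Q + ((Q + (cx + ci)) + (1 + nx) * iterationCost Q R))
    loop-cost {xs = xs} {i} (kx , dx , kx≤) (ki , di , ki≤) p n≤ with iterate-cost xs i p
    ... | k , d , k≤ =
      _ , ⇓op₁ (⇓while (⇓op₂ dx di) d) ,
      +-mono-≤ (≤-trans (size-op₁ snd (pair nil (iterate f xs i))) fin)
        (+-mono-≤ fin (+-mono-≤ (+-mono-≤ (P-size xs i p) (+-mono-≤ kx≤ ki≤))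
          (≤-trans k≤ (*-monoˡ-≤ (iterationCost Q R) (s≤s n≤)))))
      where
      fin : size (pair nil (iterate f xs i)) ≤ Q
      fin = P-size _ _ (Loop.iterate-inv f P P-step xs i p)

  cond-cost : ∀ {n} {ρ : Vec Data n} {b t u v x y B kb kt ku} →
    ρ ⊢ b ⇓ v within kb → ρ ⊢ t ⇓ x within kt → ρ ⊢ u ⇓ y within ku → size (ite v x y) ≤ B →
    ρ ⊢ cond b t u ⇓ ite v x y within B + (kb + (kt + ku))
  cond-cost {v = nil} (k , d , k≤) _ (h , e , h≤) s =
    _ , ⇓else d e , +-mono-≤ s (+-mono-≤ k≤ (≤-trans h≤ (m≤n+m _ _)))
  cond-cost {v = num _} (k , d , k≤) (h , e , h≤) _ s =
    _ , ⇓then d (λ ()) e , +-mono-≤ s (+-mono-≤ k≤ (≤-trans h≤ (m≤m+n _ _)))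
  cond-cost {v = pair _ _} (k , d , k≤) (h , e , h≤) _ s =
    _ , ⇓then d (λ ()) e , +-mono-≤ s (+-mono-≤ k≤ (≤-trans h≤ (m≤m+n _ _)))

  Sized : ∀ {n} → Vec Data n → ℕ → Set
  Sized ρ s = ∀ i → size (Vec.lookup ρ i) ≤ s

  private
    sized-∷ : ∀ {n} {ρ : Vec Data n} {d s t} → Sized ρ s → size d ≤ t → Sized (d ∷ ρ) (s + t)
    sized-∷ ρ≤ d≤ zero    = ≤-trans d≤ (m≤n+m _ _)
    sized-∷ ρ≤ d≤ (suc i) = ≤-trans (ρ≤ i) (m≤m+n _ _)

    sized-body : ∀ {n} {ρ : Vec Data n} {s Q xs a} → Sized ρ s → size (pair xs a) ≤ Q →
                 Sized (a ∷ ⟦ fst ⟧₁ xs ∷ ⟦ snd ⟧₁ xs ∷ pair xs a ∷ ρ) (s + Q)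
    sized-body {s = s} {Q} {xs} {a} ρ≤ st = λ where
        zero                      → ≤-trans (size-op₁ snd (pair xs a)) st′
        (suc zero)                → ≤-trans (size-op₁ fst xs) (≤-trans (size-op₁ fst (pair xs a)) st′)
        (suc (suc zero))          → ≤-trans (size-op₁ snd xs) (≤-trans (size-op₁ fst (pair xs a)) st′)
        (suc (suc (suc zero)))    → st′
        (suc (suc (suc (suc i)))) → ≤-trans (ρ≤ i) (m≤m+n _ _)
      where
      st′ : size (pair xs a) ≤ s + Q
      st′ = ≤-trans st (m≤n+m Q s)

    recast : ∀ {n} {ρ : Vec Data n} {t v b b′} → b ≡ b′ → ρ ⊢ t ⇓ v within b → ρ ⊢ t ⇓ v within b′
    recast refl d = d

  smalls-within : ∀ {n} {ρ : Vec Data n} {A s} → Sized ρ s → EnvWithin smalls A s ρ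
  smalls-within {n} {ρ} {A} {s} ρ≤ i =
    subst (λ g → Within g A s (size (Vec.lookup ρ i))) (sym (Vec.lookup-replicate i small)) (ρ≤ i)

  eval-size : ∀ {n} (e : Ex n) {ρ s} → WF e → Sized ρ s → size (eval Oracle e ρ) ≤ ⟦ pol e ⟧ s
  eval-size e {ρ} {s} wf ρ≤ =
    subst (λ g → Within g 0 (⟦ pol e ⟧ s) (size (eval Oracle e ρ))) (gr-smalls e wf)
      (eval-within Oracle smalls e ρ 0 s (smalls-within {ρ = ρ} ρ≤))

  compile : ∀ {n} (e : Ex n) {ρ s} → WF e → Sized ρ s → ρ ⊢ ⌜ e ⌝ ⇓ eval Oracle e ρ within ⟦ ct e ⟧ s
  compile (var i)      wf ρ≤ = _ , ⇓var , ρ≤ i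
  compile (const d)    wf ρ≤ = _ , ⇓const , ≤-refl
  compile (op₁ o e)    wf ρ≤ with compile e wf ρ≤
  ... | k , d , k≤ = _ , ⇓op₁ d , +-mono-≤ (eval-size (op₁ o e) wf ρ≤) k≤
  compile (op₂ o e f)  wf@(we , wf′) ρ≤ with compile e we ρ≤ | compile f wf′ ρ≤
  ... | k , d , k≤ | h , d′ , h≤ = _ , ⇓op₂ d d′ , +-mono-≤ (eval-size (op₂ o e f) wf ρ≤) (+-mono-≤ k≤ h≤)
  compile (query e)    wf ρ≤ with compile e wf ρ≤
  ... | k , d , k≤ = _ , ⇓query d , +-mono-≤ (eval-size (query e) wf ρ≤) k≤
  compile (cond b t u) wf@(wb , wt , wu) ρ≤ =
    cond-cost (compile b wb ρ≤) (compile t wt ρ≤) (compile u wu ρ≤) (eval-size (cond b t u) wf ρ≤)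
  compile (bind t u)   {s = s} wf@(wt , wu) ρ≤
    with compile t wt ρ≤ | compile u wu (sized-∷ ρ≤ (eval-size t wt ρ≤))
  ... | k , d , k≤ | h , d′ , h≤ = _ , ⇓bind d d′ ,
    +-mono-≤ (eval-size (bind t u) wf ρ≤)
      (+-mono-≤ k≤ (≤-trans h≤ (≤-reflexive (sym (⟦[]ᵖ⟧ (ct u) (𝕏 ⊕ pol t) s)))))
  compile (for xs i b) {ρ} {s} (wx , wi , wb , notWild) ρ≤ =
    loop-cost ρ ⌜ b ⌝ _ (Budget px pi pb (pi + px * pb)) (budget-step Oracle smalls b ρ ¬wild
        (λ ρ′ A s → eval-within Oracle (big ∷ small ∷ small ∷ big ∷ smalls) b ρ′ A s)
        (λ a _ → smalls-within {ρ = ρ} λ j → ≤-trans (ρ≤ j) (m≤m+n s _)) (m≤n+m (suc px) s))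
      Q _ Q-size
      (λ ys a ≢nil p → recast (sym (⟦[]ᵖ⟧ (ct b) (𝕏 ⊕ stateBound (pol xs) (pol (for xs i b))) s))
                         (compile b wb (sized-body ρ≤ (Q-size ys a p))))
      (compile xs wx ρ≤) (compile i wi ρ≤)
      (sx , pi , si , ≤-refl , +-monoʳ-≤ pi (*-monoˡ-≤ pb (≤-trans (iterations≤size (eval Oracle xs ρ)) sx)))
      (≤-trans (iterations≤size (eval Oracle xs ρ)) sx)
    where
    px = ⟦ pol xs ⟧ s
    pi = ⟦ pol i ⟧ s
    s′ = s + (1 + px)
    pb = ⟦ pol b ⟧ s′
    Q = ⟦ stateBound (pol xs) (pol (for xs i b)) ⟧ s
    sx = eval-size xs wx ρ≤
    si = eval-size i wi ρ≤
    ¬wild : gr (big ∷ small ∷ small ∷ big ∷ smalls) b ≢ wild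
    ¬wild eq = subst NotWild eq notWild
    Q-size : ∀ ys a → Budget px pi pb (pi + px * pb) ys a → size (pair ys a) ≤ Q
    Q-size ys v (ys≤ , a , v≤ , _ , a≤) = s≤s (+-mono-≤ ys≤ (≤-trans v≤ (≤-trans (≤-trans (m≤m+n a _) a≤)
      (≤-reflexive (cong (λ h → pi + px * h) (sym (⟦[]ᵖ⟧ (pol b) (bodyArg (pol xs)) s)))))))

  module _ (S : ℕ) where

    -- The invariant of an `iter` is its actual run: every accumulator that occurs has size at most
    -- S, and G, the same requirement for the loops inside the body, holds at every pass.
    FitsLoop : (Data → Data → Data → Data → Set) → (Data → Data → Data → Data → Data) →
               Data → Data → Set
    FitsLoop G f nil           a = size a ≤ S
    FitsLoop G f xs@(num _)    a = size a ≤ S × G a nil nil (pair xs a) × size (f a nil nil (pair xs a)) ≤ S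
    FitsLoop G f xs@(pair d e) a = size a ≤ S × G a d e (pair xs a) × FitsLoop G f e (f a d e (pair xs a))

    Fits : ∀ {n} → Pr n → Vec Data n → Set
    Fits (exp e)       ρ = Unit
    Fits (bind p q)    ρ = Fits p ρ × Fits q (evalₚ Oracle p ρ ∷ ρ)
    Fits (iter xs i b) ρ =
      FitsLoop (λ a d e st → Fits b (a ∷ d ∷ e ∷ st ∷ ρ)) (λ a d e st → evalₚ Oracle b (a ∷ d ∷ e ∷ st ∷ ρ))
        (eval Oracle xs ρ) (eval Oracle i ρ)

    private
      fits-size : ∀ G f xs a → FitsLoop G f xs a → size a ≤ S
      fits-size G f nil        a s       = s
      fits-size G f (num _)    a (s , _) = s
      fits-size G f (pair _ _) a (s , _) = s

      fits-step : ∀ G f xs a → xs ≢ nil → FitsLoop G f xs a →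
                  FitsLoop G f (⟦ snd ⟧₁ xs) (f a (⟦ fst ⟧₁ xs) (⟦ snd ⟧₁ xs) (pair xs a))
      fits-step G f nil        a ≢nil _           = contradiction refl ≢nil
      fits-step G f (num _)    a _    (_ , _ , s) = s
      fits-step G f (pair _ _) a _    (_ , _ , r) = r

      fits-body : ∀ G f xs a → xs ≢ nil → FitsLoop G f xs a →
                  G a (⟦ fst ⟧₁ xs) (⟦ snd ⟧₁ xs) (pair xs a)
      fits-body G f nil        a ≢nil _           = contradiction refl ≢nil
      fits-body G f (num _)    a _    (_ , g , _) = g
      fits-body G f (pair _ _) a _    (_ , g , _) = g

    evalₚ-size : ∀ {n} (p : Pr n) {ρ s} → WFₚ p → Sized ρ s → S ≤ s → Fits p ρ →
                 size (evalₚ Oracle p ρ) ≤ ⟦ polₚ p ⟧ s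
    evalₚ-size (exp e)    wf ρ≤ S≤s _ = eval-size e wf ρ≤
    evalₚ-size (bind p q) {ρ} {s} (wp , wq) ρ≤ S≤s (fp , fq) =
      ≤-trans (evalₚ-size q wq (sized-∷ ρ≤ (evalₚ-size p wp ρ≤ S≤s fp)) (≤-trans S≤s (m≤m+n s _)) fq)
        (≤-reflexive (sym (⟦[]ᵖ⟧ (polₚ q) (𝕏 ⊕ polₚ p) s)))
    evalₚ-size (iter xs i b) {ρ} {s} wf ρ≤ S≤s fits =
      ≤-trans (Loop.iterate-inv f (FitsLoop G f) (fits-step G f) (eval Oracle xs ρ) (eval Oracle i ρ) fits) S≤s
      where
      G : Data → Data → Data → Data → Set
      G a d e st = Fits b (a ∷ d ∷ e ∷ st ∷ ρ)
      f : Data → Data → Data → Data → Data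
      f a d e st = evalₚ Oracle b (a ∷ d ∷ e ∷ st ∷ ρ)

    compileₚ : ∀ {n} (p : Pr n) {ρ s} → WFₚ p → Sized ρ s → S ≤ s → Fits p ρ →
               ρ ⊢ ⌜ p ⌝ₚ ⇓ evalₚ Oracle p ρ within ⟦ ctₚ p ⟧ s
    compileₚ (exp e)    wf ρ≤ S≤s _ = compile e wf ρ≤
    compileₚ (bind p q) {ρ} {s} wf@(wp , wq) ρ≤ S≤s fits@(fp , fq)
      with compileₚ p wp ρ≤ S≤s fp
         | compileₚ q wq (sized-∷ ρ≤ (evalₚ-size p wp ρ≤ S≤s fp)) (≤-trans S≤s (m≤m+n s _)) fq
    ... | k , d , k≤ | h , d′ , h≤ = _ , ⇓bind d d′ ,
      +-mono-≤ (evalₚ-size (bind p q) wf ρ≤ S≤s fits)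
        (+-mono-≤ k≤ (≤-trans h≤ (≤-reflexive (sym (⟦[]ᵖ⟧ (ctₚ q) (𝕏 ⊕ polₚ p) s)))))
    compileₚ (iter xs i b) {ρ} {s} (wx , wi , wb) ρ≤ S≤s fits =
      loop-cost ρ ⌜ b ⌝ₚ f P P-step Q _ Q-size
        (λ ys a ≢nil p → recast (sym (⟦[]ᵖ⟧ (ctₚ b) (𝕏 ⊕ stateBound (pol xs) 𝕏) s))
           (compileₚ b wb (sized-body ρ≤ (Q-size ys a p)) (≤-trans S≤s (m≤m+n s _)) (fits-body G f ys a ≢nil (proj₂ p))))
        (compile xs wx ρ≤) (compile i wi ρ≤) (sx , fits)
        (≤-trans (iterations≤size (eval Oracle xs ρ)) sx)
      where
      G : Data → Data → Data → Data → Set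
      G a d e st = Fits b (a ∷ d ∷ e ∷ st ∷ ρ)
      f : Data → Data → Data → Data → Data
      f a d e st = evalₚ Oracle b (a ∷ d ∷ e ∷ st ∷ ρ)
      px = ⟦ pol xs ⟧ s
      Q = ⟦ stateBound (pol xs) 𝕏 ⟧ s
      sx = eval-size xs wx ρ≤
      P : Data → Data → Set
      P ys a = size ys ≤ px × FitsLoop G f ys a
      P-step : ∀ ys a → ys ≢ nil → P ys a →
               P (⟦ snd ⟧₁ ys) (f a (⟦ fst ⟧₁ ys) (⟦ snd ⟧₁ ys) (pair ys a))
      P-step ys a ≢nil (ys≤ , r) = ≤-trans (size-op₁ snd ys) ys≤ , fits-step G f ys a ≢nil r
      Q-size : ∀ ys a → P ys a → size (pair ys a) ≤ Q
      Q-size ys a (ys≤ , r) = s≤s (+-mono-≤ ys≤ (≤-trans (fits-size G f ys a r) S≤s))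

-- The online algorithm as a program

pattern i0 = zero
pattern i1 = suc i0
pattern i2 = suc i1
pattern i3 = suc i2
pattern i4 = suc i3
pattern i5 = suc i4
pattern i6 = suc i5
pattern i7 = suc i6
pattern i8 = suc i7
pattern i9 = suc i8

↑ : ∀ {n} → Fin n → Fin (4 + n)
↑ i = suc (suc (suc (suc i)))

infixr 5 _∶_

_∶_ : ∀ {n} → Ex n → Ex n → Ex n
e ∶ f = op₂ cons e f

fstE sndE : ∀ {n} → Ex n → Ex n
fstE = op₁ fst
sndE = op₁ snd

nilE oneE : ∀ {n} → Ex n
nilE = const nil
oneE = const (num 1ℚ)

-- Truncated subtraction of unary numbers: each layer of the first removes one layer of the second,
-- and the rest is non-`nil`, hence true, exactly if the first is smaller.
lt : ∀ {n} → Fin n → Fin n → Ex n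
lt i j = for (var i) (var j) (sndE (var i0))

append : ∀ {n} → Fin n → Ex n → Ex n
append i e = for (var i) e (nilE ∶ var i0)

rev : ∀ {n} → Ex n → Ex n
rev e = for e nilE (var i1 ∶ var i0)

-- Equality of unary indices is tested as the failure of both strict comparisons.
member : ∀ {n} → Fin n → Fin n → Ex n
member i X = for (var X) nilE (cond (lt i1 (↑ i)) (var i0) (cond (lt (↑ i) i1) (var i0) oneE))

-- Loops build lists by consing and thus reverse them; run over the reversed list of loads, this one
-- yields the characteristic vector in the order that the oracle expects.
indicator : ∀ {n} → Fin n → Fin n → Ex n
indicator r X = for (var r) nilE (bind (fstE (var i1)) (member i0 (suc (↑ X)) ∶ var i1))

kE keyE cE : ∀ {n} → Fin n → Ex n
kE   r = fstE (sndE (var r))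
keyE r = fstE (sndE (sndE (var r)))
cE   r = sndE (sndE (sndE (var r)))

extendE : ∀ {n} → Fin n → Ex (4 + (4 + n))
extendE r⁻ =
  bind (keyE i1)
    (cond (lt i6 i0) (var i1)
      (bind (fstE (var i2) ∶ var i1)
        (cond (query (indicator (suc (suc (↑ (↑ r⁻)))) i0)) (var i0) (var i2))))

basisE : ∀ {n} → Fin n → Fin n → Fin n → Ex n
basisE r r⁻ vs = for (var vs) nilE (for (var (↑ r)) (var i0) (extendE r⁻))

demandStep aboveStep : ∀ {n} → Fin n → Ex (4 + n)
demandStep v =
  bind (keyE i1) (cond (lt (suc (↑ v)) i0) (bind (kE i2) (append i0 (var i2))) (var i1))
aboveStep v =
  bind (keyE i1) (cond (lt (suc (↑ v)) i0) (fstE (var i2) ∶ var i1) (var i1))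

supplyStep : ∀ {n} → Fin n → Fin n → Fin n → Ex (4 + n)
supplyStep B M v =
  bind (keyE i1) (cond (lt (suc (↑ v)) i0)
    (bind (fstE (var i2)) (cond (member i0 (suc (suc (↑ B)))) (append (suc (suc (↑ M))) (var i2)) (var i2)))
    (var i1))

demandE aboveE : ∀ {n} → Fin n → Fin n → Ex n
demandE r v = for (var r) nilE (demandStep v)
aboveE  r v = for (var r) nilE (aboveStep v)

supplyE : ∀ {n} → Fin n → Fin n → Fin n → Fin n → Ex n
supplyE r B M v = for (var r) nilE (supplyStep B M v)

violatedStep : ∀ {n} → Fin n → Fin n → Fin n → Ex (4 + n)
violatedStep r B M =
  cond (bind (demandE (↑ r) i1) (bind (supplyE (suc (↑ r)) (suc (↑ B)) (suc (↑ M)) i2) (lt i1 i0)))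
    (aboveE (↑ r) i1) (var i0)

violatedE : ∀ {n} → Fin n → Fin n → Fin n → Fin n → Ex n
violatedE r B M vs = for (var vs) nilE (violatedStep r B M)

bumpE : ∀ {n} → Fin n → Ex n
bumpE r =
  bind (nilE ∶ cE r)
    (bind (kE (suc r))
      (cond (lt i1 i0)
        (fstE (var r″) ∶ var i0 ∶ keyE r″ ∶ var i1)
        (fstE (var r″) ∶ var i0 ∶ (nilE ∶ keyE r″) ∶ nilE)))
  where r″ = suc (suc r)

updateStep : ∀ {n} → Fin n → Ex (4 + n)
updateStep B =
  bind (fstE (var i1)) (cond (member i0 (suc (↑ B))) (cond (keyE i2) (bumpE i2) (var i2)) (var i2))
    ∶ var i0

updateE : ∀ {n} → Fin n → Fin n → Ex n
updateE r⁻ B = for (var r⁻) nilE (updateStep B)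

roundE : ∀ {n} → Fin n → Fin n → Fin n → Ex n
roundE s M vs =
  cond (fstE (var s)) (var s)
    (bind (sndE (var s))
      (bind (rev (var i0))
        (bind (basisE i1 i0 (suc (suc vs)))
          (bind (violatedE i2 i0 (suc (suc (suc M))) (suc (suc (suc vs))))
            (cond (var i0) (var i0 ∶ var i3) (nilE ∶ updateE i2 i1))))))

-- Unary numbers, encoded lists and the simulation of loops

un : ℕ → Data
un zero    = nil
un (suc n) = pair nil (un n)

pos : ℕ → Bool
pos zero    = false
pos (suc _) = true

encode : ∀ {A : Set} → (A → Data) → List A → Data
encode f xs = list (map f xs)

module _ {A B : Set} (encA : A → Data) (encB : B → Data) (step : A → B → A)
  (f : Data → Data → Data → Data → Data)
  (f-step : ∀ a b e st → f (encA a) (encB b) e st ≡ encA (step a b)) where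

  -- The tool behind most evaluation lemmas: it reduces a loop to one pass of its body, for an
  -- arbitrary rest of the list and internal state.
  iterate-foldl : ∀ a xs → iterate f (encode encB xs) (encA a) ≡ encA (foldl step a xs)
  iterate-foldl a []       = refl
  iterate-foldl a (x ∷ xs)
    rewrite f-step a x (encode encB xs) (pair (encode encB (x ∷ xs)) (encA a)) = iterate-foldl (step a x) xs

repeat : ∀ {A : Set} → ℕ → (A → A) → A → A
repeat zero    g a = a
repeat (suc n) g a = repeat n g (g a)

iterate-un : ∀ {A : Set} (encA : A → Data) (step : A → A) (f : Data → Data → Data → Data → Data) →
             (∀ a e st → f (encA a) nil e st ≡ encA (step a)) →
             ∀ n a → iterate f (un n) (encA a) ≡ encA (repeat n step a)
iterate-un encA step f f-step zero    a = refl
iterate-un encA step f f-step (suc n) a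
  rewrite f-step a (un n) (pair (un (suc n)) (encA a)) = iterate-un encA step f f-step n (step a)

iterate-map : ∀ {B : Set} (encB g : B → Data) (f : Data → Data → Data → Data → Data) →
              (∀ a b e st → f a (encB b) e st ≡ pair (g b) a) →
              ∀ xs → iterate f (list (reverse (map encB xs))) nil ≡ encode g xs
iterate-map encB g f f-step xs = begin
  iterate f (list (reverse (map encB xs))) nil         ≡⟨ cong (λ h → iterate f (list h) nil) (sym (List.reverse-map encB xs)) ⟩
  iterate f (encode encB (reverse xs)) nil             ≡⟨ iterate-foldl list encB (λ a b → g b ∷ a) f (λ a b → f-step (list a) b) [] (reverse xs) ⟩
  list (foldl (λ a b → g b ∷ a) [] (reverse xs))       ≡⟨ cong list (List.reverse-foldl (λ a b → g b ∷ a) [] xs) ⟩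
  list (List.foldr (λ b a → g b ∷ a) [] xs)            ≡⟨ cong list (foldr-map xs) ⟩
  encode g xs                                          ∎
  where
  open ≡-Reasoning
  foldr-map : ∀ xs → List.foldr (λ b a → g b ∷ a) [] xs ≡ map g xs
  foldr-map []       = refl
  foldr-map (x ∷ xs) = cong (g x ∷_) (foldr-map xs)

ite-un : ∀ {A : Set} n {x y : A} → ite (un n) x y ≡ (if pos n then x else y)
ite-un zero    = refl
ite-un (suc n) = refl

ite-truth : ∀ {A : Set} b {x y : A} → ite (truth b) x y ≡ (if b then x else y)
ite-truth true  = refl
ite-truth false = refl

if-cong : ∀ {A B : Set} (f : A → B) b {x y : A} → f (if b then x else y) ≡ (if b then f x else f y)
if-cong f true  = refl
if-cong f false = refl

toSubset-encode : ∀ m (g : Fin m → Bool) → toSubset m (encode (truth ∘ g) (allFin m)) ≡ Vec.tabulate g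
toSubset-encode m g = trans (cong (toSubset m ∘ list) (List.map-tabulate (λ i → i) (truth ∘ g))) (go m g)
  where
  go : ∀ m (g : Fin m → Bool) → toSubset m (list (List.tabulate (truth ∘ g))) ≡ Vec.tabulate g
  go zero    g = refl
  go (suc m) g with g zero
  ... | true  = cong (_ ∷_) (go m (g ∘ suc))
  ... | false = cong (_ ∷_) (go m (g ∘ suc))

-- The packing algorithm

-- k is the capacity of an element, its weight is 2 ^ key, and c counts its uses
-- since the last doubling of the weight.
record Load : Set where
  constructor load
  field
    k key c : ℕ


module Packing (m : ℕ) (indep : Subset m → Bool) (M V : ℕ) where

  open Load

  -- From here on the algorithm is given on lists, functions and numbers, every fold mirroring one
  -- loop of the program, so that correctness of the program is a comparison of single passes.
  member? : Fin m → List (Fin m) → Bool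
  member? e = foldl (λ a x → if pos (toℕ e ∸ toℕ x) then a else if pos (toℕ x ∸ toℕ e) then a else true) false

  subset : List (Fin m) → Subset m
  subset X = Vec.tabulate (λ e → member? e X)

  Loads : Set
  Loads = Fin m → Load

  above? : Loads → ℕ → Fin m → Bool
  above? w v e = pos (key (w e) ∸ v)

  extend : Loads → ℕ → List (Fin m) → Fin m → List (Fin m)
  extend w v B e = if above? w v e then B else if indep (subset (e ∷ B)) then e ∷ B else B

  -- Greedy without sorting: pass v may take every element of key at most v, and those of smaller
  -- key have had their turn in the earlier passes.
  basis : Loads → List (Fin m)
  basis w = foldl (λ B v → foldl (extend w v) B (allFin m)) [] (upTo (suc V))

  demand : Loads → ℕ → ℕ
  demand w v = foldl (λ n e → if above? w v e then k (w e) + n else n) 0 (allFin m)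

  -- For the greedy basis B, the elements of B of key at most v span all elements of key at most v.
  -- So B has r minus the rank of {key ≤ v} elements in D = {key > v}, and `demand` below `supply`
  -- says that k / M violates the constraint of D.
  supply : Loads → List (Fin m) → ℕ → ℕ
  supply w B v = foldl (λ n e → if above? w v e then (if member? e B then M + n else n) else n) 0 (allFin m)

  above : Loads → ℕ → List (Fin m)
  above w v = foldl (λ D e → if above? w v e then e ∷ D else D) [] (allFin m)

  violated : Loads → List (Fin m) → List (Fin m)
  violated w B = foldl (λ D v → if pos (supply w B v ∸ demand w v) then above w v else D) [] (upTo (suc V))

  bump : Load → Load
  bump r = if pos (k r ∸ suc (c r)) then load (k r) (key r) (suc (c r)) else load (k r) (suc (key r)) 0

  update : Loads → List (Fin m) → Loads
  update w B e = if member? e B then (if pos (key (w e)) then bump (w e) else w e) else w e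

  round : List (Fin m) × Loads → List (Fin m) × Loads
  round (D@(_ ∷ _) , w) = D , w
  round ([]        , w) with violated w (basis w)
  ... | D@(_ ∷ _) = D , w
  ... | []        = [] , update w (basis w)

  Oracle : Data → Bool
  Oracle = indep ∘ toSubset m

  idᵈ : Fin m → Data
  idᵈ = un ∘ toℕ

  loadᵈ : Fin m → Load → Data
  loadᵈ e r = pair (idᵈ e) (pair (un (k r)) (pair (un (key r)) (un (c r))))

  loadsᵈ : Loads → Data
  loadsᵈ w = encode (λ e → loadᵈ e (w e)) (allFin m)

  roundᵈ : List (Fin m) × Loads → Data
  roundᵈ (D , w) = pair (encode idᵈ D) (loadsᵈ w)

  ⟨_⟩ : ∀ {n} → Ex n → Vec Data n → Data
  ⟨ e ⟩ = eval Oracle e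

  module _ {n : ℕ} (ρ : Vec Data n) where

    eval-lt : ∀ {i j} a b → Vec.lookup ρ i ≡ un a → Vec.lookup ρ j ≡ un b → ⟨ lt i j ⟩ ρ ≡ un (b ∸ a)
    eval-lt a b eq eq′ rewrite eq | eq′ = go a b
      where
      go : ∀ a b → iterate (λ a _ _ _ → ⟦ snd ⟧₁ a) (un a) (un b) ≡ un (b ∸ a)
      go zero    b       = refl
      go (suc a) zero    = trans (go a zero) (cong un (0∸n≡0 a))
      go (suc a) (suc b) = go a b

    eval-append : ∀ {i} (e : Ex n) a b → Vec.lookup ρ i ≡ un a → ⟨ e ⟩ ρ ≡ un b → ⟨ append i e ⟩ ρ ≡ un (a + b)
    eval-append e a b eq eq′ rewrite eq | eq′ = go a b
      where
      go : ∀ a b → iterate (λ a _ _ _ → pair nil a) (un a) (un b) ≡ un (a + b)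
      go zero    b = refl
      go (suc a) b = trans (go a (suc b)) (cong un (+-suc a b))

    eval-rev : ∀ (e : Ex n) xs → ⟨ e ⟩ ρ ≡ list xs → ⟨ rev e ⟩ ρ ≡ list (reverse xs)
    eval-rev e xs eq rewrite eq = trans (cong (λ h → iterate _ (list h) nil) (sym (List.map-id xs)))
      (iterate-foldl list (λ d → d) (λ a b → b ∷ a) _ (λ _ _ _ _ → refl) [] xs)

  module _ {n : ℕ} (ρ : Vec Data n) where

    eval-member : ∀ {i X} e xs → Vec.lookup ρ i ≡ idᵈ e → Vec.lookup ρ X ≡ encode idᵈ xs →
                  ⟨ member i X ⟩ ρ ≡ truth (member? e xs)
    eval-member {i} {X} e xs eq eq′ rewrite eq′ =
      iterate-foldl truth idᵈ _ _ step false xs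
      where
      step : ∀ a x r st → ⟨ cond (lt i1 (↑ i)) (var i0) (cond (lt (↑ i) i1) (var i0) oneE) ⟩
                            (truth a ∷ idᵈ x ∷ r ∷ st ∷ ρ)
             ≡ truth (if pos (toℕ e ∸ toℕ x) then a else if pos (toℕ x ∸ toℕ e) then a else true)
      step a x r st
        rewrite eval-lt (truth a ∷ idᵈ x ∷ r ∷ st ∷ ρ) {i1} {↑ i} (toℕ x) (toℕ e) refl eq
              | eval-lt (truth a ∷ idᵈ x ∷ r ∷ st ∷ ρ) {↑ i} {i1} (toℕ e) (toℕ x) eq refl
              | ite-un (toℕ e ∸ toℕ x) {truth a} {ite (un (toℕ x ∸ toℕ e)) (truth a) (num 1ℚ)}
              | ite-un (toℕ x ∸ toℕ e) {truth a} {num 1ℚ}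
        with pos (toℕ e ∸ toℕ x) | pos (toℕ x ∸ toℕ e)
      ... | true  | _     = refl
      ... | false | true  = refl
      ... | false | false = refl

  module _ {n : ℕ} (ρ : Vec Data n) {r⁻ X : Fin n} (w : Loads) (B : List (Fin m))
    (r⁻≡ : Vec.lookup ρ r⁻ ≡ list (reverse (map (λ e → loadᵈ e (w e)) (allFin m))))
    (X≡ : Vec.lookup ρ X ≡ encode idᵈ B) where

    eval-indicator : ⟨ indicator r⁻ X ⟩ ρ ≡ encode (λ e → truth (member? e B)) (allFin m)
    eval-indicator rewrite r⁻≡ = iterate-map (λ e → loadᵈ e (w e)) _ _
      (λ a e r st → cong (λ h → pair h a) (eval-member (idᵈ e ∷ a ∷ loadᵈ e (w e) ∷ r ∷ st ∷ ρ) {i0} {suc (↑ X)} e B refl X≡)) (allFin m)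

  module _ {n : ℕ} (ρ : Vec Data n) (w : Loads) {r : Fin n} (r≡ : Vec.lookup ρ r ≡ loadsᵈ w) where

    eval-basis : ∀ {r⁻ vs} → Vec.lookup ρ r⁻ ≡ list (reverse (map (λ e → loadᵈ e (w e)) (allFin m))) →
                 Vec.lookup ρ vs ≡ encode un (upTo (suc V)) →
                 ⟨ basisE r r⁻ vs ⟩ ρ ≡ encode idᵈ (basis w)
    eval-basis {r⁻} r⁻≡ vs≡ rewrite vs≡ = iterate-foldl (encode idᵈ) un _ _ outer [] (upTo (suc V))
      where
      outer : ∀ B v e st → ⟨ for (var (↑ r)) (var i0) (extendE r⁻) ⟩ (encode idᵈ B ∷ un v ∷ e ∷ st ∷ ρ)
              ≡ encode idᵈ (foldl (extend w v) B (allFin m))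
      outer B v e st rewrite r≡ = iterate-foldl (encode idᵈ) (λ e → loadᵈ e (w e)) (extend w v) _ inner B (allFin m)
        where
        inner : ∀ A x e′ st′ → ⟨ extendE r⁻ ⟩ (encode idᵈ A ∷ loadᵈ x (w x) ∷ e′ ∷ st′ ∷ encode idᵈ B ∷ un v ∷ e ∷ st ∷ ρ)
                ≡ encode idᵈ (extend w v A x)
        inner A x e′ st′
          rewrite eval-lt (un (key (w x)) ∷ encode idᵈ A ∷ loadᵈ x (w x) ∷ e′ ∷ st′ ∷ encode idᵈ B ∷ un v ∷ e ∷ st ∷ ρ) {i6} {i0} v (key (w x)) refl refl
                | eval-indicator (encode idᵈ (x ∷ A) ∷ un (key (w x)) ∷ encode idᵈ A ∷ loadᵈ x (w x) ∷ e′ ∷ st′ ∷ encode idᵈ B ∷ un v ∷ e ∷ st ∷ ρ)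
                    {suc (suc (↑ (↑ r⁻)))} {i0} w (x ∷ A) r⁻≡ refl
                | toSubset-encode m (λ e → member? e (x ∷ A))
                | ite-un (key (w x) ∸ v) {encode idᵈ A} {ite (truth (indep (subset (x ∷ A)))) (encode idᵈ (x ∷ A)) (encode idᵈ A)}
                | ite-truth (indep (subset (x ∷ A))) {encode idᵈ (x ∷ A)} {encode idᵈ A}
          with pos (key (w x) ∸ v) | indep (subset (x ∷ A))
        ... | true  | _     = refl
        ... | false | true  = refl
        ... | false | false = refl

    eval-demand : ∀ {v} n → Vec.lookup ρ v ≡ un n → ⟨ demandE r v ⟩ ρ ≡ un (demand w n)
    eval-demand {v} n v≡ rewrite r≡ = iterate-foldl un (λ e → loadᵈ e (w e)) _ _ step 0 (allFin m)
      where
      step : ∀ a x e st → ⟨ demandStep v ⟩ (un a ∷ loadᵈ x (w x) ∷ e ∷ st ∷ ρ)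
             ≡ un (if above? w n x then k (w x) + a else a)
      step a x e st
        rewrite eval-lt (un (key (w x)) ∷ un a ∷ loadᵈ x (w x) ∷ e ∷ st ∷ ρ) {suc (↑ v)} {i0} n (key (w x)) v≡ refl
              | eval-append (un (k (w x)) ∷ un (key (w x)) ∷ un a ∷ loadᵈ x (w x) ∷ e ∷ st ∷ ρ) {i0} (var i2) (k (w x)) a refl refl
              | ite-un (key (w x) ∸ n) {un (k (w x) + a)} {un a}
        = sym (if-cong un (pos (key (w x) ∸ n)))

    eval-above : ∀ {v} n → Vec.lookup ρ v ≡ un n → ⟨ aboveE r v ⟩ ρ ≡ encode idᵈ (above w n)
    eval-above {v} n v≡ rewrite r≡ = iterate-foldl (encode idᵈ) (λ e → loadᵈ e (w e)) _ _ step [] (allFin m)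
      where
      step : ∀ a x e st → ⟨ aboveStep v ⟩ (encode idᵈ a ∷ loadᵈ x (w x) ∷ e ∷ st ∷ ρ)
             ≡ encode idᵈ (if above? w n x then x ∷ a else a)
      step a x e st
        rewrite eval-lt (un (key (w x)) ∷ encode idᵈ a ∷ loadᵈ x (w x) ∷ e ∷ st ∷ ρ) {suc (↑ v)} {i0} n (key (w x)) v≡ refl
              | ite-un (key (w x) ∸ n) {encode idᵈ (x ∷ a)} {encode idᵈ a}
        = sym (if-cong (encode idᵈ) (pos (key (w x) ∸ n)))

    eval-supply : ∀ {v X N} n B → Vec.lookup ρ v ≡ un n → Vec.lookup ρ X ≡ encode idᵈ B → Vec.lookup ρ N ≡ un M →
                  ⟨ supplyE r X N v ⟩ ρ ≡ un (supply w B n)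
    eval-supply {v} {X} {N} n B v≡ X≡ N≡ rewrite r≡ = iterate-foldl un (λ e → loadᵈ e (w e)) _ _ step 0 (allFin m)
      where
      step : ∀ a x e st → ⟨ supplyStep X N v ⟩ (un a ∷ loadᵈ x (w x) ∷ e ∷ st ∷ ρ)
             ≡ un (if above? w n x then (if member? x B then M + a else a) else a)
      step a x e st
        rewrite eval-lt (un (key (w x)) ∷ un a ∷ loadᵈ x (w x) ∷ e ∷ st ∷ ρ) {suc (↑ v)} {i0} n (key (w x)) v≡ refl
              | eval-member (idᵈ x ∷ un (key (w x)) ∷ un a ∷ loadᵈ x (w x) ∷ e ∷ st ∷ ρ) {i0} {suc (suc (↑ X))} x B refl X≡
              | eval-append (idᵈ x ∷ un (key (w x)) ∷ un a ∷ loadᵈ x (w x) ∷ e ∷ st ∷ ρ) {suc (suc (↑ N))} (var i2) M a N≡ refl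
              | ite-truth (member? x B) {un (M + a)} {un a}
              | ite-un (key (w x) ∸ n) {if member? x B then un (M + a) else un a} {un a}
        with pos (key (w x) ∸ n) | member? x B
      ... | true  | true  = refl
      ... | true  | false = refl
      ... | false | _     = refl

  module _ {n : ℕ} (ρ : Vec Data n) (w : Loads) {r : Fin n} (r≡ : Vec.lookup ρ r ≡ loadsᵈ w) where

    eval-violated : ∀ {X N vs} B → Vec.lookup ρ X ≡ encode idᵈ B → Vec.lookup ρ N ≡ un M →
                    Vec.lookup ρ vs ≡ encode un (upTo (suc V)) →
                    ⟨ violatedE r X N vs ⟩ ρ ≡ encode idᵈ (violated w B)
    eval-violated {X} {N} B X≡ N≡ vs≡ rewrite vs≡ = iterate-foldl (encode idᵈ) un _ _ step [] (upTo (suc V))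
      where
      step : ∀ D v e st → ⟨ violatedStep r X N ⟩ (encode idᵈ D ∷ un v ∷ e ∷ st ∷ ρ)
             ≡ encode idᵈ (if pos (supply w B v ∸ demand w v) then above w v else D)
      step D v e st
        rewrite eval-demand (encode idᵈ D ∷ un v ∷ e ∷ st ∷ ρ) w {↑ r} r≡ {i1} v refl
              | eval-supply (un (demand w v) ∷ encode idᵈ D ∷ un v ∷ e ∷ st ∷ ρ) w {suc (↑ r)} r≡ {i2} {suc (↑ X)} {suc (↑ N)} v B refl X≡ N≡
              | eval-lt (un (supply w B v) ∷ un (demand w v) ∷ encode idᵈ D ∷ un v ∷ e ∷ st ∷ ρ) {i1} {i0} (demand w v) (supply w B v) refl refl
              | eval-above (encode idᵈ D ∷ un v ∷ e ∷ st ∷ ρ) w {↑ r} r≡ {i1} v refl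
              | ite-un (supply w B v ∸ demand w v) {encode idᵈ (above w v)} {encode idᵈ D}
        = sym (if-cong (encode idᵈ) (pos (supply w B v ∸ demand w v)))

  eval-bump : ∀ {n} (ρ : Vec Data n) {i} e r → Vec.lookup ρ i ≡ loadᵈ e r → ⟨ bumpE i ⟩ ρ ≡ loadᵈ e (bump r)
  eval-bump ρ {i} e r i≡
    rewrite i≡
          | eval-lt (un (k r) ∷ un (suc (c r)) ∷ ρ) {i1} {i0} (suc (c r)) (k r) refl refl
          | ite-un (k r ∸ suc (c r)) {loadᵈ e (load (k r) (key r) (suc (c r)))} {loadᵈ e (load (k r) (suc (key r)) 0)}
    = sym (if-cong (loadᵈ e) (pos (k r ∸ suc (c r))))

  eval-update : ∀ {n} (ρ : Vec Data n) {r⁻ X} w B →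
                Vec.lookup ρ r⁻ ≡ list (reverse (map (λ e → loadᵈ e (w e)) (allFin m))) →
                Vec.lookup ρ X ≡ encode idᵈ B → ⟨ updateE r⁻ X ⟩ ρ ≡ loadsᵈ (update w B)
  eval-update ρ {r⁻} {X} w B r⁻≡ X≡ rewrite r⁻≡ =
    iterate-map (λ e → loadᵈ e (w e)) (λ e → loadᵈ e (update w B e)) _ step (allFin m)
    where
    step : ∀ a x e st → ⟨ updateStep X ⟩ (a ∷ loadᵈ x (w x) ∷ e ∷ st ∷ ρ)
           ≡ pair (loadᵈ x (update w B x)) a
    step a x e st
      rewrite eval-member (idᵈ x ∷ a ∷ loadᵈ x (w x) ∷ e ∷ st ∷ ρ) {i0} {suc (↑ X)} x B refl X≡
            | eval-bump (idᵈ x ∷ a ∷ loadᵈ x (w x) ∷ e ∷ st ∷ ρ) {i2} x (w x) refl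
            | ite-un (key (w x)) {loadᵈ x (bump (w x))} {loadᵈ x (w x)}
            | ite-truth (member? x B) {if pos (key (w x)) then loadᵈ x (bump (w x)) else loadᵈ x (w x)} {loadᵈ x (w x)}
      with member? x B | pos (key (w x))
    ... | true  | true  = refl
    ... | true  | false = refl
    ... | false | _     = refl

  eval-round : ∀ {n} (ρ : Vec Data n) {i N vs} s → Vec.lookup ρ i ≡ roundᵈ s → Vec.lookup ρ N ≡ un M →
               Vec.lookup ρ vs ≡ encode un (upTo (suc V)) → ⟨ roundE i N vs ⟩ ρ ≡ roundᵈ (round s)
  eval-round ρ (_ ∷ _ , w) i≡ N≡ vs≡ rewrite i≡ = refl
  eval-round ρ {i} {N} {vs} ([] , w) i≡ N≡ vs≡ rewrite i≡
    | eval-rev (loadsᵈ w ∷ ρ) (var i0) (map (λ e → loadᵈ e (w e)) (allFin m)) refl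
    | eval-basis (list (reverse (map (λ e → loadᵈ e (w e)) (allFin m))) ∷ loadsᵈ w ∷ ρ) w {i1} refl {i0} {suc (suc vs)} refl vs≡
    | eval-violated (encode idᵈ (basis w) ∷ list (reverse (map (λ e → loadᵈ e (w e)) (allFin m))) ∷ loadsᵈ w ∷ ρ) w {i2} refl
        {i0} {suc (suc (suc N))} {suc (suc (suc vs))} (basis w) refl N≡ vs≡
    with violated w (basis w)
  ... | _ ∷ _ = refl
  ... | []    = cong (pair nil) (eval-update (nil ∷ encode idᵈ (basis w) ∷ list (reverse (map (λ e → loadᵈ e (w e)) (allFin m))) ∷ loadsᵈ w ∷ ρ) {i2} {i1} w (basis w) refl refl)

-- Programs of the outer algorithm

loadStep : ∀ {n} → Fin n → Fin n → Ex (4 + n)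
loadStep M V =
  bind (fstE (sndE (var i1)))
    (bind (fstE (sndE (sndE (var i0))))
      ((fstE (var i3) ∶ var i0 ∶
        cond (var i0) (cond (lt i0 (suc (suc (↑ M)))) (fstE (sndE (sndE (sndE (var i1))))) nilE) (var (suc (suc (↑ V)))) ∶
        nilE) ∶ var i2))

loadsE : ∀ {n} → Fin n → Fin n → Fin n → Ex n
loadsE els M V = for (rev (var els)) nilE (loadStep M V)

minStep : ∀ {n} → Fin n → Ex (4 + n)
minStep D =
  bind (fstE (var i1))
    (cond (member i0 (suc (↑ D)))
      (bind (fstE (sndE (fstE (sndE (var i2)))))
        (cond (var i2) (cond (op₂ leq (var i0) (var i2)) (var i0) (var i2)) (var i0)))
      (var i1))

levelUpE : ∀ {n} → Fin n → Fin n → Ex n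
levelUpE cur st =
  bind (fstE (sndE (sndE (var cur))))
    (fstE c ∶ fstE c ∶
     cond (var i0) (append i0 (var i0)) (nilE ∶ nilE) ∶
     cond (var i0) (sndE (fstE rest)) (fstE rest) ∶
     cond (var i0) (op₂ mul (const (num (fromℕ 2))) (sndE rest))
                   (op₂ mul (const (num (fromℕ 2))) (op₁ inv (fstE (var (suc st))))))
  where
  c = var (suc cur)
  rest = sndE (sndE (sndE c))

lowerE : ∀ {n} → Fin n → Fin n → Fin n → Ex n
lowerE cur δ st =
  bind (op₂ add (fstE (sndE (var cur))) (op₁ neg (var δ)))
    (cond (op₂ leq (var i0) (const (num 0ℚ)))
      (levelUpE (suc cur) (suc st))
      (fstE (var (suc cur)) ∶ var i0 ∶ sndE (sndE (var (suc cur)))))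

lowerStep : ∀ {n} → Fin n → Fin n → Fin n → Ex (4 + n)
lowerStep D δ st =
  bind (fstE (var i1))
    (cond (member i0 (suc (↑ D)))
      (bind (fstE (sndE (var i2)))
        (var i1 ∶ lowerE i0 (suc (suc (↑ δ))) (suc (suc (↑ st))) ∶ sndE (sndE (var i3))))
      (var i2))
  ∶ var i0

improveE : ∀ {n} → Fin n → Fin n → Fin n → Ex n
improveE s els st =
  bind (fstE (var s))
    (cond (var i0)
      (bind (for (var (suc els)) nilE (minStep i0))
        (for (rev (var (suc (suc els)))) nilE (lowerStep i1 i0 (suc (suc st)))))
      (var (suc els)))

arriveStep : ∀ {n} → Fin n → Fin n → Ex (4 + n)
arriveStep msg U =
  bind (fstE (var i1))
    (bind (fstE (for (var i0) (var (suc (↑ msg))) (sndE (var i0))))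
      (cond (var i0)
        (var i1 ∶ (var i0 ∶ var i0 ∶ nilE ∶ var (suc (suc (↑ U))) ∶ const (num 0ℚ)) ∶ sndE (var i3))
        (var i3)))
  ∶ var i0

outputStep : ∀ {n} → Ex (4 + n)
outputStep =
  bind (sndE (sndE (sndE (sndE (var i1)))))
    (cond (op₂ leq (var i0) oneE) (var i0) oneE ∶ var i1)

outputE : ∀ {n} → Fin n → Ex n
outputE els = for (rev (var els)) nilE (for (sndE (var i1)) nilE outputStep ∶ var i0)

unaryE : ∀ {n} → Fin n → Ex n
unaryE i = for (var i) nilE (nilE ∶ var i0)

initialE : ∀ {n} → Fin n → Ex n
initialE msg = for (rev (var msg)) nilE ((unaryE i2 ∶ nilE) ∶ var i0)

packing : Pr 15
packing = iter (var (suc i9)) (nilE ∶ var i0) (exp (roundE i0 (↑ (suc (suc i9))) (↑ i7)))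

improve : Pr 14
improve = bind (exp (loadsE i0 (suc i9) i8)) (bind packing (exp (improveE i0 i2 i7)))

opaque
  main : Pr 10
  main = bind (iter (var i3) (var i0) improve)
    (exp ((fstE (var i2) ∶ var i0) ∶ outputE i0))

  program : Pr 2
  program =
    -- The unary m is the length of the message; the rational m in the state serves for its inverse.
    bind (exp (unaryE i1))
    (bind (exp (append i0 (var i0)))
    (bind (exp (for (var i1) nilE (append (↑ i1) (var i0))))
    (bind (exp (append i1 (var i0)))
    (bind (exp (nilE ∶ var i0))
    (bind (exp (for (var i0) nilE (unaryE i2 ∶ var i0)))
    -- Only the initial state is a bare number, for which `fst` gives `nil`. It is completed by m
    -- empty histories.
    (bind (exp (cond (fstE (var i6)) (var i6) (var i6 ∶ initialE i7)))
    (bind (exp (for (rev (sndE (var i0))) nilE (arriveStep i8 i6)))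
    main)))))))

  -- For this closed program `WFₚ` evaluates to a product of unit types, so the check of all loop
  -- bodies is a computation.
  wf : WFₚ program
  wf = _

-- Loops over positions, and the data of a copy

iterate-un-list : ∀ ys n → iterate (λ a _ _ _ → pair nil a) (list ys) (un n) ≡ un (length ys + n)
iterate-un-list []       n = refl
iterate-un-list (y ∷ ys) n = begin
  iterate g (pair y (list ys)) (un n)   ≡⟨⟩
  iterate g (list ys) (un (suc n))      ≡⟨ iterate-un-list ys (suc n) ⟩
  un (length ys + suc n)                ≡⟨ cong un (+-suc (length ys) n) ⟩
  un (suc (length ys + n))              ∎
  where
  open ≡-Reasoning
  g : Data → Data → Data → Data → Data
  g a _ _ _ = pair nil a

-- Looking at the number of remaining items, a loop over n items builds a
-- list indexed by 0, …, n - 1.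
iterate-applyUpTo : ∀ (g : ℕ → Data) (f : Data → Data → Data → Data → Data) →
                    (∀ a b ys st → f a b (list ys) st ≡ pair (g (length ys)) a) →
                    ∀ xs zs → iterate f (list xs) (list zs) ≡ list (applyUpTo g (length xs) ++ zs)
iterate-applyUpTo g f f-step []       zs = refl
iterate-applyUpTo g f f-step (x ∷ xs) zs
  rewrite f-step (list zs) x xs (pair (list (x ∷ xs)) (list zs)) =
  trans (iterate-applyUpTo g f f-step xs (g (length xs) ∷ zs))
    (cong list (trans (sym (List.∷ʳ-++ (applyUpTo g (length xs)) (g (length xs)) zs))
                      (cong (_++ zs) (List.applyUpTo-∷ʳ g (length xs)))))

un-list : ∀ n → un n ≡ list (replicate n nil)
un-list zero    = refl
un-list (suc n) = cong (pair nil) (un-list n)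

applyUpTo-tabulate : ∀ {A : Set} (g : ℕ → A) n → applyUpTo g n ≡ List.tabulate {n = n} (g ∘ toℕ)
applyUpTo-tabulate g zero    = refl
applyUpTo-tabulate g (suc n) = cong (g 0 ∷_) (applyUpTo-tabulate (g ∘ suc) n)

map-toℕ-allFin : ∀ {A : Set} (g : ℕ → A) n → map (g ∘ toℕ) (allFin n) ≡ applyUpTo g n
map-toℕ-allFin g n = trans (List.map-tabulate (λ i → i) (g ∘ toℕ)) (sym (applyUpTo-tabulate g n))

nth-encode : ∀ {n} (g : Fin n → Data) i → nth (encode g (allFin n)) (toℕ i) ≡ g i
nth-encode {n} g i = trans (cong (λ h → nth (list h) (toℕ i)) (List.map-tabulate (λ j → j) g)) (go g i)
  where
  go : ∀ {n} (g : Fin n → Data) i → nth (list (List.tabulate g)) (toℕ i) ≡ g i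
  go g zero    = refl
  go g (suc i) = go (g ∘ suc) i

iterate-nth : ∀ n d → ⟦ fst ⟧₁ (iterate (λ a _ _ _ → ⟦ snd ⟧₁ a) (un n) d) ≡ nth d n
iterate-nth zero    d = refl
iterate-nth (suc n) d = iterate-nth n (⟦ snd ⟧₁ d)

-- A copy of cost a, residual cost ρ and level lev
record Cur : Set where
  constructor cur
  field
    a ρ : ℚ
    lev : ℕ

capacity : ℕ → ℕ
capacity zero    = 0
capacity (suc i) = 2 ^ i

-- At capacity 2 ^ i the initial key is m - i, so that every active element starts with the same
-- potential 2 ^ i * 2 ^ (m - i) = 2 ^ m. Level 0 holds the value that level 1 takes over.
baseKey : ℕ → ℕ → ℕ
baseKey m zero    = m
baseKey m (suc i) = m ∸ i

-- 2 * capacity l / q, in the form in which the program computes it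
amount : ℚ → ℕ → ℚ
amount q zero          = 0ℚ
amount q (suc zero)    = fromℕ 2 ℚ.* inverse q
amount q (suc (suc i)) = fromℕ 2 ℚ.* amount q (suc i)

≤?-cases : ∀ p q → (does (p ℚ.≤? q) ≡ true × p ℚ.≤ q) ⊎ (does (p ℚ.≤? q) ≡ false × q ℚ.≤ p)
≤?-cases p q = go (p ℚ.≤? q)
  where
  go : (d : Dec (p ℚ.≤ q)) → (does d ≡ true × p ℚ.≤ q) ⊎ (does d ≡ false × q ℚ.≤ p)
  go (yes p≤q) = inj₁ (refl , p≤q)
  go (no  p≰q) = inj₂ (refl , ℚ.<⇒≤ (ℚ.≰⇒> p≰q))

truncated : ℚ → ℚ
truncated y = if does (y ℚ.≤? 1ℚ) then y else 1ℚ

-- The outer algorithm and its evaluation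

module Outer (m : ℕ) (mq : ℚ) (indep : Subset m → Bool) where

  M V : ℕ
  M = m + m
  -- V exceeds the keys that used elements reach in m * m rounds.
  V = M + m * m

  open Packing m indep M V public

  Curs Histories : Set
  Curs = Fin m → Cur
  Histories = Fin m → List Cur

  -- Key 0 marks saturated elements, which are free and whose key `update` leaves alone. Capacity 0
  -- gets the key V, so the greedy basis takes such an element only if the others do not suffice,
  -- and then a constraint is violated.
  loads : Curs → Loads
  loads cs e = load k′ (if pos k′ then (if pos (M ∸ k′) then baseKey m l else 0) else V) 0
    where
    l = Cur.lev (cs e)
    k′ = capacity l

  pack : Curs → List (Fin m) × Loads
  pack cs = repeat (m * m) round ([] , loads cs)

  private
    memberStep : Fin m → Bool → Fin m → Bool
    memberStep e a x = if pos (toℕ e ∸ toℕ x) then a else if pos (toℕ x ∸ toℕ e) then a else true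

    pos-∸ : ∀ a b → pos (a ∸ b) ≡ false → a ≤ b
    pos-∸ a b eq = m∸n≡0⇒m≤n (zero-pos (a ∸ b) eq)
      where
      zero-pos : ∀ n → pos n ≡ false → n ≡ 0
      zero-pos zero _ = refl

    memberStep-refl : ∀ e a → memberStep e a e ≡ true
    memberStep-refl e a rewrite n∸n≡0 (toℕ e) = refl

    memberStep-true : ∀ e x → memberStep e true x ≡ true
    memberStep-true e x with pos (toℕ e ∸ toℕ x) | pos (toℕ x ∸ toℕ e)
    ... | true  | _     = refl
    ... | false | true  = refl
    ... | false | false = refl

    members-true : ∀ e X → foldl (memberStep e) true X ≡ true
    members-true e []      = refl
    members-true e (x ∷ X) rewrite memberStep-true e x = members-true e X

    members⁺ : ∀ e X a → e ∈ X → foldl (memberStep e) a X ≡ true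
    members⁺ e (x ∷ X) a (here refl) rewrite memberStep-refl e a = members-true e X
    members⁺ e (x ∷ X) a (there e∈)  = members⁺ e X (memberStep e a x) e∈

    memberStep⁻ : ∀ e x a → memberStep e a x ≡ true → a ≡ true ⊎ e ≡ x
    memberStep⁻ e x a eq with pos (toℕ e ∸ toℕ x) in p | pos (toℕ x ∸ toℕ e) in q
    ... | true  | _     = inj₁ eq
    ... | false | true  = inj₁ eq
    ... | false | false = inj₂ (Fin.toℕ-injective (≤-antisym (pos-∸ _ _ p) (pos-∸ _ _ q)))

    members⁻ : ∀ e X a → foldl (memberStep e) a X ≡ true → a ≡ true ⊎ e ∈ X
    members⁻ e []      a eq = inj₁ eq
    members⁻ e (x ∷ X) a eq with members⁻ e X (memberStep e a x) eq
    ... | inj₂ e∈ = inj₂ (there e∈)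
    ... | inj₁ eq′ with memberStep⁻ e x a eq′
    ...   | inj₁ a≡  = inj₁ a≡
    ...   | inj₂ e≡x = inj₂ (here e≡x)

  member?⁺ : ∀ {e X} → e ∈ X → member? e X ≡ true
  member?⁺ {e} {X} = members⁺ e X false

  member?⁻ : ∀ {e X} → member? e X ≡ true → e ∈ X
  member?⁻ {e} {X} eq with members⁻ e X false eq
  ... | inj₂ e∈ = e∈

  lowerMin : List (Fin m) → Curs → Maybe ℚ → Fin m → Maybe ℚ
  lowerMin D cs δ e =
    if member? e D
    then just (maybe′ (λ δ → if does (Cur.ρ (cs e) ℚ.≤? δ) then Cur.ρ (cs e) else δ) (Cur.ρ (cs e)) δ)
    else δ

  minimum : List (Fin m) → Curs → Maybe ℚ
  minimum D cs = foldl (lowerMin D cs) nothing (allFin m)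

  module _ (D : List (Fin m)) (cs : Curs) where

    private
      lowerMin-just : ∀ α e → ∃[ δ ] (lowerMin D cs (just α) e ≡ just δ × δ ℚ.≤ α)
      lowerMin-just α e with member? e D
      ... | false = α , refl , ℚ.≤-refl
      ... | true with ≤?-cases (Cur.ρ (cs e)) α
      ...   | inj₁ (eq , ρ≤α) rewrite eq = _ , refl , ρ≤α
      ...   | inj₂ (eq , _)   rewrite eq = α , refl , ℚ.≤-refl

      lowerMin-member : ∀ a e → member? e D ≡ true → ∃[ δ ] (lowerMin D cs a e ≡ just δ × δ ℚ.≤ Cur.ρ (cs e))
      lowerMin-member a e e∈ rewrite e∈ with a
      ... | nothing = _ , refl , ℚ.≤-refl
      ... | just α with ≤?-cases (Cur.ρ (cs e)) α
      ...   | inj₁ (eq , _)   rewrite eq = _ , refl , ℚ.≤-refl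
      ...   | inj₂ (eq , α≤ρ) rewrite eq = α , refl , α≤ρ

      lowerMin-attained : ∀ a e δ → lowerMin D cs a e ≡ just δ →
                          a ≡ just δ ⊎ (member? e D ≡ true × Cur.ρ (cs e) ≡ δ)
      lowerMin-attained a e δ eq with member? e D | a
      lowerMin-attained a e δ eq   | false | _       = inj₁ eq
      lowerMin-attained a e δ refl | true  | nothing = inj₂ (refl , refl)
      lowerMin-attained a e δ eq   | true  | just α with does (Cur.ρ (cs e) ℚ.≤? α)
      lowerMin-attained a e δ refl | true  | just α | true  = inj₂ (refl , refl)
      lowerMin-attained a e δ refl | true  | just α | false = inj₁ refl

      mins-just : ∀ xs α → ∃[ δ ] (foldl (lowerMin D cs) (just α) xs ≡ just δ × δ ℚ.≤ α)
      mins-just []       α = α , refl , ℚ.≤-refl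
      mins-just (x ∷ xs) α with lowerMin D cs (just α) x | lowerMin-just α x
      ... | _ | β , refl , β≤α with mins-just xs β
      ...   | δ , eq , δ≤β = δ , eq , ℚ.≤-trans δ≤β β≤α

      mins-member : ∀ xs a e → e ∈ xs → member? e D ≡ true →
                    ∃[ δ ] (foldl (lowerMin D cs) a xs ≡ just δ × δ ℚ.≤ Cur.ρ (cs e))
      mins-member (x ∷ xs) a e (there e∈) e∈D = mins-member xs _ e e∈ e∈D
      mins-member (x ∷ xs) a e (here refl) e∈D with lowerMin D cs a x | lowerMin-member a x e∈D
      ... | _ | β , refl , β≤ with mins-just xs β
      ...   | δ , eq , δ≤β = δ , eq , ℚ.≤-trans δ≤β β≤

      mins-attained : ∀ xs a δ → foldl (lowerMin D cs) a xs ≡ just δ →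
                      a ≡ just δ ⊎ (∃[ e ] (member? e D ≡ true × Cur.ρ (cs e) ≡ δ))
      mins-attained []       a δ eq = inj₁ eq
      mins-attained (x ∷ xs) a δ eq with mins-attained xs (lowerMin D cs a x) δ eq
      ... | inj₂ p = inj₂ p
      ... | inj₁ eq′ with lowerMin-attained a x δ eq′
      ...   | inj₁ p = inj₁ p
      ...   | inj₂ p = inj₂ (x , p)

    minimum-≤ : ∀ {e} → e ∈ D → ∃[ δ ] (minimum D cs ≡ just δ × δ ℚ.≤ Cur.ρ (cs e))
    minimum-≤ {e} e∈ = mins-member (allFin m) nothing e (∈-allFin e) (member?⁺ e∈)

    minimum-attained : ∀ {δ} → minimum D cs ≡ just δ → ∃[ e ] (e ∈ D × Cur.ρ (cs e) ≡ δ)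
    minimum-attained {δ} eq with mins-attained (allFin m) nothing δ eq
    ... | inj₂ (e , e∈ , ρ≡) = e , member?⁻ e∈ , ρ≡

  lower : ℚ → Cur → Cur
  lower δ (cur a ρ lev) = if does (ρ ℚ.+ ℚ.- δ ℚ.≤? 0ℚ) then cur a a (suc lev) else cur a (ρ ℚ.+ ℚ.- δ) lev

  lowerAll : List (Fin m) → ℚ → Curs → Curs
  lowerAll D δ cs e = if member? e D then lower δ (cs e) else cs e

  step : Curs → Curs
  step cs with proj₁ (pack cs)
  ... | []        = cs
  -- The set is nonempty, so its `minimum` is a `just`.
  ... | D@(_ ∷ _) = lowerAll D (fromMaybe 0ℚ (minimum D cs)) cs

  fresh : ℚ → Cur
  fresh q = cur q q 0

  arrive : (Fin m → Maybe ℚ) → Histories → Histories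
  arrive news hs e = maybe′ (λ q → fresh q ∷ hs e) (hs e) (news e)

  -- The level is represented by quantities derived from it, which every raise after the first
  -- updates by a doubling or a decrement. Capacity `nil` marks level 0.
  curᵈ : Cur → Data
  curᵈ (cur a ρ lev) = pair (num a) (pair (num ρ) (pair (un (capacity lev)) (pair (un (baseKey m lev)) (num (amount mq lev)))))

  historyᵈ : Fin m → List Cur → Data
  historyᵈ e h = pair (idᵈ e) (encode curᵈ h)

  historiesᵈ : Histories → Data
  historiesᵈ hs = encode (λ e → historyᵈ e (hs e)) (allFin m)

  _∷ₕ_ : Curs → Histories → Histories
  (cs ∷ₕ hs) e = cs e ∷ hs e

  outputᵈ : Histories → Data
  outputᵈ hs = encode (λ e → encode (λ c → num (truncated (amount mq (Cur.lev c)))) (reverse (hs e))) (allFin m)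

  eval-loads : ∀ {n} (ρ : Vec Data n) {els N W} cs hs → Vec.lookup ρ els ≡ historiesᵈ (cs ∷ₕ hs) →
               Vec.lookup ρ N ≡ un M → Vec.lookup ρ W ≡ un V →
               ⟨ loadsE els N W ⟩ ρ ≡ loadsᵈ (loads cs)
  eval-loads ρ {els} {N} {W} cs hs els≡ N≡ W≡
    rewrite eval-rev ρ (var els) (map (λ e → historyᵈ e ((cs ∷ₕ hs) e)) (allFin m)) els≡ =
    iterate-map (λ e → historyᵈ e ((cs ∷ₕ hs) e)) (λ e → loadᵈ e (loads cs e)) _ body (allFin m)
    where
    body : ∀ a e r st → ⟨ loadStep N W ⟩ (a ∷ historyᵈ e (cs e ∷ hs e) ∷ r ∷ st ∷ ρ) ≡ pair (loadᵈ e (loads cs e)) a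
    body a e r st
      rewrite eval-lt (un (capacity (Cur.lev (cs e))) ∷ curᵈ (cs e) ∷ a ∷ historyᵈ e (cs e ∷ hs e) ∷ r ∷ st ∷ ρ)
                {i0} {suc (suc (↑ N))} (capacity (Cur.lev (cs e))) M refl N≡
            | W≡
            | ite-un (M ∸ capacity (Cur.lev (cs e))) {un (baseKey m (Cur.lev (cs e)))} {nil}
            | ite-un (capacity (Cur.lev (cs e))) {if pos (M ∸ capacity (Cur.lev (cs e))) then un (baseKey m (Cur.lev (cs e))) else nil} {un V}
      with pos (capacity (Cur.lev (cs e))) | pos (M ∸ capacity (Cur.lev (cs e)))
    ... | true  | true  = refl
    ... | true  | false = refl
    ... | false | _     = refl

  maybeᵈ : Maybe ℚ → Data
  maybeᵈ = maybe′ num nil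

  module _ {n : ℕ} (ρ : Vec Data n) (cs : Curs) (hs : Histories) {els : Fin n}
    (els≡ : Vec.lookup ρ els ≡ historiesᵈ (cs ∷ₕ hs)) where

    eval-minimum : ∀ {D} D′ → Vec.lookup ρ D ≡ encode idᵈ D′ →
                   ⟨ for (var els) nilE (minStep D) ⟩ ρ ≡ maybeᵈ (minimum D′ cs)
    eval-minimum {D} D′ D≡ rewrite els≡ =
      iterate-foldl maybeᵈ (λ e → historyᵈ e ((cs ∷ₕ hs) e)) (lowerMin D′ cs) _ body nothing (allFin m)
      where
      body : ∀ a e r st → ⟨ minStep D ⟩ (maybeᵈ a ∷ historyᵈ e (cs e ∷ hs e) ∷ r ∷ st ∷ ρ) ≡ maybeᵈ (lowerMin D′ cs a e)
      body a e r st
        rewrite eval-member (idᵈ e ∷ maybeᵈ a ∷ historyᵈ e (cs e ∷ hs e) ∷ r ∷ st ∷ ρ) {i0} {suc (↑ D)} e D′ refl D≡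
        with member? e D′ | a
      ... | false | _       = refl
      ... | true  | nothing = refl
      ... | true  | just δ
        rewrite ite-truth (does (Cur.ρ (cs e) ℚ.≤? δ)) {num (Cur.ρ (cs e))} {num δ} =
        sym (if-cong num (does (Cur.ρ (cs e) ℚ.≤? δ)))

  eval-lower : ∀ {n} (ρ : Vec Data n) {x d s} c δ r → Vec.lookup ρ x ≡ curᵈ c → Vec.lookup ρ d ≡ num δ →
               Vec.lookup ρ s ≡ pair (num mq) r → ⟨ lowerE x d s ⟩ ρ ≡ curᵈ (lower δ c)
  eval-lower ρ c@(cur a ρ′ lev) δ r x≡ d≡ s≡
    rewrite x≡ | d≡ | s≡
    with does (ρ′ ℚ.+ ℚ.- δ ℚ.≤? 0ℚ)
  ... | false = refl
  ... | true  = levelUp lev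
    where
    positive : ∀ i → pos (2 ^ i) ≡ true
    positive i with 2 ^ i | m^n>0 2 i
    ... | suc _ | _ = refl
    levelUp : ∀ l → ⟨ levelUpE i0 i1 ⟩ (curᵈ (cur a ρ′ l) ∷ pair (num mq) r ∷ []) ≡ curᵈ (cur a a (suc l))
    levelUp zero    = refl
    levelUp (suc i)
      rewrite eval-append (un (2 ^ i) ∷ curᵈ (cur a ρ′ (suc i)) ∷ pair (num mq) r ∷ []) {i0} (var i0) (2 ^ i) (2 ^ i) refl refl
            | ite-un (2 ^ i) {un (2 ^ i + 2 ^ i)} {un 1}
            | ite-un (2 ^ i) {⟦ snd ⟧₁ (un (m ∸ i))} {un (m ∸ i)}
            | ite-un (2 ^ i) {num (fromℕ 2 ℚ.* amount mq (suc i))} {num (fromℕ 2 ℚ.* inverse mq)}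
            | positive i | +-identityʳ (2 ^ i) =
      cong (λ h → pair (num a) (pair (num a) (pair (un (2 ^ i + 2 ^ i)) (pair h (num (amount mq (suc (suc i)))))))) (pred-monus (m ∸ i) (pred[m∸n]≡m∸[1+n] m i))
      where
      pred-monus : ∀ k {l} → pred k ≡ l → ⟦ snd ⟧₁ (un k) ≡ un l
      pred-monus zero    refl = refl
      pred-monus (suc k) refl = refl

  eval-improve : ∀ {n} (ρ : Vec Data n) {s els st} cs hs w r → Vec.lookup ρ s ≡ roundᵈ (proj₁ (pack cs) , w) →
                 Vec.lookup ρ els ≡ historiesᵈ (cs ∷ₕ hs) → Vec.lookup ρ st ≡ pair (num mq) r →
                 ⟨ improveE s els st ⟩ ρ ≡ historiesᵈ (step cs ∷ₕ hs)
  eval-improve ρ {s} {els} {st} cs hs w r s≡ els≡ st≡ rewrite s≡ with proj₁ (pack cs)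
  ... | []             = els≡
  ... | D′@(_ ∷ _) with minimum-≤ D′ cs (here refl)
  ...   | δ , δ≡ , _
    rewrite eval-minimum (encode idᵈ D′ ∷ ρ) cs hs {suc els} els≡ {i0} D′ refl
          | eval-rev (maybeᵈ (minimum D′ cs) ∷ encode idᵈ D′ ∷ ρ) (var (suc (suc els))) (map (λ e → historyᵈ e ((cs ∷ₕ hs) e)) (allFin m)) els≡
          | δ≡ =
    iterate-map (λ e → historyᵈ e ((cs ∷ₕ hs) e)) (λ e → historyᵈ e ((lowerAll D′ δ cs ∷ₕ hs) e)) _ body (allFin m)
    where
    body : ∀ a e r st′ → ⟨ lowerStep i1 i0 (suc (suc st)) ⟩ (a ∷ historyᵈ e (cs e ∷ hs e) ∷ r ∷ st′ ∷ num δ ∷ encode idᵈ D′ ∷ ρ)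
           ≡ pair (historyᵈ e (lowerAll D′ δ cs e ∷ hs e)) a
    body a e r′ st′
      rewrite eval-member (idᵈ e ∷ a ∷ historyᵈ e (cs e ∷ hs e) ∷ r′ ∷ st′ ∷ num δ ∷ encode idᵈ D′ ∷ ρ) {i0} {suc (↑ i1)} e D′ refl refl
            | eval-lower (curᵈ (cs e) ∷ idᵈ e ∷ a ∷ historyᵈ e (cs e ∷ hs e) ∷ r′ ∷ st′ ∷ num δ ∷ encode idᵈ D′ ∷ ρ)
                {i0} {suc (suc (↑ i0))} {suc (suc (↑ (suc (suc st))))} (cs e) δ r refl refl st≡
      with member? e D′
    ... | true  = refl
    ... | false = refl

  newsᵈ : (Fin m → Maybe ℚ) → Data
  newsᵈ news = encode (maybeᵈ ∘ news) (allFin m)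

  eval-arrive : ∀ {n} (ρ : Vec Data n) (e : Ex n) {msg U} hs news → ⟨ e ⟩ ρ ≡ historiesᵈ hs →
                Vec.lookup ρ msg ≡ newsᵈ news → Vec.lookup ρ U ≡ un m →
                ⟨ for (rev e) nilE (arriveStep msg U) ⟩ ρ ≡ historiesᵈ (arrive news hs)
  eval-arrive ρ e {msg} {U} hs news e≡ msg≡ U≡
    rewrite eval-rev ρ e (map (λ e → historyᵈ e (hs e)) (allFin m)) e≡ =
    iterate-map (λ e → historyᵈ e (hs e)) (λ e → historyᵈ e (arrive news hs e)) _ body (allFin m)
    where
    body : ∀ a e r st → ⟨ arriveStep msg U ⟩ (a ∷ historyᵈ e (hs e) ∷ r ∷ st ∷ ρ) ≡ pair (historyᵈ e (arrive news hs e)) a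
    body a e r st
      rewrite iterate-nth (toℕ e) (Vec.lookup ρ msg) | msg≡ | nth-encode (maybeᵈ ∘ news) e | U≡
      with news e
    ... | nothing = refl
    ... | just q  = refl

  eval-output : ∀ {n} (ρ : Vec Data n) {els} hs → Vec.lookup ρ els ≡ historiesᵈ hs → ⟨ outputE els ⟩ ρ ≡ outputᵈ hs
  eval-output ρ {els} hs els≡
    rewrite eval-rev ρ (var els) (map (λ e → historyᵈ e (hs e)) (allFin m)) els≡ =
    iterate-map (λ e → historyᵈ e (hs e)) (λ e → encode out (reverse (hs e))) _ body (allFin m)
    where
    out : Cur → Data
    out c = num (truncated (amount mq (Cur.lev c)))
    body : ∀ a e r st → ⟨ for (sndE (var i1)) nilE outputStep ∶ var i0 ⟩ (a ∷ historyᵈ e (hs e) ∷ r ∷ st ∷ ρ)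
           ≡ pair (encode out (reverse (hs e))) a
    body a e r st = cong (λ h → pair h a) (trans
      (iterate-foldl list curᵈ (λ a c → out c ∷ a) _ inner [] (hs e))
      (cong list (go (hs e) [])))
      where
      inner : ∀ b c r′ st′ → ⟨ outputStep ⟩ (list b ∷ curᵈ c ∷ r′ ∷ st′ ∷ a ∷ historyᵈ e (hs e) ∷ r ∷ st ∷ ρ) ≡ pair (out c) (list b)
      inner b c r′ st′ = cong (λ h → pair h (list b))
        (trans (ite-truth (does (amount mq (Cur.lev c) ℚ.≤? 1ℚ))) (sym (if-cong num (does (amount mq (Cur.lev c) ℚ.≤? 1ℚ)))))
      go : ∀ cs zs → foldl (λ a c → out c ∷ a) (map out zs) cs ≡ map out (foldl (λ a c → c ∷ a) zs cs)
      go []       zs = refl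
      go (c ∷ cs) zs = go cs (c ∷ zs)

  eval-unary : ∀ {n} (ρ : Vec Data n) {i} ys → Vec.lookup ρ i ≡ list ys → ⟨ unaryE i ⟩ ρ ≡ un (length ys)
  eval-unary ρ ys i≡ rewrite i≡ = trans (iterate-un-list ys 0) (cong un (+-identityʳ (length ys)))

  eval-initial : ∀ {n} (ρ : Vec Data n) {msg} ds → length ds ≡ m → Vec.lookup ρ msg ≡ list ds →
                 ⟨ initialE msg ⟩ ρ ≡ historiesᵈ (λ _ → [])
  eval-initial ρ {msg} ds len msg≡ rewrite eval-rev ρ (var msg) ds msg≡ =
    trans (iterate-applyUpTo (λ i → pair (un i) nil) _
             (λ a b ys st → cong (λ h → pair (pair h nil) a) (eval-unary (a ∷ b ∷ list ys ∷ st ∷ ρ) {i2} ys refl))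
             (reverse ds) [])
      (cong list (trans (List.++-identityʳ _)
        (trans (cong (applyUpTo _) (trans (List.length-reverse ds) len)) (sym (map-toℕ-allFin (λ i → pair (un i) nil) m)))))

  eval-range : ∀ {n} (ρ : Vec Data n) {i} k → Vec.lookup ρ i ≡ un k →
               ⟨ for (var i) nilE (unaryE i2 ∶ var i0) ⟩ ρ ≡ encode un (upTo k)
  eval-range ρ {i} k i≡ rewrite trans i≡ (un-list k) =
    trans (iterate-applyUpTo un _ (λ a b ys st → cong (λ h → pair h a) (eval-unary (a ∷ b ∷ list ys ∷ st ∷ ρ) {i2} ys refl))
             (replicate k nil) [])
      (cong list (trans (List.++-identityʳ _)
        (trans (cong (applyUpTo un) (List.length-replicate k)) (sym (List.map-upTo un k)))))

  eval-square : ∀ {n} (ρ : Vec Data n) {i j} ds → length ds ≡ m → Vec.lookup ρ i ≡ list ds → Vec.lookup ρ j ≡ un m →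
                ⟨ for (var i) nilE (append (↑ j) (var i0)) ⟩ ρ ≡ un (m * m)
  eval-square ρ {i} {j} ds len i≡ j≡ rewrite i≡ =
    trans (go ds 0) (cong un (trans (+-identityʳ _) (cong (_* m) len)))
    where
    go : ∀ ds z → iterate (λ a d e st → ⟨ append (↑ j) (var i0) ⟩ (a ∷ d ∷ e ∷ st ∷ ρ)) (list ds) (un z) ≡ un (length ds * m + z)
    go []       z = refl
    go (d ∷ ds) z
      rewrite eval-append (un z ∷ d ∷ list ds ∷ pair (list (d ∷ ds)) (un z) ∷ ρ) {↑ j} (var i0) m z j≡ refl =
      trans (go ds (m + z)) (cong un (trans (sym (+-assoc (length ds * m) m z)) (cong (_+ z) (+-comm (length ds * m) m))))

-- Evaluation and accumulator sizes of the whole program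

module _ (O : Data → Bool) (S : ℕ) where

  evalₚ-bind : ∀ {n} (p : Pr n) (q : Pr (suc n)) {ρ : Vec Data n} {v} →
               evalₚ O p ρ ≡ v → evalₚ O (bind p q) ρ ≡ evalₚ O q (v ∷ ρ)
  evalₚ-bind p q {ρ} eq = cong (λ v → evalₚ O q (v ∷ ρ)) eq

  fits-bind : ∀ {n} (p : Pr n) (q : Pr (suc n)) {ρ : Vec Data n} {v} → Fits O S p ρ →
              evalₚ O p ρ ≡ v → Fits O S q (v ∷ ρ) → Fits O S (bind p q) ρ
  fits-bind p q {ρ} fp eq fq = fp , subst (λ v → Fits O S q (v ∷ ρ)) (sym eq) fq

  fitsLoop-un : ∀ {A : Set} (encA : A → Data) (step : A → A) (G : Data → Data → Data → Data → Set)
                (f : Data → Data → Data → Data → Data) →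
                (∀ a e st → f (encA a) nil e st ≡ encA (step a)) →
                ∀ n a → (∀ i → i ≤ n → size (encA (repeat i step a)) ≤ S) →
                (∀ i → i < n → ∀ e st → G (encA (repeat i step a)) nil e st) →
                FitsLoop O S G f (un n) (encA a)
  fitsLoop-un encA step G f f-step zero    a sized g = sized 0 z≤n
  fitsLoop-un encA step G f f-step (suc n) a sized g =
    sized 0 z≤n , g 0 (s≤s z≤n) _ _ ,
    subst (FitsLoop O S G f (un n)) (sym (f-step a (un n) _))
      (fitsLoop-un encA step G f f-step n (step a) (λ i i≤n → sized (suc i) (s≤s i≤n)) (λ i i<n → g (suc i) (s≤s i<n)))

module Program (m : ℕ) (mq : ℚ) (indep : Subset m → Bool) where
  open Outer m mq indep public

  opaque
    steps : Curs → Curs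
    steps = repeat (suc V) step

    steps≡ : ∀ cs → steps cs ≡ repeat (suc V) step cs
    steps≡ cs = refl

  record PackEnv (ρ : Vec Data 15) (w : Loads) : Set where
    field
      loads≡ : Vec.lookup ρ i0 ≡ loadsᵈ w
      N≡     : Vec.lookup ρ (suc i9) ≡ un (m * m)
      M≡     : Vec.lookup ρ (suc (suc i9)) ≡ un M
      vs≡    : Vec.lookup ρ i7 ≡ encode un (upTo (suc V))

  module _ {ρ : Vec Data 15} {w : Loads} (env : PackEnv ρ w) where
    open PackEnv env

    private
      f : Data → Data → Data → Data → Data
      f a d e st = ⟨ roundE i0 (↑ (suc (suc i9))) (↑ i7) ⟩ (a ∷ d ∷ e ∷ st ∷ ρ)
      f-step : ∀ s e st → f (roundᵈ s) nil e st ≡ roundᵈ (round s)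
      f-step s e st = eval-round (roundᵈ s ∷ nil ∷ e ∷ st ∷ ρ) {i0} {↑ (suc (suc i9))} {↑ i7} s refl M≡ vs≡

    eval-packing : evalₚ Oracle packing ρ ≡ roundᵈ (repeat (m * m) round ([] , w))
    eval-packing rewrite loads≡ | N≡ = iterate-un roundᵈ round f f-step (m * m) ([] , w)

    fits-packing : ∀ {S} → (∀ i → i ≤ m * m → size (roundᵈ (repeat i round ([] , w))) ≤ S) → Fits Oracle S packing ρ
    fits-packing {S} sized rewrite loads≡ | N≡ =
      fitsLoop-un Oracle S roundᵈ round _ f f-step (m * m) ([] , w) sized (λ _ _ _ _ → tt)

  record Env (ρ : Vec Data 10) (cs : Curs) (hs : Histories) : Set where
    field
      {rest} : Data
      els≡ : Vec.lookup ρ i0 ≡ historiesᵈ (cs ∷ₕ hs)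
      st≡  : Vec.lookup ρ i1 ≡ pair (num mq) rest
      vs≡  : Vec.lookup ρ i2 ≡ encode un (upTo (suc V))
      F≡   : Vec.lookup ρ i3 ≡ un (suc V)
      V≡   : Vec.lookup ρ i4 ≡ un V
      N≡   : Vec.lookup ρ i5 ≡ un (m * m)
      M≡   : Vec.lookup ρ i6 ≡ un M

  PackSized : ℕ → Curs → Set
  PackSized S cs = ∀ i → i ≤ m * m → size (roundᵈ (repeat i round ([] , loads cs))) ≤ S

  module _ {ρ : Vec Data 10} {cs : Curs} {hs : Histories} (env : Env ρ cs hs) where
    open Env env

    private
      f : Data → Data → Data → Data → Data
      f a d e st = evalₚ Oracle improve (a ∷ d ∷ e ∷ st ∷ ρ)

      module _ (cs′ : Curs) (e st : Data) where
        ρ₁ : Vec Data 14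
        ρ₁ = historiesᵈ (cs′ ∷ₕ hs) ∷ nil ∷ e ∷ st ∷ ρ
        loads≡ : evalₚ Oracle (exp (loadsE i0 (suc i9) i8)) ρ₁ ≡ loadsᵈ (loads cs′)
        loads≡ = eval-loads ρ₁ {i0} {suc i9} {i8} cs′ hs refl M≡ V≡
        packEnv : PackEnv (loadsᵈ (loads cs′) ∷ ρ₁) (loads cs′)
        packEnv = record { loads≡ = refl ; N≡ = N≡ ; M≡ = M≡ ; vs≡ = vs≡ }
        f-step : f (historiesᵈ (cs′ ∷ₕ hs)) nil e st ≡ historiesᵈ (step cs′ ∷ₕ hs)
        f-step =
          trans (evalₚ-bind Oracle 0 (exp (loadsE i0 (suc i9) i8)) (bind packing (exp (improveE i0 i2 i7))) {ρ₁} loads≡)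
          (trans (evalₚ-bind Oracle 0 packing (exp (improveE i0 i2 i7)) {loadsᵈ (loads cs′) ∷ ρ₁} (eval-packing packEnv))
            (eval-improve (roundᵈ (pack cs′) ∷ loadsᵈ (loads cs′) ∷ ρ₁) {i0} {i2} {i7} cs′ hs (proj₂ (pack cs′)) rest refl refl st≡))
        fits-improve : ∀ {S} → PackSized S cs′ → Fits Oracle S improve ρ₁
        fits-improve {S} sized =
          fits-bind Oracle S (exp (loadsE i0 (suc i9) i8)) (bind packing (exp (improveE i0 i2 i7))) {ρ₁} tt loads≡
            (fits-bind Oracle S packing (exp (improveE i0 i2 i7)) {loadsᵈ (loads cs′) ∷ ρ₁}
              (fits-packing packEnv sized) (eval-packing packEnv) tt)

      improveLoop : Pr 10
      improveLoop = iter (var i3) (var i0) improve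

      eval-loop : evalₚ Oracle improveLoop ρ ≡ historiesᵈ (steps cs ∷ₕ hs)
      eval-loop rewrite F≡ | els≡ | steps≡ cs = iterate-un (λ c → historiesᵈ (c ∷ₕ hs)) step f f-step (suc V) cs

    result : Data
    result = pair (pair (num mq) (historiesᵈ (steps cs ∷ₕ hs))) (outputᵈ (steps cs ∷ₕ hs))

    opaque
      unfolding main

      eval-main : evalₚ Oracle main ρ ≡ result
      eval-main = trans (evalₚ-bind Oracle 0 improveLoop (exp ((fstE (var i2) ∶ var i0) ∶ outputE i0)) {ρ} eval-loop)
        (cong₂ (λ d e → pair (pair (⟦ fst ⟧₁ d) (historiesᵈ (steps cs ∷ₕ hs))) e) st≡
          (eval-output (historiesᵈ (steps cs ∷ₕ hs) ∷ ρ) {i0} (steps cs ∷ₕ hs) refl))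

      fits-main : ∀ {S} → (∀ i → i ≤ suc V → size (historiesᵈ (repeat i step cs ∷ₕ hs)) ≤ S) →
                  (∀ i → i < suc V → PackSized S (repeat i step cs)) → Fits Oracle S main ρ
      fits-main {S} sized packSized =
        fits-bind Oracle S improveLoop (exp ((fstE (var i2) ∶ var i0) ∶ outputE i0)) {ρ} fits-loop eval-loop tt
        where
        fits-loop : Fits Oracle S improveLoop ρ
        fits-loop rewrite F≡ | els≡ =
          fitsLoop-un Oracle S (λ c → historiesᵈ (c ∷ₕ hs)) step _ f f-step (suc V) cs sized
            (λ i i<F e st → fits-improve (repeat i step cs) e st (packSized i i<F))

  module _ (st : Data) (hs₀ : Histories) (news : Fin m → Maybe ℚ) (cs : Curs) (hs : Histories)
    (arrive≡ : ∀ e → arrive news hs₀ e ≡ cs e ∷ hs e)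
    (start : st ≡ pair (num mq) (historiesᵈ hs₀) ⊎ (st ≡ num mq × (∀ e → hs₀ e ≡ []))) where

    private
      msg : Data
      msg = newsᵈ news
      items : List Data
      items = map (maybeᵈ ∘ news) (allFin m)
      #items : length items ≡ m
      #items = trans (List.length-map (maybeᵈ ∘ news) (allFin m)) (List.length-tabulate {n = m} (λ i → i))

      ρ₀ : Vec Data 2
      ρ₀ = st ∷ msg ∷ []
      ρ₁ : Vec Data 3
      ρ₁ = un m ∷ ρ₀
      ρ₂ : Vec Data 4
      ρ₂ = un M ∷ ρ₁
      ρ₃ : Vec Data 5
      ρ₃ = un (m * m) ∷ ρ₂
      ρ₄ : Vec Data 6
      ρ₄ = un V ∷ ρ₃
      ρ₅ : Vec Data 7
      ρ₅ = un (suc V) ∷ ρ₄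
      ρ₆ : Vec Data 8
      ρ₆ = encode un (upTo (suc V)) ∷ ρ₅
      ρ₇ : Vec Data 9
      ρ₇ = pair (num mq) (historiesᵈ hs₀) ∷ ρ₆
      ρ₈ : Vec Data 10
      ρ₈ = historiesᵈ (cs ∷ₕ hs) ∷ ρ₇

      start≡ : ⟨ cond (fstE (var i6)) (var i6) (var i6 ∶ initialE i7) ⟩ ρ₆ ≡ pair (num mq) (historiesᵈ hs₀)
      start≡ = go start
        where
        go : st ≡ pair (num mq) (historiesᵈ hs₀) ⊎ (st ≡ num mq × (∀ e → hs₀ e ≡ [])) →
             ⟨ cond (fstE (var i6)) (var i6) (var i6 ∶ initialE i7) ⟩ ρ₆ ≡ pair (num mq) (historiesᵈ hs₀)
        go (inj₁ eq) = cong (λ h → ite (⟦ fst ⟧₁ h) h (pair h (⟨ initialE i7 ⟩ ρ₆))) eq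
        go (inj₂ (eq , hs₀≡)) = trans (cong (λ h → ite (⟦ fst ⟧₁ h) h (pair h (⟨ initialE i7 ⟩ ρ₆))) eq) (cong (pair (num mq)) (trans (eval-initial ρ₆ {i7} items #items refl)
              (cong list (List.map-cong (λ e → cong (historyᵈ e) (sym (hs₀≡ e))) (allFin m)))))

      els≡ : ⟨ for (rev (sndE (var i0))) nilE (arriveStep i8 i6) ⟩ ρ₇ ≡ historiesᵈ (cs ∷ₕ hs)
      els≡ = trans (eval-arrive ρ₇ (sndE (var i0)) {i8} {i6} hs₀ news refl refl refl)
        (cong list (List.map-cong (λ e → cong (historyᵈ e) (arrive≡ e)) (allFin m)))

      env : Env ρ₈ cs hs
      env = record { els≡ = refl ; st≡ = refl ; vs≡ = refl ; F≡ = refl ; V≡ = refl ; N≡ = refl ; M≡ = refl }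

      opaque
        unfolding program

        -- Evaluation and `Fits` pass through the same eight bindings. Abstracting over the
        -- predicate K walks through them once for both.
        chain : (K : ∀ {n} → Pr n → Vec Data n → Set) →
                (∀ {n} (e : Ex n) (q : Pr (suc n)) {ρ : Vec Data n} {v} →
                   ⟨ e ⟩ ρ ≡ v → K q (v ∷ ρ) → K (bind (exp e) q) ρ) →
                K main ρ₈ → K program ρ₀
        chain K b k =
          b (unaryE i1) _ (trans (eval-unary ρ₀ {i1} items refl) (cong un #items))
          (b (append i0 (var i0)) _ (eval-append ρ₁ {i0} (var i0) m m refl refl)
          (b (for (var i1) nilE (append (↑ i1) (var i0))) _ square≡
          (b (append i1 (var i0)) _ (eval-append ρ₃ {i1} (var i0) M (m * m) refl refl)
          (b (nilE ∶ var i0) _ refl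
          (b (for (var i0) nilE (unaryE i2 ∶ var i0)) _ (eval-range ρ₅ {i0} (suc V) refl)
          (b (cond (fstE (var i6)) (var i6) (var i6 ∶ initialE i7)) _ start≡
          (b (for (rev (sndE (var i0))) nilE (arriveStep i8 i6)) _ els≡ k)))))))
          where
          square≡ : ⟨ for (var i1) nilE (append (↑ i1) (var i0)) ⟩ ρ₂ ≡ un (m * m)
          square≡ = eval-square ρ₂ {i1} {i1} (replicate m nil) (List.length-replicate m) (un-list m) refl

    eval-program : evalₚ Oracle program ρ₀ ≡ result env
    eval-program = chain (λ p ρ → evalₚ Oracle p ρ ≡ result env)
      (λ e q {ρ} {v} eq k → trans (evalₚ-bind Oracle 0 (exp e) q {ρ} {v} eq) k) (eval-main env)

    fits-program : ∀ {S} → (∀ i → i ≤ suc V → size (historiesᵈ (repeat i step cs ∷ₕ hs)) ≤ S) →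
                   (∀ i → i < suc V → PackSized S (repeat i step cs)) → Fits Oracle S program ρ₀
    fits-program {S} sized packSized = chain (Fits Oracle S)
      (λ e q {ρ} {v} eq k → fits-bind Oracle S (exp e) q {ρ} {v} tt eq k) (fits-main env sized packSized)

-- Sums and comparisons of natural numbers

sumᴺ-mono : ∀ {n} {f g : Fin n → ℕ} → (∀ i → f i ≤ g i) → sumᴺ f ≤ sumᴺ g
sumᴺ-mono {zero}  f≤g = z≤n
sumᴺ-mono {suc n} f≤g = +-mono-≤ (f≤g zero) (sumᴺ-mono (f≤g ∘ suc))

sumᴺ-bound : ∀ {n b} {f : Fin n → ℕ} → (∀ i → f i ≤ b) → sumᴺ f ≤ n * b
sumᴺ-bound {zero}  f≤b = z≤n
sumᴺ-bound {suc n} f≤b = +-mono-≤ (f≤b zero) (sumᴺ-bound (f≤b ∘ suc))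

≤-sumᴺ : ∀ {n} (f : Fin n → ℕ) i → f i ≤ sumᴺ f
≤-sumᴺ f zero    = m≤m+n _ _
≤-sumᴺ f (suc i) = ≤-trans (≤-sumᴺ (f ∘ suc) i) (m≤n+m _ _)

foldl-sumᴺ : ∀ {n} (step : ℕ → Fin n → ℕ) (f : Fin n → ℕ) → (∀ a e → step a e ≡ f e + a) →
             foldl step 0 (allFin n) ≡ sumᴺ f
foldl-sumᴺ {n} step f step≡ = trans (go n (λ i → i) 0) (+-identityʳ _)
  where
  open ≡-Reasoning
  go : ∀ k (g : Fin k → Fin n) a → foldl step a (List.tabulate g) ≡ sumᴺ (f ∘ g) + a
  go zero    g a = refl
  go (suc k) g a = begin
    foldl step (step a (g zero)) (List.tabulate (g ∘ suc))   ≡⟨ go k (g ∘ suc) (step a (g zero)) ⟩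
    sumᴺ (f ∘ g ∘ suc) + step a (g zero)                     ≡⟨ cong (sumᴺ (f ∘ g ∘ suc) +_) (step≡ a (g zero)) ⟩
    sumᴺ (f ∘ g ∘ suc) + (f (g zero) + a)                    ≡⟨ sym (+-assoc (sumᴺ (f ∘ g ∘ suc)) (f (g zero)) a) ⟩
    (sumᴺ (f ∘ g ∘ suc) + f (g zero)) + a                    ≡⟨ cong (_+ a) (+-comm (sumᴺ (f ∘ g ∘ suc)) (f (g zero))) ⟩
    (f (g zero) + sumᴺ (f ∘ g ∘ suc)) + a                    ∎

pos⁺ : ∀ {a b} → b < a → pos (a ∸ b) ≡ true
pos⁺ {a} {b} b<a with a ∸ b | m<n⇒0<n∸m b<a
... | suc _ | _ = refl

pos⁻ : ∀ {a b} → pos (a ∸ b) ≡ true → b < a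
pos⁻ {a} {b} eq with b <? a
... | yes b<a = b<a
... | no  b≮a rewrite m≤n⇒m∸n≡0 (≮⇒≥ b≮a) with eq
...   | ()

pos-false⁺ : ∀ {a b} → a ≤ b → pos (a ∸ b) ≡ false
pos-false⁺ a≤b rewrite m≤n⇒m∸n≡0 a≤b = refl

pos-false⁻ : ∀ {a b} → pos (a ∸ b) ≡ false → a ≤ b
pos-false⁻ {a} {b} eq with a ≤? b
... | yes a≤b = a≤b
... | no  a≰b with trans (sym (pos⁺ (≰⇒> a≰b))) eq
...   | ()

-- Greedy bases, violated constraints and prices

module Greedy (m : ℕ) (indep : Subset m → Bool) (M V : ℕ) where
  open Packing m indep M V

  module _ (w : Loads) where

    basisBelow : ℕ → List (Fin m)
    basisBelow n = foldl (λ B v → foldl (extend w v) B (allFin m)) [] (upTo n)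

    private
      pass : ℕ → List (Fin m) → List (Fin m) → List (Fin m)
      pass v = foldl (extend w v)

      basisBelow-suc : ∀ n → basisBelow (suc n) ≡ pass n (basisBelow n) (allFin m)
      basisBelow-suc n = trans (cong (foldl _ []) (sym (List.upTo-∷ʳ n))) (List.foldl-∷ʳ _ [] n (upTo n))

      Low : ℕ → List (Fin m) → Set
      Low v B = ∀ {x} → x ∈ B → above? w v x ≡ false

      -- The witness A is the partial basis at which e was rejected in pass v. It persists in every
      -- later basis and consists of elements of key at most v, unlike what is added afterwards.
      Blocked : ℕ → List (Fin m) → Fin m → Set
      Blocked v B e = ∃[ A ] ((∀ {x} → x ∈ A → x ∈ B × above? w v x ≡ false) × indep (subset (e ∷ A)) ≡ false)

      extend-cases : ∀ v B e →
        extend w v B e ≡ B × (above? w v e ≡ true ⊎ indep (subset (e ∷ B)) ≡ false)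
        ⊎ extend w v B e ≡ e ∷ B × above? w v e ≡ false × indep (subset (e ∷ B)) ≡ true
      extend-cases v B e with above? w v e | indep (subset (e ∷ B))
      ... | true  | _     = inj₁ (refl , inj₁ refl)
      ... | false | true  = inj₂ (refl , refl , refl)
      ... | false | false = inj₁ (refl , inj₂ refl)

      pass-⊇ : ∀ v xs B {x} → x ∈ B → x ∈ pass v B xs
      pass-⊇ v []       B x∈ = x∈
      pass-⊇ v (e ∷ xs) B x∈ with extend w v B e | extend-cases v B e
      ... | _ | inj₁ (refl , _) = pass-⊇ v xs B x∈
      ... | _ | inj₂ (refl , _) = pass-⊇ v xs (e ∷ B) (there x∈)

      low-∷ : ∀ v B e → above? w v e ≡ false → Low v B → Low v (e ∷ B)
      low-∷ v B e low-e low (here refl) = low-e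
      low-∷ v B e low-e low (there x∈)  = low x∈

      pass-low : ∀ v xs B → Low v B → Low v (pass v B xs)
      pass-low v []       B low = low
      pass-low v (e ∷ xs) B low with extend w v B e | extend-cases v B e
      ... | _ | inj₁ (refl , _)         = pass-low v xs B low
      ... | _ | inj₂ (refl , low-e , _) = pass-low v xs (e ∷ B) (low-∷ v B e low-e low)

      pass-indep : ∀ v xs B → indep (subset B) ≡ true → indep (subset (pass v B xs)) ≡ true
      pass-indep v []       B ind = ind
      pass-indep v (e ∷ xs) B ind with extend w v B e | extend-cases v B e
      ... | _ | inj₁ (refl , _)          = pass-indep v xs B ind
      ... | _ | inj₂ (refl , _ , ind′)   = pass-indep v xs (e ∷ B) ind′

      pass-maximal : ∀ v xs B {e} → Low v B → e ∈ xs → above? w v e ≡ false →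
                     e ∈ pass v B xs ⊎ Blocked v (pass v B xs) e
      pass-maximal v (x ∷ xs) B low (there e∈) low-e with extend w v B x | extend-cases v B x
      ... | _ | inj₁ (refl , _)         = pass-maximal v xs B low e∈ low-e
      ... | _ | inj₂ (refl , low-x , _) = pass-maximal v xs (x ∷ B) (low-∷ v B x low-x low) e∈ low-e
      pass-maximal v (x ∷ xs) B low (here refl) low-e with extend w v B x | extend-cases v B x
      ... | _ | inj₂ (refl , _)           = inj₁ (pass-⊇ v xs (x ∷ B) (here refl))
      ... | _ | inj₁ (refl , inj₂ blocked) = inj₂ (B , (λ y∈ → pass-⊇ v xs B y∈ , low y∈) , blocked)
      ... | _ | inj₁ (refl , inj₁ high) with trans (sym high) low-e
      ...   | ()

      above-mono : ∀ {u v} x → u ≤ v → above? w u x ≡ false → above? w v x ≡ false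
      above-mono x u≤v eq = pos-false⁺ (≤-trans (pos-false⁻ eq) u≤v)

      basisBelow-low : ∀ n → Low n (basisBelow n)
      basisBelow-low zero    ()
      basisBelow-low (suc n) {x} x∈ =
        above-mono x (n≤1+n n) (pass-low n (allFin m) (basisBelow n) (basisBelow-low n) (subst (x ∈_) (basisBelow-suc n) x∈))

      basisBelow-maximal : ∀ n v e → v < n → above? w v e ≡ false → e ∈ basisBelow n ⊎ Blocked v (basisBelow n) e
      basisBelow-maximal (suc n) v e (s≤s v≤n) low-e
        rewrite basisBelow-suc n with m≤n⇒m<n∨m≡n v≤n
      ... | inj₂ refl = pass-maximal n (allFin m) (basisBelow n) (basisBelow-low n) (∈-allFin e) low-e
      ... | inj₁ v<n with basisBelow-maximal n v e v<n low-e
      ...   | inj₁ e∈ = inj₁ (pass-⊇ n (allFin m) (basisBelow n) e∈)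
      ...   | inj₂ (A , A⊆ , blocked) =
        inj₂ (A , (λ x∈ → pass-⊇ n (allFin m) (basisBelow n) (proj₁ (A⊆ x∈)) , proj₂ (A⊆ x∈)) , blocked)

    -- One basis serves all thresholds, since the passes run through increasing v. This is the
    -- optimality of the greedy basis in the form that weak duality uses; at v = V it says that the
    -- chosen set is a basis.
    basis-maximal : ∀ {v e} → v ≤ V → above? w v e ≡ false →
      e ∈ basis w ⊎ (∃[ A ] ((∀ {x} → x ∈ A → x ∈ basis w × above? w v x ≡ false) × indep (subset (e ∷ A)) ≡ false))
    basis-maximal {v} {e} v≤V low = basisBelow-maximal (suc V) v e (s≤s v≤V) low

    basis-indep : indep (subset []) ≡ true → indep (subset (basis w)) ≡ true
    basis-indep ind = go (suc V)
      where
      go : ∀ n → indep (subset (basisBelow n)) ≡ true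
      go zero    = ind
      go (suc n) rewrite basisBelow-suc n = pass-indep n (allFin m) (basisBelow n) (go n)

    private
      collect : ℕ → List (Fin m) → Fin m → List (Fin m)
      collect v D e = if above? w v e then e ∷ D else D

      aboves-⊇ : ∀ v xs D {x} → x ∈ D → x ∈ foldl (collect v) D xs
      aboves-⊇ v []       D x∈ = x∈
      aboves-⊇ v (e ∷ xs) D x∈ with above? w v e
      ... | true  = aboves-⊇ v xs (e ∷ D) (there x∈)
      ... | false = aboves-⊇ v xs D x∈

      aboves⁺ : ∀ v xs D {x} → x ∈ xs → above? w v x ≡ true → x ∈ foldl (collect v) D xs
      aboves⁺ v (e ∷ xs) D (there x∈)  high = aboves⁺ v xs (collect v D e) x∈ high
      aboves⁺ v (e ∷ xs) D (here refl) high rewrite high = aboves-⊇ v xs (e ∷ D) (here refl)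

      aboves⁻ : ∀ v xs D {x} → x ∈ foldl (collect v) D xs → x ∈ D ⊎ above? w v x ≡ true
      aboves⁻ v []       D x∈ = inj₁ x∈
      aboves⁻ v (e ∷ xs) D x∈ with above? w v e in eq
      ... | false = aboves⁻ v xs D x∈
      ... | true with aboves⁻ v xs (e ∷ D) x∈
      ...   | inj₂ high         = inj₂ high
      ...   | inj₁ (there x∈D)  = inj₁ x∈D
      ...   | inj₁ (here refl)  = inj₂ eq

    above⁺ : ∀ {v x} → above? w v x ≡ true → x ∈ above w v
    above⁺ {v} {x} = aboves⁺ v (allFin m) [] (∈-allFin x)

    above⁻ : ∀ {v x} → x ∈ above w v → above? w v x ≡ true
    above⁻ {v} x∈ with aboves⁻ v (allFin m) [] x∈
    ... | inj₂ high = high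

    demand-sum : ∀ v → demand w v ≡ sumᴺ (λ e → if above? w v e then Load.k (w e) else 0)
    demand-sum v = foldl-sumᴺ _ _ step
      where
      step : ∀ a e → (if above? w v e then Load.k (w e) + a else a) ≡ (if above? w v e then Load.k (w e) else 0) + a
      step a e with above? w v e
      ... | true  = refl
      ... | false = refl

    supply-sum : ∀ B v → supply w B v ≡ sumᴺ (λ e → if above? w v e then (if member? e B then M else 0) else 0)
    supply-sum B v = foldl-sumᴺ _ _ step
      where
      step : ∀ a e → (if above? w v e then (if member? e B then M + a else a) else a)
             ≡ (if above? w v e then (if member? e B then M else 0) else 0) + a
      step a e with above? w v e | member? e B
      ... | true  | true  = refl
      ... | true  | false = refl
      ... | false | _     = refl

    private
      overwrite : List (Fin m) → List (Fin m) → ℕ → List (Fin m)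
      overwrite B D v = if pos (supply w B v ∸ demand w v) then above w v else D

      -- The empty list stands for the absence of a violated constraint, so a violated set has to be
      -- nonempty. This follows from the strict deficit, which makes the supply positive.
      above-nonempty : ∀ B v → demand w v < supply w B v → above w v ≢ []
      above-nonempty B v d<s above≡[] = n≮0 (<-≤-trans d<s (≤-trans (≤-reflexive (supply-sum B v)) (≤-trans (sumᴺ-bound {b = 0} none) (≤-reflexive (*-zeroʳ m)))))
        where
        none : ∀ e → (if above? w v e then (if member? e B then M else 0) else 0) ≤ 0
        none e with above? w v e in eq
        ... | false = z≤n
        ... | true with subst (e ∈_) above≡[] (above⁺ {v} eq)
        ...   | ()

      violateds : ∀ B vs D → foldl (overwrite B) D vs ≡ [] →
                  D ≡ [] × (∀ {v} → v ∈ vs → supply w B v ≤ demand w v)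
      violateds B []       D eq = eq , λ ()
      violateds B (v ∷ vs) D eq with violateds B vs (overwrite B D v) eq
      ... | D′≡[] , rest with pos (supply w B v ∸ demand w v) in p
      ...   | true  = contradiction D′≡[] (above-nonempty B v (pos⁻ p))
      ...   | false = D′≡[] , λ { (here refl) → pos-false⁻ p ; (there v∈) → rest v∈ }

      violateds⁻ : ∀ B vs D → foldl (overwrite B) D vs ≡ D
                   ⊎ (∃[ v ] (v ∈ vs × demand w v < supply w B v × foldl (overwrite B) D vs ≡ above w v))
      violateds⁻ B []       D = inj₁ refl
      violateds⁻ B (v ∷ vs) D with violateds⁻ B vs (overwrite B D v)
      ... | inj₂ (u , u∈ , lt , eq) = inj₂ (u , there u∈ , lt , eq)
      ... | inj₁ eq with pos (supply w B v ∸ demand w v) in p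
      ...   | false = inj₁ eq
      ...   | true  = inj₂ (v , here refl , pos⁻ p , eq)

    violated-[] : ∀ B → violated w B ≡ [] → ∀ {v} → v ≤ V → supply w B v ≤ demand w v
    violated-[] B eq v≤V = proj₂ (violateds B (upTo (suc V)) [] eq) (∈-upTo⁺ (s≤s v≤V))

    violated-∷ : ∀ B {d D} → violated w B ≡ d ∷ D →
                 ∃[ v ] (v ≤ V × demand w v < supply w B v × d ∷ D ≡ above w v)
    violated-∷ B eq with violateds⁻ B (upTo (suc V)) []
    ... | inj₁ eq′ with trans (sym eq) eq′
    ...   | ()
    violated-∷ B eq | inj₂ (v , v∈ , lt , eq′) = v , s≤s⁻¹ (∈-upTo⁻ v∈) , lt , trans (sym eq) eq′

  -- Saturated elements have key 0 and are free.
  price : ℕ → ℕ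
  price zero        = 0
  price n@(suc _)   = 2 ^ n

  -- price n = weight 0 + … + weight (n - 1)
  weight : ℕ → ℕ
  weight zero        = 2
  weight v@(suc _)   = 2 ^ v

  priceBelow : ℕ → ℕ → ℕ
  priceBelow zero    key = 0
  priceBelow (suc n) key = (if pos (key ∸ n) then weight n else 0) + priceBelow n key

  price-suc : ∀ n → price (suc n) ≡ weight n + price n
  price-suc zero    = refl
  price-suc (suc n) = cong (2 ^ suc n +_) (+-identityʳ (2 ^ suc n))

  priceBelow-≤ : ∀ n key → n ≤ key → priceBelow n key ≡ price n
  priceBelow-≤ zero    key n≤key = refl
  priceBelow-≤ (suc n) key n<key
    rewrite pos⁺ n<key | priceBelow-≤ n key (<⇒≤ n<key) = sym (price-suc n)

  priceBelow-≥ : ∀ n key → key ≤ n → priceBelow n key ≡ price key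
  priceBelow-≥ n key key≤n with m≤n⇒m<n∨m≡n key≤n
  ... | inj₂ refl = priceBelow-≤ n n ≤-refl
  priceBelow-≥ (suc n) key _ | inj₁ (s≤s key≤n) rewrite pos-false⁺ key≤n = priceBelow-≥ n key key≤n

  -- Abel summation over the thresholds v < n.
  priced-supply : ∀ w B n → (∀ {v} → v < n → supply w B v ≤ demand w v) →
    sumᴺ (λ e → priceBelow n (Load.key (w e)) * (if member? e B then M else 0))
      ≤ sumᴺ (λ e → priceBelow n (Load.key (w e)) * Load.k (w e))
  priced-supply w B zero    _   = ≤-refl
  priced-supply w B (suc n) low = begin
    sumᴺ (λ e → priceBelow (suc n) (key e) * s e)
      ≡⟨ split s ⟩
    weight n * sumᴺ (λ e → if above? w n e then s e else 0) + sumᴺ (λ e → priceBelow n (key e) * s e)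
      ≤⟨ +-mono-≤ (*-monoʳ-≤ (weight n) (subst₂ _≤_ (supply-sum w B n) (demand-sum w n) (low ≤-refl)))
                  (priced-supply w B n (λ v<n → low (m≤n⇒m≤1+n v<n))) ⟩
    weight n * sumᴺ (λ e → if above? w n e then k e else 0) + sumᴺ (λ e → priceBelow n (key e) * k e)
      ≡⟨ sym (split k) ⟩
    sumᴺ (λ e → priceBelow (suc n) (key e) * k e) ∎
    where
    open ≤-Reasoning
    key k s : Fin m → ℕ
    key e = Load.key (w e)
    k e = Load.k (w e)
    s e = if member? e B then M else 0
    split : ∀ (f : Fin m → ℕ) → sumᴺ (λ e → priceBelow (suc n) (key e) * f e)
            ≡ weight n * sumᴺ (λ e → if above? w n e then f e else 0) + sumᴺ (λ e → priceBelow n (key e) * f e)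
    split f = trans (∑ᴺ.sum-cong-≗ pointwise)
      (trans (∑ᴺ.∑-distrib-+ (λ e → weight n * (if above? w n e then f e else 0)) (λ e → priceBelow n (key e) * f e))
        (cong (_+ sumᴺ (λ e → priceBelow n (key e) * f e)) (sym (∑ᴺ.*-distribˡ-sum (weight n) (λ e → if above? w n e then f e else 0)))))
      where
      pointwise : ∀ e → priceBelow (suc n) (key e) * f e
                  ≡ weight n * (if above? w n e then f e else 0) + priceBelow n (key e) * f e
      pointwise e with above? w n e
      ... | true  = *-distribʳ-+ (f e) (weight n) (priceBelow n (key e))
      ... | false = cong (_+ priceBelow n (key e) * f e) (sym (*-zeroʳ (weight n)))

-- For t ≤ m the t-th power of 1 + 1 / (2m) is at most 1 + t / m, so m steps at most double P.
-- `block` is this bound with denominators cleared.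
doubling : ∀ m N (P : ℕ → ℕ) → (∀ i → i < N → (m + m) * P (suc i) ≤ (m + m) * P i + P i) → 1 ≤ m →
           ∀ j → j * m ≤ N → P (j * m) ≤ 2 ^ j * P 0
doubling m N P grow 1≤m = blocks
  where
  open ≤-Reasoning
  instance
    m≢0 : NonZero m
    m≢0 = >-nonZero 1≤m
    2m≢0 : NonZero (m + m)
    2m≢0 = >-nonZero (≤-trans 1≤m (m≤m+n m m))
  block : ∀ s t → t ≤ m → s + t ≤ N → m * P (s + t) ≤ (m + t) * P s
  block s zero    _   _   rewrite +-identityʳ s = ≤-reflexive (cong (_* P s) (sym (+-identityʳ m)))
  block s (suc t) t<m s≤N rewrite +-suc s t =
    *-cancelˡ-≤ (m + m) (begin
      (m + m) * (m * P (suc (s + t)))                 ≡⟨ swap (m + m) m _ ⟩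
      m * ((m + m) * P (suc (s + t)))                 ≤⟨ *-monoʳ-≤ m (grow (s + t) s≤N) ⟩
      m * ((m + m) * P (s + t) + P (s + t))           ≡⟨ factor m (P (s + t)) ⟩
      suc (m + m) * (m * P (s + t))                   ≤⟨ *-monoʳ-≤ (suc (m + m)) (block s t (<⇒≤ t<m) (<⇒≤ s≤N)) ⟩
      suc (m + m) * ((m + t) * P s)                   ≡⟨ sym (*-assoc (suc (m + m)) (m + t) (P s)) ⟩
      -- Here t < m enters: the increase m + t has to be at most 2m.
      ((m + t) + (m + m) * (m + t)) * P s             ≤⟨ *-monoˡ-≤ (P s) (+-monoˡ-≤ ((m + m) * (m + t)) (+-monoʳ-≤ m (<⇒≤ t<m))) ⟩
      ((m + m) + (m + m) * (m + t)) * P s             ≡⟨ regroup m t (P s) ⟩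
      (m + m) * ((m + suc t) * P s)                   ∎)
    where
    swap : ∀ a b c → a * (b * c) ≡ b * (a * c)
    swap = solve-∀
    factor : ∀ m p → m * ((m + m) * p + p) ≡ suc (m + m) * (m * p)
    factor = solve-∀
    regroup : ∀ m t p → ((m + m) + (m + m) * (m + t)) * p ≡ (m + m) * ((m + suc t) * p)
    regroup = solve-∀
  blocks : ∀ j → j * m ≤ N → P (j * m) ≤ 2 ^ j * P 0
  blocks zero    _   = ≤-reflexive (sym (+-identityʳ (P 0)))
  blocks (suc j) jm≤N rewrite +-comm m (j * m) = begin
    P (j * m + m)       ≤⟨ *-cancelˡ-≤ m (≤-trans (block (j * m) m ≤-refl jm≤N) (≤-reflexive (two m (P (j * m))))) ⟩
    2 * P (j * m)       ≤⟨ *-monoʳ-≤ 2 (blocks j (≤-trans (m≤m+n (j * m) m) jm≤N)) ⟩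
    2 * (2 ^ j * P 0)   ≡⟨ sym (*-assoc 2 (2 ^ j) (P 0)) ⟩
    2 ^ suc j * P 0     ∎
    where
    two : ∀ m p → (m + m) * p ≡ m * (2 * p)
    two = solve-∀

repeat-suc : ∀ {A : Set} n (g : A → A) a → repeat (suc n) g a ≡ g (repeat n g a)
repeat-suc zero    g a = refl
repeat-suc (suc n) g a = repeat-suc n g (g a)

2n≤2^n : ∀ n → 1 ≤ n → n + n ≤ 2 ^ n
2n≤2^n (suc n) _ = begin
  suc n + suc n       ≤⟨ +-mono-≤ (n<2^n n) (n<2^n n) ⟩
  2 ^ n + 2 ^ n       ≡⟨ cong (2 ^ n +_) (sym (+-identityʳ (2 ^ n))) ⟩
  2 ^ suc n           ∎
  where open ≤-Reasoning

2^-cancel-< : ∀ {i j} → 2 ^ i < 2 ^ j → i < j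
2^-cancel-< {i} {j} lt with i <? j
... | yes i<j = i<j
... | no  i≮j = contradiction (^-monoʳ-≤ 2 (≮⇒≥ i≮j)) (<⇒≱ lt)

-- Analysis of the multiplicative weights

module PackingAnalysis (m : ℕ) (mq : ℚ) (indep : Subset m → Bool) (1≤m : 1 ≤ m) where
  open Outer m mq indep
  open Greedy m indep M V

  N : ℕ
  N = m * m

  private
    M>0 : 0 < M
    M>0 = ≤-trans 1≤m (m≤m+n m m)

    m+N≤V : m + N ≤ V
    m+N≤V = +-monoˡ-≤ N (m≤m+n m m)

  -- The loads when every round updates. The actual run follows this sequence up to the first
  -- violation, as `rounds-cases` shows, and `Quiet` says that none has occurred yet.
  seq : Loads → ℕ → Loads
  seq w zero    = w
  seq w (suc i) = update (seq w i) (basis (seq w i))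

  bases : Loads → ℕ → List (Fin m)
  bases w i = basis (seq w i)

  Quiet : Loads → ℕ → Set
  Quiet w i = ∀ j → j < i → violated (seq w j) (bases w j) ≡ []

  rounds-cases : ∀ w i →
    (repeat i round ([] , w) ≡ ([] , seq w i) × Quiet w i)
    ⊎ (∃[ j ] ∃[ d ] ∃[ D ] (j < i × Quiet w j × violated (seq w j) (bases w j) ≡ d ∷ D
                              × repeat i round ([] , w) ≡ (d ∷ D , seq w j)))
  rounds-cases w zero = inj₁ (refl , λ j ())
  rounds-cases w (suc i) rewrite repeat-suc i round ([] , w) with rounds-cases w i
  ... | inj₂ (j , d , D , j<i , quiet , viol , eq) rewrite eq = inj₂ (j , d , D , m≤n⇒m≤1+n j<i , quiet , viol , refl)
  ... | inj₁ (eq , quiet) rewrite eq with violated (seq w i) (bases w i) in viol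
  ...   | d ∷ D = inj₂ (i , d , D , ≤-refl , quiet , viol , refl)
  ...   | []    = inj₁ (refl , quiet′)
    where
    quiet′ : Quiet w (suc i)
    quiet′ j (s≤s j≤i) with m≤n⇒m<n∨m≡n j≤i
    ... | inj₁ j<i  = quiet j j<i
    ... | inj₂ refl = viol

  pack-[] : ∀ cs → proj₁ (pack cs) ≡ [] → Quiet (loads cs) N
  pack-[] cs eq with rounds-cases (loads cs) N
  ... | inj₁ (_ , quiet) = quiet
  ... | inj₂ (j , d , D , _ , _ , _ , eq′) with trans (sym eq) (cong proj₁ eq′)
  ...   | ()

  pack-∷ : ∀ cs {d D} → proj₁ (pack cs) ≡ d ∷ D →
           ∃[ j ] (j < N × Quiet (loads cs) j × violated (seq (loads cs) j) (bases (loads cs) j) ≡ d ∷ D)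
  pack-∷ cs eq with rounds-cases (loads cs) N
  pack-∷ cs eq | inj₁ (eq′ , _) with trans (sym eq) (cong proj₁ eq′)
  ... | ()
  pack-∷ cs eq | inj₂ (j , d , D , j<N , quiet , viol , eq′) =
    j , j<N , quiet , trans viol (sym (trans (sym eq) (cong proj₁ eq′)))

  count : Loads → ℕ → Fin m → ℕ
  count w zero    e = 0
  count w (suc i) e = (if member? e (bases w i) then 1 else 0) + count w i e

  count≤ : ∀ w i e → count w i e ≤ i
  count≤ w zero    e = z≤n
  count≤ w (suc i) e with member? e (bases w i)
  ... | true  = s≤s (count≤ w i e)
  ... | false = m≤n⇒m≤1+n (count≤ w i e)

  -- The load of an element of level l after i rounds, n of whose bases
  -- contain it.
  data State (i l n : ℕ) : Load → Set where
    unused    : l ≡ 0 → n ≡ 0 → State i l n (load 0 V 0)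
    saturated : M ≤ capacity l → State i l n (load (capacity l) 0 0)
    active    : ∀ {key c} j → 1 ≤ baseKey m l → baseKey m l ≤ m → capacity l * 2 ^ baseKey m l ≡ 2 ^ m → capacity l < M → c < capacity l →
                j ≤ i → n ≡ j * capacity l + c → key ≡ baseKey m l + j → State i l n (load (capacity l) key c)

  -- In the active case 2 ^ i < 2m ≤ 2 ^ m, hence i < m. So active keys start at 1 or more, and key
  -- 0 is left to the saturated elements.
  initial : ∀ l → State 0 l 0 (load (capacity l) (if pos (capacity l) then (if pos (M ∸ capacity l) then baseKey m l else 0) else V) 0)
  initial zero = unused refl refl
  initial (suc i) rewrite pos⁺ {2 ^ i} {0} (m^n>0 2 i) with pos (M ∸ 2 ^ i) in eq
  ... | false = saturated (pos-false⁻ eq)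
  ... | true  = active 0 (m<n⇒0<n∸m i<m) (m∸n≤m m i) scale (pos⁻ eq) (m^n>0 2 i) z≤n refl (sym (+-identityʳ (m ∸ i)))
    where
    i<m : i < m
    i<m = 2^-cancel-< (<-≤-trans (pos⁻ eq) (2n≤2^n m 1≤m))
    scale : 2 ^ i * 2 ^ (m ∸ i) ≡ 2 ^ m
    scale = trans (sym (^-distribˡ-+-* 2 i (m ∸ i))) (cong (2 ^_) (m+[n∸m]≡n (<⇒≤ i<m)))

  module _ (cs : Curs) where

    private
      w₀ : Loads
      w₀ = loads cs
      level : Fin m → ℕ
      level e = Cur.lev (cs e)
      w : ℕ → Loads
      w = seq w₀
      B : ℕ → List (Fin m)
      B = bases w₀

    States : ℕ → Set
    States i = ∀ e → State i (level e) (count w₀ i e) (w i e)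

    state-key≤ : ∀ {i l n r} → i ≤ N → State i l n r → Load.key r ≤ V
    state-key≤ i≤N (unused _ _)  = ≤-refl
    state-key≤ i≤N (saturated _) = z≤n
    state-key≤ i≤N (active j _ h≤m _ _ _ j≤i _ refl) = ≤-trans (+-mono-≤ h≤m (≤-trans j≤i i≤N)) m+N≤V

    private
      -- Above the last threshold below V there are only unused elements, so
      -- their demand is 0.
      unused-∉ : ∀ {i} → i < N → States i → violated (w i) (B i) ≡ [] →
                 ∀ e → Load.k (w i e) ≡ 0 → Load.key (w i e) ≡ V → member? e (B i) ≡ false
      unused-∉ {i} i<N states quiet e k≡0 key≡V with member? e (B i) in eq
      ... | false = refl
      ... | true  = contradiction M≤0 (<⇒≱ M>0)
        where
        open ≤-Reasoning
        v : ℕ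
        v = pred V
        1+v≡V : suc v ≡ V
        1+v≡V = suc-pred V {{>-nonZero (<-≤-trans M>0 (m≤m+n M N))}}
        low : ∀ {l n r} → State i l n r → (if pos (Load.key r ∸ v) then Load.k r else 0) ≡ 0
        low (unused _ _) with pos (V ∸ v)
        ... | true  = refl
        ... | false = refl
        low (saturated _) rewrite pos-false⁺ {0} {v} z≤n = refl
        low {l} (active j _ h≤m _ _ _ j≤i _ refl)
          rewrite pos-false⁺ {baseKey m l + j} {v}
                    (s≤s⁻¹ (≤-trans (s≤s (+-mono-≤ h≤m j≤i)) (≤-trans (≤-reflexive (sym (+-suc m i)))
                      (≤-trans (+-monoʳ-≤ m i<N) (≤-trans m+N≤V (≤-reflexive (sym 1+v≡V))))))) = refl
        demand≡0 : demand (w i) v ≤ 0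
        demand≡0 = ≤-trans (≤-reflexive (demand-sum (w i) v))
          (≤-trans (sumᴺ-bound {b = 0} (λ e → ≤-reflexive (low (states e)))) (≤-reflexive (*-zeroʳ m)))
        M≤0 : M ≤ 0
        M≤0 = begin
          M                                           ≡⟨ sym term ⟩
          (if above? (w i) v e then (if member? e (B i) then M else 0) else 0)
                                                      ≤⟨ ≤-sumᴺ (λ e → if above? (w i) v e then (if member? e (B i) then M else 0) else 0) e ⟩
          sumᴺ (λ e → if above? (w i) v e then (if member? e (B i) then M else 0) else 0)
                                                      ≡⟨ sym (supply-sum (w i) (B i) v) ⟩
          supply (w i) (B i) v                        ≤⟨ violated-[] (w i) (B i) quiet (≤-trans (n≤1+n v) (≤-reflexive 1+v≡V)) ⟩
          demand (w i) v                              ≤⟨ demand≡0 ⟩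
          0                                           ∎
          where
          term : (if above? (w i) v e then (if member? e (B i) then M else 0) else 0) ≡ M
          term rewrite key≡V | pos⁺ {V} {v} (≤-reflexive 1+v≡V) | eq = refl

      potential : Load → ℕ
      potential r = price (Load.key r) * (Load.k r + Load.c r)

      updated : Bool → Load → Load
      updated b r = if b then (if pos (Load.key r) then bump r else r) else r

      -- Each use adds exactly the price to the potential, even when it completes a doubling: if c +
      -- 1 = k, then 2 ^ (key + 1) * k equals 2 ^ key * (k + (c + 1)).
      state-step : ∀ {i l n r} b → (Load.k r ≡ 0 → Load.key r ≡ V → b ≡ false) → State i l n r →
        State (suc i) l ((if b then 1 else 0) + n) (updated b r)
        × potential (updated b r) ≡ (if b then price (Load.key r) else 0) + potential r
      state-step true fresh (unused _ _) with fresh refl refl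
      ... | ()
      state-step false fresh (unused l≡ n≡)  = unused l≡ n≡ , refl
      state-step false fresh (saturated M≤) = saturated M≤ , refl
      state-step true  fresh (saturated M≤) = saturated M≤ , refl
      state-step false fresh (active j 1≤h h≤m scale k<M c<k j≤i n≡ key≡) =
        active j 1≤h h≤m scale k<M c<k (m≤n⇒m≤1+n j≤i) n≡ key≡ , refl
      state-step {i} {l} {n} true fresh (active {zero}  {c} j 1≤h _ _ _ _ _ _ key≡) =
        contradiction (≤-trans 1≤h (≤-trans (m≤m+n (baseKey m l) j) (≤-reflexive (sym key≡)))) λ ()
      state-step {i} {l} {n} true fresh (active {suc κ} {c} j 1≤h h≤m scale k<M c<k j≤i n≡ key≡)
        with pos (capacity l ∸ suc c) in eq
      ... | true = active j 1≤h h≤m scale k<M (pos⁻ eq) (m≤n⇒m≤1+n j≤i)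
                     (trans (cong suc n≡) (sym (+-suc (j * capacity l) c))) key≡
                 , trans (cong (2 ^ suc κ *_) (+-suc (capacity l) c)) (*-suc (2 ^ suc κ) (capacity l + c))
      ... | false = active (suc j) 1≤h h≤m scale k<M (≤-trans (s≤s z≤n) c<k) (s≤s j≤i) n≡′
                      (trans (cong suc key≡) (sym (+-suc (baseKey m l) j)))
                  , trans (double (2 ^ suc κ) (capacity l))
                      (trans (cong (λ h → 2 ^ suc κ * (capacity l + h)) (sym 1+c≡k))
                        (trans (cong (2 ^ suc κ *_) (+-suc (capacity l) c)) (*-suc (2 ^ suc κ) (capacity l + c))))
        where
        1+c≡k : suc c ≡ capacity l
        1+c≡k = ≤-antisym c<k (pos-false⁻ eq)
        n≡′ : suc n ≡ suc j * capacity l + 0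
        n≡′ = trans (cong suc n≡) (trans (sym (+-suc (j * capacity l) c))
          (trans (cong (j * capacity l +_) 1+c≡k) (trans (+-comm (j * capacity l) (capacity l)) (sym (+-identityʳ _)))))
        double : ∀ p k → 2 * p * (k + 0) ≡ p * (k + k)
        double = solve-∀

    states : ∀ {i} → i ≤ N → Quiet w₀ i → States i
    states-∉ : ∀ {i} → i < N → Quiet w₀ (suc i) → ∀ e →
               Load.k (w i e) ≡ 0 → Load.key (w i e) ≡ V → member? e (B i) ≡ false
    states-∉ {i} i<N quiet =
      unused-∉ i<N (states (<⇒≤ i<N) (λ j j<i → quiet j (m≤n⇒m≤1+n j<i))) (quiet i ≤-refl)
    states {zero}  _   _     e = initial (level e)
    states {suc i} i<N quiet e = proj₁ (state-step (member? e (B i)) (states-∉ i<N quiet e)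
      (states (<⇒≤ i<N) (λ j j<i → quiet j (m≤n⇒m≤1+n j<i)) e))

    private
      Ψ : ℕ → ℕ
      Ψ i = sumᴺ (λ e → potential (w i e))

    module _ (quiet : Quiet w₀ N) where

      private
        quiet≤ : ∀ {i} → i ≤ N → Quiet w₀ i
        quiet≤ i≤N j j<i = quiet j (<-≤-trans j<i i≤N)

        -- By Abel summation, M times the price of the chosen basis is at most the sum of price
        -- times capacity, which the potential dominates.
        grow : ∀ i → i < N → M * Ψ (suc i) ≤ M * Ψ i + Ψ i
        grow i i<N = begin
          M * Ψ (suc i)
            ≡⟨ cong (M *_) (trans (∑ᴺ.sum-cong-≗ (λ e → proj₂ (state-step (member? e (B i)) (states-∉ i<N (quiet≤ i<N) e) (st e))))
                 (∑ᴺ.∑-distrib-+ (λ e → if member? e (B i) then price (key e) else 0) (λ e → potential (w i e)))) ⟩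
          M * (sumᴺ (λ e → if member? e (B i) then price (key e) else 0) + Ψ i)
            ≡⟨ trans (*-distribˡ-+ M (sumᴺ (λ e → if member? e (B i) then price (key e) else 0)) (Ψ i)) (+-comm (M * sumᴺ (λ e → if member? e (B i) then price (key e) else 0)) (M * Ψ i)) ⟩
          M * Ψ i + M * sumᴺ (λ e → if member? e (B i) then price (key e) else 0)
            ≤⟨ +-monoʳ-≤ (M * Ψ i) charge ⟩
          M * Ψ i + Ψ i ∎
          where
          open ≤-Reasoning
          st : States i
          st = states (<⇒≤ i<N) (quiet≤ (<⇒≤ i<N))
          key : Fin m → ℕ
          key e = Load.key (w i e)
          key≤V : ∀ e → key e ≤ V
          key≤V e = state-key≤ (<⇒≤ i<N) (st e)
          commute : ∀ b p → M * (if b then p else 0) ≡ p * (if b then M else 0)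
          commute true  p = *-comm M p
          commute false p = trans (*-zeroʳ M) (sym (*-zeroʳ p))
          charge : M * sumᴺ (λ e → if member? e (B i) then price (key e) else 0) ≤ Ψ i
          charge = begin
            M * sumᴺ (λ e → if member? e (B i) then price (key e) else 0)
              ≡⟨ ∑ᴺ.*-distribˡ-sum M (λ e → if member? e (B i) then price (key e) else 0) ⟩
            sumᴺ (λ e → M * (if member? e (B i) then price (key e) else 0))
              ≡⟨ ∑ᴺ.sum-cong-≗ (λ e → trans (commute (member? e (B i)) (price (key e)))
                   (cong (_* (if member? e (B i) then M else 0)) (sym (priceBelow-≥ V (key e) (key≤V e))))) ⟩
            sumᴺ (λ e → priceBelow V (key e) * (if member? e (B i) then M else 0))
              ≤⟨ priced-supply (w i) (B i) V (λ v<V → violated-[] (w i) (B i) (quiet i i<N) (<⇒≤ v<V)) ⟩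
            sumᴺ (λ e → priceBelow V (key e) * Load.k (w i e))
              ≤⟨ sumᴺ-mono (λ e → *-mono-≤ (≤-reflexive (priceBelow-≥ V (key e) (key≤V e))) (m≤m+n _ _)) ⟩
            Ψ i ∎

        initial-potential : ∀ {l r} → State 0 l 0 r → potential r ≤ 2 ^ m
        initial-potential (unused _ _)  = ≤-trans (≤-reflexive (*-zeroʳ (price V))) z≤n
        initial-potential (saturated _) = z≤n
        initial-potential {l} (active zero 1≤h _ scale _ _ _ refl refl) = ≤-reflexive (exact (baseKey m l) 1≤h scale)
          where
          exact : ∀ h → 1 ≤ h → capacity l * 2 ^ h ≡ 2 ^ m → price (h + 0) * (capacity l + 0) ≡ 2 ^ m
          exact h@(suc _) _ scale = trans (cong₂ _*_ (cong price (+-identityʳ h)) (+-identityʳ (capacity l)))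
            (trans (*-comm (2 ^ h) (capacity l)) scale)

        -- The m * m rounds form m blocks of m. Each block at most doubles the potential, which
        -- starts at no more than 2 ^ m per element.
        final-potential : Ψ N ≤ 2 ^ m * (m * 2 ^ m)
        final-potential = ≤-trans (doubling m N Ψ grow 1≤m m ≤-refl)
          (*-monoʳ-≤ (2 ^ m) (sumᴺ-bound (λ e → initial-potential (initial (level e)))))

        -- After j doublings the element alone contributes at least 2 ^ j * 2 ^ m to a potential of
        -- at most 2 ^ m * (m * 2 ^ m). So 2 ^ j ≤ 2 ^ m * m < 2 ^ (2m), and the number j * k + c of
        -- uses is less than (j + 1) * k ≤ 2m * k.
        state-count : ∀ {l n r} → State N l n r → capacity l < M → potential r ≤ 2 ^ m * (m * 2 ^ m) → n ≤ (m + m) * capacity l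
        state-count (unused _ refl) _ _ = z≤n
        state-count (saturated M≤k) k<M _ = contradiction M≤k (<⇒≱ k<M)
        state-count {l} (active {c = c} j 1≤h _ scale _ c<k _ refl refl) _ pot≤ = begin
          j * capacity l + c        ≤⟨ +-monoʳ-≤ (j * capacity l) (<⇒≤ c<k) ⟩
          j * capacity l + capacity l     ≡⟨ +-comm (j * capacity l) (capacity l) ⟩
          suc j * capacity l        ≤⟨ *-monoˡ-≤ (capacity l) j<2m ⟩
          (m + m) * capacity l      ∎
          where
          open ≤-Reasoning
          h = baseKey m l
          price≡ : ∀ n → 1 ≤ n → price n ≡ 2 ^ n
          price≡ (suc _) _ = refl
          reorder : ∀ a b k c → a * b * (k + c) ≡ b * (k * a) + a * b * c
          reorder = solve-∀
          scaled : 2 ^ j * 2 ^ m ≤ (2 ^ m * m) * 2 ^ m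
          scaled = begin
            2 ^ j * 2 ^ m                               ≡⟨ cong (2 ^ j *_) (sym scale) ⟩
            2 ^ j * (capacity l * 2 ^ h)                      ≤⟨ m≤m+n _ _ ⟩
            2 ^ j * (capacity l * 2 ^ h) + 2 ^ h * 2 ^ j * c  ≡⟨ sym (reorder (2 ^ h) (2 ^ j) (capacity l) c) ⟩
            2 ^ h * 2 ^ j * (capacity l + c)                  ≡⟨ cong (_* (capacity l + c)) (trans (sym (^-distribˡ-+-* 2 h j)) (sym (price≡ (h + j) (≤-trans 1≤h (m≤m+n h j))))) ⟩
            price (h + j) * (capacity l + c)                  ≤⟨ pot≤ ⟩
            2 ^ m * (m * 2 ^ m)                         ≡⟨ sym (*-assoc (2 ^ m) m (2 ^ m)) ⟩
            (2 ^ m * m) * 2 ^ m                         ∎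
          j<2m : j < m + m
          j<2m = 2^-cancel-< (begin-strict
            2 ^ j           ≤⟨ *-cancelʳ-≤ (2 ^ j) (2 ^ m * m) (2 ^ m) {{m^n≢0 2 m}} scaled ⟩
            2 ^ m * m       <⟨ *-monoʳ-< (2 ^ m) {{m^n≢0 2 m}} (n<2^n m) ⟩
            2 ^ m * 2 ^ m   ≡⟨ sym (^-distribˡ-+-* 2 m m) ⟩
            2 ^ (m + m)     ∎)

      count-bound : ∀ e → capacity (level e) < M → count w₀ N e ≤ (m + m) * capacity (level e)
      count-bound e k<M = state-count (states ≤-refl quiet e) k<M
        (≤-trans (≤-sumᴺ (λ e → potential (w N e)) e) final-potential)

    module _ {i v : ℕ} (i<N : i < N) (quiet : Quiet w₀ i) where

      above-unsaturated : ∀ {e} → above? (w i) v e ≡ true → capacity (level e) < M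
      above-unsaturated {e} high = go (states (<⇒≤ i<N) quiet e) (pos⁻ high)
        where
        go : ∀ {l n r} → State i l n r → v < Load.key r → capacity l < M
        go (unused refl _) _  = M>0
        go (saturated _)   ()
        go (active j _ _ _ k<M _ _ _ _) _ = k<M

      load-k : ∀ e → Load.k (w i e) ≡ capacity (level e)
      load-k e = go (states (<⇒≤ i<N) quiet e)
        where
        go : ∀ {l n r} → State i l n r → Load.k r ≡ capacity l
        go (unused refl _) = refl
        go (saturated _)   = refl
        go (active j _ _ _ _ _ _ _ _) = refl

-- Rational arithmetic and integrality

ℚ-ring : AlmostCommutativeRing _ _
ℚ-ring = fromCommutativeRing ℚ.+-*-commutativeRing (λ q → dec⇒maybe (0ℚ ℚ.≟ q))

int : ℤ → ℚ
int z = z ℚ./ 1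

private
  mk : ℤ → ℚ
  mk z = ℚ.mkℚ z 0 (Coprime.sym (Coprime.1-coprimeTo ℤ.∣ z ∣))

  int≡mk : ∀ z → int z ≡ mk z
  int≡mk z = ℚ.↥p/↧p≡p (mk z)

int-+ : ∀ y z → int (y ℤ.+ z) ≡ int y ℚ.+ int z
int-+ y z rewrite int≡mk y | int≡mk z = cong int (sym (cong₂ ℤ._+_ (ℤ.*-identityʳ y) (ℤ.*-identityʳ z)))

int-* : ∀ y z → int (y ℤ.* z) ≡ int y ℚ.* int z
int-* y z rewrite int≡mk y | int≡mk z = refl

int-neg : ∀ z → int (ℤ.- z) ≡ ℚ.- int z
int-neg z rewrite int≡mk z | int≡mk (ℤ.- z) with z
... | ℤ.+ zero     = refl
... | ℤ.+ suc n    = refl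
... | ℤ.-[1+ n ]   = refl

int-≤ : ∀ {y z} → y ℤ.≤ z → int y ℚ.≤ int z
int-≤ {y} {z} y≤z rewrite int≡mk y | int≡mk z = ℚ.*≤* (subst₂ ℤ._≤_ (sym (ℤ.*-identityʳ y)) (sym (ℤ.*-identityʳ z)) y≤z)

int-≤⁻ : ∀ {y z} → int y ℚ.≤ int z → y ℤ.≤ z
int-≤⁻ {y} {z} le rewrite int≡mk y | int≡mk z with le
... | ℚ.*≤* y≤z = subst₂ ℤ._≤_ (ℤ.*-identityʳ y) (ℤ.*-identityʳ z) y≤z

fromℕ-+ : ∀ a b → fromℕ (a + b) ≡ fromℕ a ℚ.+ fromℕ b
fromℕ-+ a b = trans (cong int (ℤ.pos-+ a b)) (int-+ (ℤ.+ a) (ℤ.+ b))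

fromℕ-* : ∀ a b → fromℕ (a * b) ≡ fromℕ a ℚ.* fromℕ b
fromℕ-* a b = trans (cong int (ℤ.pos-* a b)) (int-* (ℤ.+ a) (ℤ.+ b))

fromℕ-suc : ∀ a → fromℕ (suc a) ≡ 1ℚ ℚ.+ fromℕ a
fromℕ-suc a = fromℕ-+ 1 a

fromℕ-≤ : ∀ {a b} → a ≤ b → fromℕ a ℚ.≤ fromℕ b
fromℕ-≤ a≤b = int-≤ (ℤ.+≤+ a≤b)

0≤fromℕ : ∀ n → 0ℚ ℚ.≤ fromℕ n
0≤fromℕ n = fromℕ-≤ {0} {n} z≤n

*-monoˡ : ∀ {p q r} → 0ℚ ℚ.≤ r → p ℚ.≤ q → r ℚ.* p ℚ.≤ r ℚ.* q
*-monoˡ {r = r} 0≤r p≤q = ℚ.*-monoˡ-≤-nonNeg r {{ℚ.nonNegative 0≤r}} p≤q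

*-nonneg : ∀ {p q} → 0ℚ ℚ.≤ p → 0ℚ ℚ.≤ q → 0ℚ ℚ.≤ p ℚ.* q
*-nonneg {p} 0≤p 0≤q = ℚ.≤-trans (ℚ.≤-reflexive (sym (ℚ.*-zeroʳ p))) (*-monoˡ 0≤p 0≤q)

p≤q⇒0≤q-p : ∀ {p q} → p ℚ.≤ q → 0ℚ ℚ.≤ q ℚ.- p
p≤q⇒0≤q-p {p} p≤q = ℚ.≤-trans (ℚ.≤-reflexive (sym (ℚ.+-inverseʳ p))) (ℚ.+-monoˡ-≤ (ℚ.- p) p≤q)

0≤q-p⇒p≤q : ∀ {p q} → 0ℚ ℚ.≤ q ℚ.- p → p ℚ.≤ q
0≤q-p⇒p≤q {p} {q} 0≤ = subst₂ ℚ._≤_ (ℚ.+-identityˡ p) (cancel q p) (ℚ.+-monoˡ-≤ p 0≤)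
  where
  cancel : ∀ q p → (q ℚ.- p) ℚ.+ p ≡ q
  cancel q p = trans (ℚ.+-assoc q (ℚ.- p) p) (trans (cong (q ℚ.+_) (ℚ.+-inverseˡ p)) (ℚ.+-identityʳ q))

∑-mono : ∀ {n} {f g : Fin n → ℚ} → (∀ i → f i ℚ.≤ g i) → ∑ f ℚ.≤ ∑ g
∑-mono {zero}  f≤g = ℚ.≤-refl
∑-mono {suc n} f≤g = ℚ.+-mono-≤ (f≤g zero) (∑-mono (f≤g ∘ suc))

∑-cong : ∀ {n} {f g : Fin n → ℚ} → (∀ i → f i ≡ g i) → ∑ f ≡ ∑ g
∑-cong = ∑ℚ.sum-cong-≗

∑-+ : ∀ {n} (f g : Fin n → ℚ) → ∑ (λ i → f i ℚ.+ g i) ≡ ∑ f ℚ.+ ∑ g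
∑-+ = ∑ℚ.∑-distrib-+

∑-* : ∀ {n} x (f : Fin n → ℚ) → ∑ (λ i → x ℚ.* f i) ≡ x ℚ.* ∑ f
∑-* x f = sym (∑ℚ.*-distribˡ-sum x f)

∑-zero : ∀ n → ∑ {n} (λ _ → 0ℚ) ≡ 0ℚ
∑-zero = ∑ℚ.sum-replicate-zero

∑-comm : ∀ {m n} (f : Fin m → Fin n → ℚ) → ∑ (λ i → ∑ (f i)) ≡ ∑ (λ j → ∑ (λ i → f i j))
∑-comm = ∑ℚ.∑-comm

∑-neg : ∀ {n} (f : Fin n → ℚ) → ∑ (λ i → ℚ.- f i) ≡ ℚ.- ∑ f
∑-neg {zero}  f = refl
∑-neg {suc n} f = trans (cong (ℚ.- f zero ℚ.+_) (∑-neg (f ∘ suc))) (sym (ℚ.neg-distrib-+ (f zero) _))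

∑-nonneg : ∀ {n} {f : Fin n → ℚ} → (∀ i → 0ℚ ℚ.≤ f i) → 0ℚ ℚ.≤ ∑ f
∑-nonneg {n} 0≤f = ℚ.≤-trans (ℚ.≤-reflexive (sym (∑-zero n))) (∑-mono 0≤f)

fromℕ-sum : ∀ {n} (f : Fin n → ℕ) → fromℕ (sumᴺ f) ≡ ∑ (λ i → fromℕ (f i))
fromℕ-sum {zero}  f = refl
fromℕ-sum {suc n} f = trans (fromℕ-+ (f zero) _) (cong (fromℕ (f zero) ℚ.+_) (fromℕ-sum (f ∘ suc)))

-- Residual costs are differences of costs, so they stay integral over any
-- common denominator D of the costs.
Integral : ℕ → ℚ → Set
Integral D q = ∃[ z ] (q ℚ.* fromℕ D ≡ int z)

integral-- : ∀ {D p q} → Integral D p → Integral D q → Integral D (p ℚ.+ ℚ.- q)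
integral-- {D} {p} {q} (y , p≡) (z , q≡) = y ℤ.+ ℤ.- z , (begin
  (p ℚ.+ ℚ.- q) ℚ.* fromℕ D                     ≡⟨ ℚ.*-distribʳ-+ (fromℕ D) p (ℚ.- q) ⟩
  p ℚ.* fromℕ D ℚ.+ ℚ.- q ℚ.* fromℕ D           ≡⟨ cong (p ℚ.* fromℕ D ℚ.+_) (sym (ℚ.neg-distribˡ-* q (fromℕ D))) ⟩
  p ℚ.* fromℕ D ℚ.+ ℚ.- (q ℚ.* fromℕ D)         ≡⟨ cong₂ (λ a b → a ℚ.+ ℚ.- b) p≡ q≡ ⟩
  int y ℚ.+ ℚ.- int z                           ≡⟨ cong (int y ℚ.+_) (sym (int-neg z)) ⟩
  int y ℚ.+ int (ℤ.- z)                         ≡⟨ sym (int-+ y (ℤ.- z)) ⟩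
  int (y ℤ.+ ℤ.- z)                             ∎)
  where open ≡-Reasoning

integral-scale : ∀ {D q} k → Integral D q → Integral (k * D) q
integral-scale {D} {q} k (z , q≡) = ℤ.+ k ℤ.* z , (begin
  q ℚ.* fromℕ (k * D)             ≡⟨ cong (q ℚ.*_) (fromℕ-* k D) ⟩
  q ℚ.* (fromℕ k ℚ.* fromℕ D)     ≡⟨ sym (ℚ.*-assoc q (fromℕ k) (fromℕ D)) ⟩
  (q ℚ.* fromℕ k) ℚ.* fromℕ D     ≡⟨ cong (ℚ._* fromℕ D) (ℚ.*-comm q (fromℕ k)) ⟩
  (fromℕ k ℚ.* q) ℚ.* fromℕ D     ≡⟨ ℚ.*-assoc (fromℕ k) q (fromℕ D) ⟩
  fromℕ k ℚ.* (q ℚ.* fromℕ D)     ≡⟨ cong (fromℕ k ℚ.*_) q≡ ⟩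
  fromℕ k ℚ.* int z               ≡⟨ sym (int-* (ℤ.+ k) z) ⟩
  int (ℤ.+ k ℤ.* z)               ∎)
  where open ≡-Reasoning

-- Dual load, interpolated primal cost and levels

increment : ℕ → ℕ
increment zero    = 1
increment (suc i) = 2 ^ i

capacity-suc : ∀ l → capacity (suc l) ≡ capacity l + increment l
capacity-suc zero    = refl
capacity-suc (suc i) = cong (2 ^ i +_) (+-identityʳ (2 ^ i))

increment≤ : ∀ l → increment l ≤ capacity l + 1
increment≤ zero    = ≤-refl
increment≤ (suc i) = m≤m+n _ 1

-- dualLoad is the sum of the dual variables that a copy has paid for, and Φ
-- interpolates a * capacity l linearly between levels.
dualLoad Φ : Cur → ℚ
dualLoad (cur a ρ l) = a ℚ.* fromℕ l ℚ.+ (a ℚ.- ρ)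
Φ        (cur a ρ l) = a ℚ.* fromℕ (capacity l) ℚ.+ (a ℚ.- ρ) ℚ.* fromℕ (increment l)

-- Used with μ = 2M and with ξ the value of a feasible solution at the copy. Nonnegativity of its
-- sum over all copies bounds the primal cost by the weighted dual load.
gap : ℚ → ℚ → Cur → ℚ
gap μ ξ c = μ ℚ.* dualLoad c ℚ.* ξ ℚ.- Φ c

gap-lower : ∀ μ ξ δ a ρ l →
  gap μ ξ (cur a (ρ ℚ.+ ℚ.- δ) l) ≡ gap μ ξ (cur a ρ l) ℚ.+ δ ℚ.* (μ ℚ.* ξ ℚ.- fromℕ (increment l))
gap-lower μ ξ δ a ρ l = identity μ ξ δ a ρ (fromℕ l) (fromℕ (capacity l)) (fromℕ (increment l))
  where
  identity : ∀ μ ξ δ a ρ l k x →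
    μ ℚ.* (a ℚ.* l ℚ.+ (a ℚ.+ ℚ.- (ρ ℚ.+ ℚ.- δ))) ℚ.* ξ ℚ.+ ℚ.- (a ℚ.* k ℚ.+ (a ℚ.+ ℚ.- (ρ ℚ.+ ℚ.- δ)) ℚ.* x)
    ≡ (μ ℚ.* (a ℚ.* l ℚ.+ (a ℚ.+ ℚ.- ρ)) ℚ.* ξ ℚ.+ ℚ.- (a ℚ.* k ℚ.+ (a ℚ.+ ℚ.- ρ) ℚ.* x)) ℚ.+ δ ℚ.* (μ ℚ.* ξ ℚ.+ ℚ.- x)
  identity = Ring.solve-∀ ℚ-ring

-- A copy of residual cost 0 has the same `dualLoad` and `Φ` as the recharged copy one level higher.
-- So a recharge at ρ = δ changes `gap` by the same expression as a mere decrease by δ in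
-- `gap-lower`.
gap-raise : ∀ μ ξ a ρ l →
  gap μ ξ (cur a a (suc l)) ≡ gap μ ξ (cur a ρ l) ℚ.+ ρ ℚ.* (μ ℚ.* ξ ℚ.- fromℕ (increment l))
gap-raise μ ξ a ρ l = trans
  (cong₂ (λ L K → μ ℚ.* (a ℚ.* L ℚ.+ (a ℚ.- a)) ℚ.* ξ ℚ.- (a ℚ.* K ℚ.+ (a ℚ.- a) ℚ.* fromℕ (2 ^ l)))
    (fromℕ-suc l) (trans (cong fromℕ (capacity-suc l)) (fromℕ-+ (capacity l) (increment l))))
  (identity μ ξ a ρ (fromℕ l) (fromℕ (capacity l)) (fromℕ (increment l)) (fromℕ (2 ^ l)))
  where
  identity : ∀ μ ξ a ρ l k x y →
    μ ℚ.* (a ℚ.* (1ℚ ℚ.+ l) ℚ.+ (a ℚ.+ ℚ.- a)) ℚ.* ξ ℚ.+ ℚ.- (a ℚ.* (k ℚ.+ x) ℚ.+ (a ℚ.+ ℚ.- a) ℚ.* y)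
    ≡ (μ ℚ.* (a ℚ.* l ℚ.+ (a ℚ.+ ℚ.- ρ)) ℚ.* ξ ℚ.+ ℚ.- (a ℚ.* k ℚ.+ (a ℚ.+ ℚ.- ρ) ℚ.* x)) ℚ.+ ρ ℚ.* (μ ℚ.* ξ ℚ.+ ℚ.- x)
  identity = Ring.solve-∀ ℚ-ring

-- An unsaturated level i + 1 has 2 ^ i < 2m and hence i ≤ log m; one more raise leads to level log
-- m + 2 at most.
Λ : ℕ → ℕ
Λ m = 2 + log m

log≤ : ∀ m → log m ≤ m
log≤ m = ≤-trans (⌈log₂⌉-mono-≤ (n<2^n m)) (≤-reflexive (⌈log₂2^n⌉≡n m))

unsaturated-level : ∀ m l → capacity l < m + m → l < Λ m
unsaturated-level m zero    _  = s≤s z≤n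
unsaturated-level m (suc i) lt = s≤s (2^-cancel-< (begin-strict
  2 ^ i               <⟨ lt ⟩
  m + m               ≤⟨ +-mono-≤ m≤ m≤ ⟩
  2 ^ log m + 2 ^ log m   ≡⟨ cong (2 ^ log m +_) (sym (+-identityʳ (2 ^ log m))) ⟩
  2 ^ suc (log m)     ∎))
  where
  open ≤-Reasoning
  m≤ : m ≤ 2 ^ log m
  m≤ = ≤-trans (n≤1+n m) (n≤2^⌈log₂n⌉ (suc m))

load-bound : ∀ {m} a ρ l → 0ℚ ℚ.≤ a → 0ℚ ℚ.≤ ρ → l < Λ m → a ℚ.* fromℕ l ℚ.+ (a ℚ.- ρ) ℚ.≤ a ℚ.* fromℕ (Λ m)
load-bound {m} a ρ l 0≤a 0≤ρ l<Λ = begin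
  a ℚ.* fromℕ l ℚ.+ (a ℚ.- ρ)     ≤⟨ ℚ.+-monoʳ-≤ (a ℚ.* fromℕ l) (ℚ.+-monoʳ-≤ a (ℚ.neg-antimono-≤ 0≤ρ)) ⟩
  a ℚ.* fromℕ l ℚ.+ (a ℚ.+ 0ℚ)    ≡⟨ factor a (fromℕ l) ⟩
  a ℚ.* (1ℚ ℚ.+ fromℕ l)          ≡⟨ cong (a ℚ.*_) (sym (fromℕ-suc l)) ⟩
  a ℚ.* fromℕ (suc l)             ≤⟨ *-monoˡ 0≤a (fromℕ-≤ l<Λ) ⟩
  a ℚ.* fromℕ (Λ m)               ∎
  where
  open ℚ.≤-Reasoning
  factor : ∀ a l → a ℚ.* l ℚ.+ (a ℚ.+ 0ℚ) ≡ a ℚ.* (1ℚ ℚ.+ l)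
  factor = Ring.solve-∀ ℚ-ring

record Good (m D : ℕ) (c : Cur) : Set where
  open Cur c
  field
    0≤ρ     : 0ℚ ℚ.≤ ρ
    ρ≤a     : ρ ℚ.≤ a
    load≤   : dualLoad c ℚ.≤ a ℚ.* fromℕ (Λ m)
    lev≤    : lev ≤ Λ m
    capacity≤     : capacity lev ≤ 1 + (m + m + (m + m))
    a-int   : Integral D a
    ρ-int   : Integral D ρ

-- Improvement steps

module Improvement (m : ℕ) (mq : ℚ) (indep : Subset m → Bool) (1≤m : 1 ≤ m) where
  open Outer m mq indep
  open Greedy m indep M V
  open PackingAnalysis m mq indep 1≤m

  hits : Loads → ℕ → Fin m → ℕ
  hits w v e = if above? w v e then (if member? e (basis w) then 1 else 0) else 0

  -- The consequence of feasibility that the analysis uses: at least r minus the rank of {key ≤ v}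
  -- of the mass of ξ lies on {key > v}, for any loads, expressed as a number of basis elements.
  Covers : (Fin m → ℚ) → Set
  Covers ξ = ∀ w v → v ≤ V → fromℕ (sumᴺ (hits w v)) ℚ.≤ ∑ (λ e → if above? w v e then ξ e else 0ℚ)

  data Lowered (δ : ℚ) (c : Cur) : Cur → Set where
    partly : 0ℚ ℚ.≤ Cur.ρ c ℚ.+ ℚ.- δ → Lowered δ c (cur (Cur.a c) (Cur.ρ c ℚ.+ ℚ.- δ) (Cur.lev c))
    raised : Cur.ρ c ≡ δ → Lowered δ c (cur (Cur.a c) (Cur.a c) (suc (Cur.lev c)))

  lower-cases : ∀ δ c → δ ℚ.≤ Cur.ρ c → Lowered δ c (lower δ c)
  lower-cases δ (cur a ρ l) δ≤ρ with ≤?-cases (ρ ℚ.+ ℚ.- δ) 0ℚ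
  ... | inj₁ (eq , ≤0) rewrite eq = raised (ℚ.≤-antisym (0≤q-p⇒p≤q (subst (0ℚ ℚ.≤_) (flip ρ δ) (p≤q⇒0≤q-p ≤0))) δ≤ρ)
    where
    flip : ∀ ρ δ → 0ℚ ℚ.+ ℚ.- (ρ ℚ.+ ℚ.- δ) ≡ δ ℚ.+ ℚ.- ρ
    flip = Ring.solve-∀ ℚ-ring
  ... | inj₂ (eq , 0≤) rewrite eq = partly 0≤

  -- What later arguments use of a step: the violated set as {key > v} for the loads w of the round
  -- that found it, and an element `e₀` of it whose residual cost is the decrease δ.
  record Improved (cs cs′ : Curs) : Set where
    field
      w      : Loads
      v      : ℕ
      v≤V    : v ≤ V
      δ      : ℚ
      short  : demand w v < supply w (basis w) v
      k≡     : ∀ e → Load.k (w e) ≡ capacity (Cur.lev (cs e))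
      unsat  : ∀ {e} → above? w v e ≡ true → capacity (Cur.lev (cs e)) < M
      δ≤     : ∀ {e} → above? w v e ≡ true → δ ℚ.≤ Cur.ρ (cs e)
      e₀     : Fin m
      e₀-above : above? w v e₀ ≡ true
      ρe₀    : Cur.ρ (cs e₀) ≡ δ
      new≡   : ∀ e → cs′ e ≡ (if above? w v e then lower δ (cs e) else cs e)

  step-done : ∀ cs → proj₁ (pack cs) ≡ [] → step cs ≡ cs
  step-done cs eq with proj₁ (pack cs)
  step-done cs refl | [] = refl

  step-cases : ∀ cs → (proj₁ (pack cs) ≡ [] × step cs ≡ cs) ⊎ Improved cs (step cs)
  step-cases cs with proj₁ (pack cs) in eq
  ... | []    = inj₁ (refl , refl)
  ... | d ∷ D with pack-∷ cs eq
  ...   | j , j<N , quiet , viol with violated-∷ (seq (loads cs) j) (bases (loads cs) j) viol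
  ...     | v , v≤V , short , D≡ with minimum-≤ (d ∷ D) cs (here refl)
  ...       | δ , δ≡ , _ with minimum-attained (d ∷ D) cs δ≡
  ...         | e₀ , e₀∈ , ρe₀ = inj₂ (record
    { w = w′ ; v = v ; v≤V = v≤V ; δ = δ ; short = short
    ; k≡ = load-k cs {v = v} j<N quiet
    ; unsat = λ {e} → above-unsaturated cs {v = v} j<N quiet {e}
    ; δ≤ = δ≤
    ; e₀ = e₀
    ; e₀-above = above⁻ w′ {v} (subst (e₀ ∈_) D≡ e₀∈)
    ; ρe₀ = ρe₀
    ; new≡ = new≡
    })
    where
    w′ : Loads
    w′ = seq (loads cs) j
    δ≤ : ∀ {e} → above? w′ v e ≡ true → δ ℚ.≤ Cur.ρ (cs e)
    δ≤ {e} high with minimum-≤ (d ∷ D) cs (subst (e ∈_) (sym D≡) (above⁺ w′ {v} high))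
    ... | δ′ , δ′≡ , δ′≤ with trans (sym δ≡) δ′≡
    ...   | refl = δ′≤
    new≡ : ∀ e → lowerAll (d ∷ D) (fromMaybe 0ℚ (minimum (d ∷ D) cs)) cs e ≡ (if above? w′ v e then lower δ (cs e) else cs e)
    new≡ e rewrite δ≡ with above? w′ v e in high
    ... | true rewrite member?⁺ {e} {d ∷ D} (subst (e ∈_) (sym D≡) (above⁺ w′ {v} high)) = refl
    ... | false with member? e (d ∷ D) in mem
    ...   | false = refl
    ...   | true with trans (sym (above⁻ w′ {v} (subst (e ∈_) D≡ (member?⁻ mem)))) high
    ...     | ()

  module _ {cs cs′ : Curs} (imp : Improved cs cs′) where
    open Improved imp

    private
      hi : Fin m → Bool
      hi = above? w v

    improved-a : ∀ e → Cur.a (cs′ e) ≡ Cur.a (cs e)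
    improved-a e rewrite new≡ e with hi e in high
    ... | false = refl
    ... | true with lower δ (cs e) | lower-cases δ (cs e) (δ≤ high)
    ...   | _ | partly _ = refl
    ...   | _ | raised _ = refl

    improved-lev : ∀ e → Cur.lev (cs e) ≤ Cur.lev (cs′ e)
    improved-lev e rewrite new≡ e with hi e in high
    ... | false = ≤-refl
    ... | true with lower δ (cs e) | lower-cases δ (cs e) (δ≤ high)
    ...   | _ | partly _ = ≤-refl
    ...   | _ | raised _ = n≤1+n _

    improved-lev-< : Cur.lev (cs e₀) < Cur.lev (cs′ e₀)
    improved-lev-< rewrite new≡ e₀ | e₀-above = go (cs e₀) ρe₀
      where
      go : ∀ c → Cur.ρ c ≡ δ → Cur.lev c < Cur.lev (lower δ c)
      go (cur a ρ l) refl rewrite ℚ.+-inverseʳ ρ = ≤-refl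

    improved-levs : suc (sumᴺ (λ e → Cur.lev (cs e))) ≤ sumᴺ (λ e → Cur.lev (cs′ e))
    improved-levs = sumᴺ-strict e₀ improved-lev improved-lev-<
      where
      sumᴺ-strict : ∀ {n} {f g : Fin n → ℕ} i → (∀ i → f i ≤ g i) → f i < g i → suc (sumᴺ f) ≤ sumᴺ g
      sumᴺ-strict zero    f≤g lt = +-mono-≤ lt (sumᴺ-mono (f≤g ∘ suc))
      sumᴺ-strict {f = f} (suc i) f≤g lt = ≤-trans (≤-reflexive (sym (+-suc (f zero) _)))
        (+-mono-≤ (f≤g zero) (sumᴺ-strict i (f≤g ∘ suc) lt))

    0≤δ : (∀ e → 0ℚ ℚ.≤ Cur.ρ (cs e)) → 0ℚ ℚ.≤ δ
    0≤δ 0≤ρ = ℚ.≤-trans (0≤ρ e₀) (ℚ.≤-reflexive ρe₀)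

    improved-good : ∀ {D} → (∀ e → Good m D (cs e)) → ∀ e → Good m D (cs′ e)
    improved-good {D} good e = subst (Good m D) (sym (new≡ e)) (go (hi e) refl)
      where
      go : ∀ b → hi e ≡ b → Good m D (if b then lower δ (cs e) else cs e)
      go false _    = good e
      go true  high with lower δ (cs e) | lower-cases δ (cs e) (δ≤ high)
      ... | _ | partly 0≤ρ-δ = record
        { 0≤ρ = 0≤ρ-δ ; ρ≤a = ℚ.≤-trans (ℚ.≤-trans (ℚ.+-monoʳ-≤ (Cur.ρ (cs e)) (ℚ.neg-antimono-≤ (0≤δ (Good.0≤ρ ∘ good)))) (ℚ.≤-reflexive (ℚ.+-identityʳ _))) ρ≤a
        ; load≤ = bound ; lev≤ = lev≤ ; capacity≤ = capacity≤ ; a-int = a-int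
        -- The decrease δ is itself the residual cost of `e₀` and hence integral over D.
        ; ρ-int = integral-- {D} {ρ} {δ} ρ-int (subst (Integral D) ρe₀ (Good.ρ-int (good e₀))) }
        where
        open Good (good e)
        open Cur (cs e)
        bound : a ℚ.* fromℕ lev ℚ.+ (a ℚ.- (ρ ℚ.+ ℚ.- δ)) ℚ.≤ a ℚ.* fromℕ (Λ m)
        bound = load-bound {m} a (ρ ℚ.+ ℚ.- δ) lev (ℚ.≤-trans 0≤ρ ρ≤a) 0≤ρ-δ (unsaturated-level m lev (unsat high))
      ... | _ | raised ρ≡δ = record
        { 0≤ρ = ℚ.≤-trans 0≤ρ ρ≤a ; ρ≤a = ℚ.≤-refl
        ; load≤ = bound ; lev≤ = unsaturated-level m lev (unsat high)
        ; capacity≤ = capacity-bound ; a-int = a-int ; ρ-int = a-int }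
        where
        open Good (good e)
        open Cur (cs e)
        bound : a ℚ.* fromℕ (suc lev) ℚ.+ (a ℚ.- a) ℚ.≤ a ℚ.* fromℕ (Λ m)
        bound = ℚ.≤-trans (ℚ.≤-reflexive (trans (cong (a ℚ.* fromℕ (suc lev) ℚ.+_) (ℚ.+-inverseʳ a)) (ℚ.+-identityʳ _)))
          (*-monoˡ (ℚ.≤-trans 0≤ρ ρ≤a) (fromℕ-≤ (unsaturated-level m lev (unsat high))))
        capacity-bound : capacity (suc lev) ≤ 1 + (m + m + (m + m))
        capacity-bound = begin
          capacity (suc lev)          ≡⟨ capacity-suc lev ⟩
          capacity lev + increment lev       ≤⟨ +-mono-≤ (<⇒≤ (unsat high)) (≤-trans (increment≤ lev) (+-monoˡ-≤ 1 (<⇒≤ (unsat high)))) ⟩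
          M + (M + 1)           ≡⟨ trans (sym (+-assoc M M 1)) (+-comm (M + M) 1) ⟩
          1 + (M + M)           ∎
          where open ≤-Reasoning

    μ : ℚ
    μ = fromℕ (M + M)

    private
      excess : ℚ → (Fin m → ℚ) → Fin m → ℚ
      excess μ ξ e = if hi e then μ ℚ.* ξ e ℚ.- fromℕ (increment (Cur.lev (cs e))) else 0ℚ

      gap-change : ∀ μ ξ e → gap μ (ξ e) (cs′ e) ≡ gap μ (ξ e) (cs e) ℚ.+ δ ℚ.* excess μ ξ e
      gap-change μ ξ e = trans (cong (gap μ (ξ e)) (new≡ e)) (go (hi e) refl)
        where
        c : Cur
        c = cs e
        lowered : ∀ {c′} → Lowered δ c c′ → gap μ (ξ e) c′ ≡ gap μ (ξ e) c ℚ.+ δ ℚ.* (μ ℚ.* ξ e ℚ.- fromℕ (increment (Cur.lev c)))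
        lowered (partly _)   = gap-lower μ (ξ e) δ (Cur.a c) (Cur.ρ c) (Cur.lev c)
        lowered (raised ρ≡δ) = trans (gap-raise μ (ξ e) (Cur.a c) (Cur.ρ c) (Cur.lev c))
          (cong (λ r → gap μ (ξ e) c ℚ.+ r ℚ.* (μ ℚ.* ξ e ℚ.- fromℕ (increment (Cur.lev c)))) ρ≡δ)
        go : ∀ b → hi e ≡ b → gap μ (ξ e) (if b then lower δ c else c)
             ≡ gap μ (ξ e) c ℚ.+ δ ℚ.* (if b then μ ℚ.* ξ e ℚ.- fromℕ (increment (Cur.lev c)) else 0ℚ)
        go false _    = sym (trans (cong (gap μ (ξ e) c ℚ.+_) (ℚ.*-zeroʳ δ)) (ℚ.+-identityʳ _))
        go true  high = lowered (lower-cases δ c (δ≤ high))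

      h : ℕ
      h = sumᴺ (hits w v)

      supply≡ : supply w (basis w) v ≡ M * h
      supply≡ = trans (supply-sum w (basis w) v) (trans (∑ᴺ.sum-cong-≗ pointwise) (sym (∑ᴺ.*-distribˡ-sum M (hits w v))))
        where
        pointwise : ∀ e → (if above? w v e then (if member? e (basis w) then M else 0) else 0) ≡ M * hits w v e
        pointwise e with above? w v e | member? e (basis w)
        ... | true  | true  = sym (*-identityʳ M)
        ... | true  | false = sym (*-zeroʳ M)
        ... | false | _     = sym (*-zeroʳ M)

      -- An increment is at most k + 1. By violation the k sum to less than M * h; the ones sum to
      -- at most m ≤ M * h, because a violated constraint has h ≥ 1. This is the origin of μ = 2M.
      increment-sum≤ : sumᴺ (λ e → if hi e then increment (Cur.lev (cs e)) else 0) ≤ (M + M) * h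
      increment-sum≤ = begin
        sumᴺ (λ e → if hi e then increment (Cur.lev (cs e)) else 0)
          ≤⟨ sumᴺ-mono pointwise ⟩
        sumᴺ (λ e → (if hi e then Load.k (w e) else 0) + 1)
          ≡⟨ ∑ᴺ.∑-distrib-+ (λ e → if hi e then Load.k (w e) else 0) (λ _ → 1) ⟩
        sumᴺ (λ e → if hi e then Load.k (w e) else 0) + sumᴺ {m} (λ _ → 1)
          ≤⟨ +-mono-≤ (≤-trans (≤-reflexive (sym (demand-sum w v))) (≤-trans (<⇒≤ short) (≤-reflexive supply≡)))
                      (sumᴺ-bound {m} {1} {λ _ → 1} (λ _ → ≤-refl)) ⟩
        M * h + m * 1
          ≤⟨ +-monoʳ-≤ (M * h) (≤-trans (≤-reflexive (*-identityʳ m)) (≤-trans (m≤m+n m m) M≤)) ⟩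
        M * h + M * h
          ≡⟨ sym (*-distribʳ-+ h M M) ⟩
        (M + M) * h ∎
        where
        open ≤-Reasoning
        pointwise : ∀ e → (if hi e then increment (Cur.lev (cs e)) else 0) ≤ (if hi e then Load.k (w e) else 0) + 1
        pointwise e with hi e
        ... | true  = ≤-trans (increment≤ (Cur.lev (cs e))) (≤-reflexive (cong (_+ 1) (sym (k≡ e))))
        ... | false = z≤n
        M≤ : M ≤ M * h
        M≤ with h in eq
        ... | suc h′ = m≤m*n M (suc h′)
        ... | zero   = contradiction (≤-trans short (≤-reflexive (trans supply≡ (trans (cong (M *_) eq) (*-zeroʳ M))))) λ ()

    improved-gap : ∀ ξ → Covers ξ → (∀ e → 0ℚ ℚ.≤ Cur.ρ (cs e)) →
                   ∑ (λ e → gap μ (ξ e) (cs e)) ℚ.≤ ∑ (λ e → gap μ (ξ e) (cs′ e))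
    improved-gap ξ covers 0≤ρ = begin
      ∑ (λ e → gap μ (ξ e) (cs e))
        ≡⟨ sym (ℚ.+-identityʳ _) ⟩
      ∑ (λ e → gap μ (ξ e) (cs e)) ℚ.+ 0ℚ
        ≤⟨ ℚ.+-monoʳ-≤ (∑ (λ e → gap μ (ξ e) (cs e))) (*-nonneg (0≤δ 0≤ρ) 0≤excess) ⟩
      ∑ (λ e → gap μ (ξ e) (cs e)) ℚ.+ δ ℚ.* ∑ (excess μ ξ)
        ≡⟨ cong (∑ (λ e → gap μ (ξ e) (cs e)) ℚ.+_) (sym (∑-* δ (excess μ ξ))) ⟩
      ∑ (λ e → gap μ (ξ e) (cs e)) ℚ.+ ∑ (λ e → δ ℚ.* excess μ ξ e)
        ≡⟨ sym (∑-+ (λ e → gap μ (ξ e) (cs e)) (λ e → δ ℚ.* excess μ ξ e)) ⟩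
      ∑ (λ e → gap μ (ξ e) (cs e) ℚ.+ δ ℚ.* excess μ ξ e)
        ≡⟨ ∑-cong (λ e → sym (gap-change μ ξ e)) ⟩
      ∑ (λ e → gap μ (ξ e) (cs′ e)) ∎
      where
      open ℚ.≤-Reasoning
      mxℚ : Fin m → ℚ
      mxℚ e = if hi e then fromℕ (increment (Cur.lev (cs e))) else 0ℚ
      if-linear : ∀ b μ x y → (if b then μ ℚ.* x ℚ.- y else 0ℚ) ≡ μ ℚ.* (if b then x else 0ℚ) ℚ.+ ℚ.- (if b then y else 0ℚ)
      if-linear true  μ x y = refl
      if-linear false μ x y = sym (trans (cong (ℚ._+ ℚ.- 0ℚ) (ℚ.*-zeroʳ μ)) refl)
      0≤excess : 0ℚ ℚ.≤ ∑ (excess μ ξ)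
      0≤excess = begin
        0ℚ
          ≤⟨ p≤q⇒0≤q-p (begin
               ∑ mxℚ                                    ≡⟨ ∑-cong (λ e → sym (if-cong fromℕ (hi e))) ⟩
               ∑ (λ e → fromℕ (if hi e then increment (Cur.lev (cs e)) else 0))
                                                        ≡⟨ sym (fromℕ-sum (λ e → if hi e then increment (Cur.lev (cs e)) else 0)) ⟩
               fromℕ (sumᴺ (λ e → if hi e then increment (Cur.lev (cs e)) else 0))
                                                        ≤⟨ fromℕ-≤ increment-sum≤ ⟩
               fromℕ ((M + M) * h)                      ≡⟨ fromℕ-* (M + M) h ⟩
               μ ℚ.* fromℕ h                            ≤⟨ *-monoˡ (0≤fromℕ (M + M)) (covers w v v≤V) ⟩
               μ ℚ.* ∑ (λ e → if hi e then ξ e else 0ℚ) ∎) ⟩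
        μ ℚ.* ∑ (λ e → if hi e then ξ e else 0ℚ) ℚ.- ∑ mxℚ
          ≡⟨ cong₂ ℚ._+_ (sym (∑-* μ (λ e → if hi e then ξ e else 0ℚ))) (sym (∑-neg mxℚ)) ⟩
        ∑ (λ e → μ ℚ.* (if hi e then ξ e else 0ℚ)) ℚ.+ ∑ (λ e → ℚ.- mxℚ e)
          ≡⟨ sym (∑-+ (λ e → μ ℚ.* (if hi e then ξ e else 0ℚ)) (λ e → ℚ.- mxℚ e)) ⟩
        ∑ (λ e → μ ℚ.* (if hi e then ξ e else 0ℚ) ℚ.+ ℚ.- mxℚ e)
          ≡⟨ ∑-cong (λ e → sym (if-linear (hi e) μ (ξ e) (fromℕ (increment (Cur.lev (cs e)))))) ⟩
        ∑ (excess μ ξ) ∎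

  -- All levels are at most Λ m and some level increases in every improvement.
  steps-packed : ∀ {D cs} → (∀ e → Good m D (cs e)) → proj₁ (pack (repeat (suc V) step cs)) ≡ []
  steps-packed {D} {cs} good with progress (suc V)
    where
    levels : Curs → ℕ
    levels cs = sumᴺ (λ e → Cur.lev (cs e))
    progress : ∀ n → (∀ e → Good m D (repeat n step cs e))
               × (proj₁ (pack (repeat n step cs)) ≡ [] ⊎ n ≤ levels (repeat n step cs))
    progress zero = good , inj₂ z≤n
    progress (suc n) rewrite repeat-suc n step cs with progress n
    ... | g , inj₁ done rewrite step-done (repeat n step cs) done = g , inj₁ done
    ... | g , inj₂ n≤ with step-cases (repeat n step cs)
    ...   | inj₁ (done , same) rewrite same = g , inj₁ done
    ...   | inj₂ imp = improved-good imp g , inj₂ (≤-trans (s≤s n≤) (improved-levs imp))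
  ... | _ , inj₁ done = done
  ... | g , inj₂ V<levels = contradiction (≤-trans V<levels (≤-trans (sumᴺ-bound (Good.lev≤ ∘ g)) mΛ≤V)) (<⇒≱ ≤-refl)
    where
    -- By log m ≤ m, the sum of levels is at most m * (2 + m), which is exactly V.
    mΛ≤V : m * Λ m ≤ V
    mΛ≤V = ≤-trans (*-monoʳ-≤ m (s≤s (s≤s (log≤ m)))) (≤-reflexive (lemma m))
      where
      lemma : ∀ m → m * (2 + m) ≡ m + m + m * m
      lemma = solve-∀

  steps-inv : ∀ {P : Curs → Set} → (∀ {cs cs′} → Improved cs cs′ → P cs → P cs′) → ∀ n {cs} → P cs → P (repeat n step cs)
  steps-inv improve zero    p = p
  steps-inv {P} improve (suc n) {cs} p with step-cases cs
  ... | inj₁ (_ , same) rewrite same = steps-inv improve n p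
  ... | inj₂ imp = steps-inv improve n (improve imp p)

-- Sums, subsets and ranks

∑-single : ∀ {n} (f : Fin n → ℚ) i → (∀ j → j ≢ i → f j ≡ 0ℚ) → ∑ f ≡ f i
∑-single {suc n} f zero    f≡0 = trans (cong (f zero ℚ.+_) (trans (∑-cong (λ j → f≡0 (suc j) λ ())) (∑-zero n))) (ℚ.+-identityʳ _)
∑-single {suc n} f (suc i) f≡0 = trans (cong₂ ℚ._+_ (f≡0 zero λ ()) (∑-single (f ∘ suc) i (λ j j≢i → f≡0 (suc j) (j≢i ∘ Fin.suc-injective))))
  (ℚ.+-identityˡ _)

inverse-fromℕ : ∀ n → 1 ≤ n → fromℕ n ℚ.* inverse (fromℕ n) ≡ 1ℚ
inverse-fromℕ n 1≤n with fromℕ n ℚ.≟ 0ℚ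
... | yes n≡0 = contradiction (int-≤⁻ {ℤ.+ 1} {ℤ.+ 0} (ℚ.≤-trans (fromℕ-≤ 1≤n) (ℚ.≤-reflexive n≡0))) λ { (ℤ.+≤+ ()) }
... | no  n≢0 = ℚ.*-inverseʳ (fromℕ n) {{ℚ.≢-nonZero n≢0}}

0≤inverse : ∀ n → 1 ≤ n → 0ℚ ℚ.≤ inverse (fromℕ n)
0≤inverse n 1≤n with 0ℚ ℚ.≤? inverse (fromℕ n)
... | yes 0≤ = 0≤
... | no  ≰ = contradiction (ℚ.≤-trans (ℚ.≤-reflexive (sym (inverse-fromℕ n 1≤n)))
    (ℚ.≤-trans (*-monoˡ (0≤fromℕ n) (ℚ.<⇒≤ (ℚ.≰⇒> ≰))) (ℚ.≤-reflexive (ℚ.*-zeroʳ (fromℕ n))))) λ { (ℚ.*≤* (ℤ.+≤+ ())) }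

set : ∀ {n} → (Fin n → Bool) → Subset n
set = Vec.tabulate

∈-set⁺ : ∀ {n} {f : Fin n → Bool} {i} → f i ≡ true → i Subset.∈ set f
∈-set⁺ {f = f} {i} eq = Vec.lookup⇒[]= i (set f) (trans (Vec.lookup∘tabulate f i) eq)

∈-set⁻ : ∀ {n} {f : Fin n → Bool} {i} → i Subset.∈ set f → f i ≡ true
∈-set⁻ {f = f} {i} i∈ = trans (sym (Vec.lookup∘tabulate f i)) (Vec.[]=⇒lookup i∈)

card-∑ : ∀ {n} (S : Subset n) → fromℕ Subset.∣ S ∣ ≡ ∑ (λ i → if Vec.lookup S i then 1ℚ else 0ℚ)
card-∑ []          = refl
card-∑ (true ∷ S)  = trans (fromℕ-suc Subset.∣ S ∣) (cong (1ℚ ℚ.+_) (card-∑ S))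
card-∑ (false ∷ S) = trans (card-∑ S) (sym (ℚ.+-identityˡ _))

∈-allSubsets : ∀ {n} (S : Subset n) → S ∈ allSubsets n
∈-allSubsets []          = here refl
∈-allSubsets (false ∷ S) = ∈-++⁺ˡ (∈-map⁺ (Subset.outside ∷_) (∈-allSubsets S))
∈-allSubsets (true ∷ S)  = ∈-++⁺ʳ _ (∈-map⁺ (Subset.inside ∷_) (∈-allSubsets S))

module _ {n : ℕ} (𝓜 : Matroid n) where
  open Matroid 𝓜

  ≤-rank : ∀ {S I} → I Subset.⊆ S → Independent I → Subset.∣ I ∣ ≤ rank 𝓜 S
  ≤-rank {S} {I} I⊆S ind = All.lookup (xs≤max 0 _)
    (∈-map⁺ Subset.∣_∣ (∈-filter⁺ (λ p → p Subset.⊆? S ×-dec independent? p) (∈-allSubsets I) (I⊆S , ind)))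

  -- A larger independent subset of S would, by exchange, supply an element of S that extends I.
  rank-≤ : ∀ {S I} → Independent I → (∀ {e} → e Subset.∈ S → e Subset.∉ I → ¬ Independent (I Subset.∪ Subset.⁅ e ⁆)) →
           rank 𝓜 S ≤ Subset.∣ I ∣
  rank-≤ {S} {I} ind maximal = max≤v⁺ z≤n (All.map⁺ (All.tabulate bound))
    where
    bound : ∀ {J} → J ∈ List.filter (λ p → p Subset.⊆? S ×-dec independent? p) (allSubsets n) → Subset.∣ J ∣ ≤ Subset.∣ I ∣
    bound {J} J∈ with ∈-filter⁻ (λ p → p Subset.⊆? S ×-dec independent? p) {xs = allSubsets n} J∈ | Subset.∣ J ∣ ≤? Subset.∣ I ∣
    ... | _ | yes J≤I = J≤I
    ... | _ , J⊆S , indJ | no J≰I with exchange ind indJ (≰⇒> J≰I)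
    ...   | e , e∈J , e∉I , ind′ = contradiction ind′ (maximal (J⊆S e∈J) e∉I)

module _ {m : ℕ} where

  ∈-image⁺ : ∀ {n} (π : Fin n → Fin m) {S i} → i Subset.∈ S → π i Subset.∈ image π S
  ∈-image⁺ π {true ∷ S}  Vec.here      = Subset.x∈p∪q⁺ (inj₁ (Subset.x∈⁅x⁆ _))
  ∈-image⁺ π {true ∷ S}  (Vec.there p) = Subset.x∈p∪q⁺ {p = Subset.⁅ π zero ⁆} (inj₂ (∈-image⁺ (π ∘ suc) p))
  ∈-image⁺ π {false ∷ S} (Vec.there p) = ∈-image⁺ (π ∘ suc) p

  ∈-image⁻ : ∀ {n} (π : Fin n → Fin m) S {e} → e Subset.∈ image π S → ∃[ i ] (i Subset.∈ S × π i ≡ e)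
  ∈-image⁻ π []          p = ⊥-elim (Subset.∉⊥ p)
  ∈-image⁻ π (false ∷ S) p with ∈-image⁻ (π ∘ suc) S p
  ... | i , i∈S , eq = suc i , Vec.there i∈S , eq
  ∈-image⁻ π (true ∷ S)  p with Subset.x∈p∪q⁻ Subset.⁅ π zero ⁆ _ p
  ... | inj₁ q = zero , Vec.here , sym (Subset.x∈⁅y⁆⇒x≡y _ q)
  ... | inj₂ q with ∈-image⁻ (π ∘ suc) S q
  ...   | i , i∈S , eq = suc i , Vec.there i∈S , eq

∧-true : ∀ {a b} → a ∧ b ≡ true → a ≡ true × b ≡ true
∧-true {true} {true} _ = refl , refl

does-true : ∀ {A : Set} (d : Dec A) → does d ≡ true → A
does-true (yes a) _ = a

true-does : ∀ {A : Set} (d : Dec A) → A → does d ≡ true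
true-does (yes _)  _ = refl
true-does (no ¬a)  a = contradiction a ¬a

-- currentCopy picks the copies that are alive at a fixed time.
module Lift {m : ℕ} (mq : ℚ) (M₀ : Matroid m) (1≤m : 1 ≤ m) {n : ℕ} (π : Fin n → Fin m) (currentCopy : Fin m → Fin n)
  (π-currentCopy : ∀ e → π (currentCopy e) ≡ e) where

  indep : Subset m → Bool
  indep = does ∘ Matroid.independent? M₀

  open Outer m mq indep hiding (⟨_⟩)
  open Greedy m indep M V
  open PackingAnalysis m mq indep 1≤m
  open Improvement m mq indep 1≤m

  𝓜 : Matroid n
  𝓜 = parallelExtension M₀ π

  private
    module M₀ = Matroid M₀
    module 𝓜 = Matroid 𝓜

  current? : Fin n → Bool
  current? k = does (k Fin.≟ currentCopy (π k))

  current-currentCopy : ∀ e → current? (currentCopy e) ≡ true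
  current-currentCopy e = true-does (currentCopy e Fin.≟ currentCopy (π (currentCopy e))) (cong currentCopy (sym (π-currentCopy e)))

  -- Every copy is counted at its origin. Exchanging the two sums leaves, for each e, the copies of
  -- e, of which only the current one contributes.
  ∑-current : ∀ (f : Fin n → ℚ) → (∀ k → current? k ≡ false → f k ≡ 0ℚ) → ∑ f ≡ ∑ (λ e → f (currentCopy e))
  ∑-current f f≡0 = begin
    ∑ f                                                     ≡⟨ ∑-cong (λ k → sym (trans (∑-single (g k) (π k) (g-off k)) (g-on k))) ⟩
    ∑ (λ k → ∑ (g k))                                       ≡⟨ ∑-comm g ⟩
    ∑ (λ e → ∑ (λ k → g k e))                               ≡⟨ ∑-cong (λ e → trans (∑-single (λ k → g k e) (currentCopy e) (off e)) (on e)) ⟩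
    ∑ (λ e → f (currentCopy e))                                      ∎
    where
    open ≡-Reasoning
    g : Fin n → Fin m → ℚ
    g k e = if does (π k Fin.≟ e) then f k else 0ℚ
    g-on : ∀ k → g k (π k) ≡ f k
    g-on k rewrite true-does (π k Fin.≟ π k) refl = refl
    g-off : ∀ k e → e ≢ π k → g k e ≡ 0ℚ
    g-off k e e≢ with π k Fin.≟ e
    ... | yes eq = contradiction (sym eq) e≢
    ... | no  _  = refl
    on : ∀ e → g (currentCopy e) e ≡ f (currentCopy e)
    on e rewrite true-does (π (currentCopy e) Fin.≟ e) (π-currentCopy e) = refl
    off : ∀ e k → k ≢ currentCopy e → g k e ≡ 0ℚ
    off e k k≢ with π k Fin.≟ e
    ... | no  _    = refl
    ... | yes refl = f≡0 k (not-current (k Fin.≟ currentCopy (π k)) k≢)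
      where
      not-current : ∀ {A : Set} (d : Dec A) → ¬ A → does d ≡ false
      not-current (yes a) ¬a = contradiction a ¬a
      not-current (no _)  _  = refl

  lifted : (Fin m → Bool) → Subset n
  lifted f = set (λ k → current? k ∧ f (π k))

  lifted⁻ : ∀ {f k} → k Subset.∈ lifted f → k ≡ currentCopy (π k) × f (π k) ≡ true
  lifted⁻ {f} {k} k∈ with ∧-true {current? k} (∈-set⁻ k∈)
  ... | c , fk = does-true (k Fin.≟ currentCopy (π k)) c , fk

  lifted⁺ : ∀ {f e} → f e ≡ true → currentCopy e Subset.∈ lifted f
  lifted⁺ {f} {e} fe = ∈-set⁺ (trans (cong₂ _∧_ (current-currentCopy e) (cong f (π-currentCopy e))) fe)

  ∑-lifted : ∀ f (z : Fin n → ℚ) → z ⟨ lifted f ⟩ ≡ ∑ (λ e → if f e then z (currentCopy e) else 0ℚ)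
  ∑-lifted f z = trans (∑-current (λ k → if Vec.lookup (lifted f) k then z k else 0ℚ) off) (∑-cong on)
    where
    off : ∀ k → current? k ≡ false → (if Vec.lookup (lifted f) k then z k else 0ℚ) ≡ 0ℚ
    off k eq rewrite Vec.lookup∘tabulate (λ k → current? k ∧ f (π k)) k | eq = refl
    on : ∀ e → (if Vec.lookup (lifted f) (currentCopy e) then z (currentCopy e) else 0ℚ) ≡ (if f e then z (currentCopy e) else 0ℚ)
    on e rewrite Vec.lookup∘tabulate (λ k → current? k ∧ f (π k)) (currentCopy e) | current-currentCopy e | π-currentCopy e = refl

  card-lifted : ∀ f → fromℕ Subset.∣ lifted f ∣ ≡ fromℕ (sumᴺ (λ e → if f e then 1 else 0))
  card-lifted f = begin
    fromℕ Subset.∣ lifted f ∣                  ≡⟨ card-∑ (lifted f) ⟩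
    (λ _ → 1ℚ) ⟨ lifted f ⟩                    ≡⟨ ∑-lifted f (λ _ → 1ℚ) ⟩
    ∑ (λ e → if f e then 1ℚ else 0ℚ)           ≡⟨ ∑-cong (λ e → sym (if-cong fromℕ (f e))) ⟩
    ∑ (λ e → fromℕ (if f e then 1 else 0))     ≡⟨ sym (fromℕ-sum (λ e → if f e then 1 else 0)) ⟩
    fromℕ (sumᴺ (λ e → if f e then 1 else 0))  ∎
    where open ≡-Reasoning

  module _ (w : Loads) where

    chosen : Fin m → Bool
    chosen e = member? e (basis w)

    chosen-independent : 𝓜.Independent (lifted chosen)
    chosen-independent =
        (λ i j i∈ j∈ eq → trans (proj₁ (lifted⁻ {chosen} i∈)) (trans (cong currentCopy eq) (sym (proj₁ (lifted⁻ {chosen} j∈)))))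
      , M₀.hereditary image⊆ (does-true (M₀.independent? _) (basis-indep w (true-does (M₀.independent? _) empty)))
      where
      empty : M₀.Independent (subset [])
      empty = M₀.hereditary (λ x∈ → contradiction (∈-set⁻ x∈) λ ()) M₀.empty
      image⊆ : image π (lifted chosen) Subset.⊆ subset (basis w)
      image⊆ x∈ with ∈-image⁻ π (lifted chosen) x∈
      ... | k , k∈ , refl = ∈-set⁺ (proj₂ (lifted⁻ {chosen} k∈))

    module _ {v : ℕ} (v≤V : v ≤ V) where

      below : Fin m → Bool
      below e = not (above? w v e)

      chosenBelow : Fin m → Bool
      chosenBelow e = below e ∧ chosen e

      rank-below : rank 𝓜 (lifted below) ≤ Subset.∣ lifted chosenBelow ∣
      rank-below = rank-≤ 𝓜 (𝓜.hereditary sub chosen-independent) maximal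
        where
        sub : lifted chosenBelow Subset.⊆ lifted chosen
        sub {k} k∈ with lifted⁻ {chosenBelow} k∈
        ... | k≡ , eq = subst (Subset._∈ lifted chosen) (sym k≡) (lifted⁺ {chosen} (proj₂ (∧-true {below (π k)} eq)))
        maximal : ∀ {k} → k Subset.∈ lifted below → k Subset.∉ lifted chosenBelow →
                  ¬ 𝓜.Independent (lifted chosenBelow Subset.∪ Subset.⁅ k ⁆)
        maximal {k} k∈ k∉ (_ , ind) with lifted⁻ {below} k∈
        ... | k≡ , low with basis-maximal w {v} {π k} v≤V (not-true low)
          where
          not-true : ∀ {b} → not b ≡ true → b ≡ false
          not-true {false} _ = refl
        ...   | inj₁ πk∈ = k∉ (subst (Subset._∈ lifted chosenBelow) (sym k≡)
                             (lifted⁺ {chosenBelow} (cong₂ _∧_ low (member?⁺ πk∈))))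
        ...   | inj₂ (A , A⊆ , blocked) with trans (sym blocked) (true-does (M₀.independent? _) (M₀.hereditary inImage ind))
          where
          I⁺ : Subset n
          I⁺ = lifted chosenBelow Subset.∪ Subset.⁅ k ⁆
          inImage : subset (π k ∷ A) Subset.⊆ image π I⁺
          inImage {x} x∈ with member?⁻ {x} {π k ∷ A} (∈-set⁻ x∈)
          ... | here refl = ∈-image⁺ π (Subset.x∈p∪q⁺ {p = lifted chosenBelow} (inj₂ (Subset.x∈⁅x⁆ k)))
          ... | there x∈A = subst (Subset._∈ image π I⁺) (π-currentCopy x)
                  (∈-image⁺ π (Subset.x∈p∪q⁺ (inj₁ (lifted⁺ {chosenBelow}
                    (cong₂ _∧_ (cong not (proj₂ (A⊆ x∈A))) (member?⁺ (proj₁ (A⊆ x∈A))))))))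
        ...     | ()

      -- Weak duality for the constraint given by the elements above v
      cover : ∀ (z : Fin n → ℚ) → z ∈P 𝓜 → (∀ k → current? k ≡ false → z k ≡ 0ℚ) →
              fromℕ (sumᴺ (hits w v)) ℚ.≤ ∑ (λ e → if above? w v e then z (currentCopy e) else 0ℚ)
      cover z base z≡0 = 0≤q-p⇒p≤q (subst (0ℚ ℚ.≤_) (sym difference) (ℚ.+-mono-≤ total≥ low≤))
        where
        open _∈P_ base
        Zl Zh H Hl : ℚ
        Zl = ∑ (λ e → if below e then z (currentCopy e) else 0ℚ)
        Zh = ∑ (λ e → if above? w v e then z (currentCopy e) else 0ℚ)
        H  = fromℕ (sumᴺ (hits w v))
        Hl = fromℕ (sumᴺ (λ e → if chosenBelow e then 1 else 0))
        low≤ : 0ℚ ℚ.≤ Hl ℚ.- Zl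
        low≤ = p≤q⇒0≤q-p (begin
          Zl                                       ≡⟨ sym (∑-lifted below z) ⟩
          z ⟨ lifted below ⟩                       ≤⟨ ranks (lifted below) ⟩
          fromℕ (rank 𝓜 (lifted below))            ≤⟨ fromℕ-≤ rank-below ⟩
          fromℕ Subset.∣ lifted chosenBelow ∣      ≡⟨ card-lifted chosenBelow ⟩
          Hl                                       ∎)
          where open ℚ.≤-Reasoning
        total≥ : 0ℚ ℚ.≤ (Zl ℚ.+ Zh) ℚ.- (Hl ℚ.+ H)
        total≥ = p≤q⇒0≤q-p (begin
          Hl ℚ.+ H                                 ≡⟨ sym (fromℕ-+ (sumᴺ (λ e → if chosenBelow e then 1 else 0)) (sumᴺ (hits w v))) ⟩
          fromℕ (sumᴺ (λ e → if chosenBelow e then 1 else 0) + sumᴺ (hits w v))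
                                                   ≡⟨ cong fromℕ (trans (sym (∑ᴺ.∑-distrib-+ (λ e → if chosenBelow e then 1 else 0) (hits w v))) (∑ᴺ.sum-cong-≗ splitᴺ)) ⟩
          fromℕ (sumᴺ (λ e → if chosen e then 1 else 0))
                                                   ≡⟨ sym (card-lifted chosen) ⟩
          fromℕ Subset.∣ lifted chosen ∣           ≤⟨ fromℕ-≤ (≤-rank 𝓜 Subset.⊆⊤ chosen-independent) ⟩
          fromℕ (rank 𝓜 Subset.⊤)                  ≡⟨ sym total ⟩
          ∑ z                                      ≡⟨ ∑-current z z≡0 ⟩
          ∑ (λ e → z (currentCopy e))                       ≡⟨ trans (∑-cong splitℚ) (∑-+ (λ e → if below e then z (currentCopy e) else 0ℚ) (λ e → if above? w v e then z (currentCopy e) else 0ℚ)) ⟩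
          Zl ℚ.+ Zh                                ∎)
          where
          open ℚ.≤-Reasoning
          splitᴺ : ∀ e → (if chosenBelow e then 1 else 0) + hits w v e ≡ (if chosen e then 1 else 0)
          splitᴺ e with above? w v e | chosen e
          ... | true  | true  = refl
          ... | true  | false = refl
          ... | false | true  = refl
          ... | false | false = refl
          splitℚ : ∀ e → z (currentCopy e) ≡ (if below e then z (currentCopy e) else 0ℚ) ℚ.+ (if above? w v e then z (currentCopy e) else 0ℚ)
          splitℚ e with above? w v e
          ... | true  = sym (ℚ.+-identityˡ _)
          ... | false = sym (ℚ.+-identityʳ _)
        difference : Zh ℚ.- H ≡ ((Zl ℚ.+ Zh) ℚ.- (Hl ℚ.+ H)) ℚ.+ (Hl ℚ.- Zl)
        difference = identity Zl Zh Hl H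
          where
          identity : ∀ a b c d → b ℚ.+ ℚ.- d ≡ ((a ℚ.+ b) ℚ.+ ℚ.- (c ℚ.+ d)) ℚ.+ (c ℚ.+ ℚ.- a)
          identity = Ring.solve-∀ ℚ-ring

  module _ (cs : Curs) (quiet : Quiet (loads cs) N) where

    private
      w₀ : Loads
      w₀ = loads cs
      level : Fin m → ℕ
      level e = Cur.lev (cs e)

      1≤N : 1 ≤ N
      1≤N = *-mono-≤ 1≤m 1≤m

      key≤V : ∀ {i} → i < N → ∀ e → above? (seq w₀ i) V e ≡ false
      key≤V i<N e = pos-false⁺ (state-key≤ cs (<⇒≤ i<N) (states cs (<⇒≤ i<N) (λ j j<i → quiet j (<-trans j<i i<N)) e))

    usage : ℕ → Fin n → ℚ
    usage i k = if current? k then fromℕ (count w₀ i (π k)) else 0ℚ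

    private
      chosenAt : ℕ → Fin m → Bool
      chosenAt i = chosen (seq w₀ i)

      basisIndicator : ℕ → Fin n → ℚ
      basisIndicator i k = if Vec.lookup (lifted (chosenAt i)) k then 1ℚ else 0ℚ

      usage-suc : ∀ i k → usage (suc i) k ≡ basisIndicator i k ℚ.+ usage i k
      usage-suc i k = trans (go (current? k) (chosenAt i (π k)) (count w₀ i (π k)))
        (cong (λ b → (if b then 1ℚ else 0ℚ) ℚ.+ usage i k) (sym (Vec.lookup∘tabulate (λ k → current? k ∧ chosenAt i (π k)) k)))
        where
        go : ∀ b c n → (if b then fromℕ ((if c then 1 else 0) + n) else 0ℚ)
             ≡ (if b ∧ c then 1ℚ else 0ℚ) ℚ.+ (if b then fromℕ n else 0ℚ)
        go true  true  n = fromℕ-suc n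
        go true  false n = sym (ℚ.+-identityˡ (fromℕ n))
        go false c     n = refl

      -- At threshold V all elements are low, so the chosen set is maximal in E. A copy that is not
      -- current is parallel to the current one: if that one is chosen, adding the copy breaks
      -- injectivity; if not, the origin is blocked by chosen elements.
      rank-chosen : ∀ {i} → i < N → fromℕ Subset.∣ lifted (chosenAt i) ∣ ≡ fromℕ (rank 𝓜 Subset.⊤)
      rank-chosen {i} i<N = cong fromℕ (≤-antisym (≤-rank 𝓜 Subset.⊆⊤ (chosen-independent (seq w₀ i)))
        (rank-≤ 𝓜 (chosen-independent (seq w₀ i)) maximal))
        where
        maximal : ∀ {k} → k Subset.∈ Subset.⊤ → k Subset.∉ lifted (chosenAt i) →
                  ¬ 𝓜.Independent (lifted (chosenAt i) Subset.∪ Subset.⁅ k ⁆)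
        maximal {k} _ k∉ (inj , ind) with basis-maximal (seq w₀ i) {V} {π k} ≤-refl (key≤V i<N (π k))
        ... | inj₁ πk∈ = k∉ (subst (Subset._∈ lifted (chosenAt i)) (inj (currentCopy (π k)) k
                (Subset.x∈p∪q⁺ (inj₁ (lifted⁺ {chosenAt i} (member?⁺ πk∈))))
                (Subset.x∈p∪q⁺ {p = lifted (chosenAt i)} (inj₂ (Subset.x∈⁅x⁆ k))) (π-currentCopy (π k)))
              (lifted⁺ {chosenAt i} (member?⁺ πk∈)))
        ... | inj₂ (A , A⊆ , blocked) with trans (sym blocked) (true-does (M₀.independent? _) (M₀.hereditary inImage ind))
          where
          I⁺ : Subset n
          I⁺ = lifted (chosenAt i) Subset.∪ Subset.⁅ k ⁆
          inImage : subset (π k ∷ A) Subset.⊆ image π I⁺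
          inImage {x} x∈ with member?⁻ {x} {π k ∷ A} (∈-set⁻ x∈)
          ... | here refl = ∈-image⁺ π (Subset.x∈p∪q⁺ {p = lifted (chosenAt i)} (inj₂ (Subset.x∈⁅x⁆ k)))
          ... | there x∈A = subst (Subset._∈ image π I⁺) (π-currentCopy x)
                  (∈-image⁺ π (Subset.x∈p∪q⁺ (inj₁ (lifted⁺ {chosenAt i} (member?⁺ (proj₁ (A⊆ x∈A)))))))
        ...   | ()

      restrict-+ : ∀ S (f g : Fin n → ℚ) → (λ k → f k ℚ.+ g k) ⟨ S ⟩ ≡ f ⟨ S ⟩ ℚ.+ g ⟨ S ⟩
      restrict-+ S f g = trans (∑-cong (λ k → go (Vec.lookup S k) (f k) (g k)))
          (∑-+ (λ k → if Vec.lookup S k then f k else 0ℚ) (λ k → if Vec.lookup S k then g k else 0ℚ))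
        where
        go : ∀ b x y → (if b then x ℚ.+ y else 0ℚ) ≡ (if b then x else 0ℚ) ℚ.+ (if b then y else 0ℚ)
        go true  x y = refl
        go false x y = refl

      restrict-cong : ∀ S {f g : Fin n → ℚ} → (∀ k → f k ≡ g k) → f ⟨ S ⟩ ≡ g ⟨ S ⟩
      restrict-cong S f≡g = ∑-cong (λ k → cong (λ x → if Vec.lookup S k then x else 0ℚ) (f≡g k))

      restrict-* : ∀ S x (f : Fin n → ℚ) → (λ k → x ℚ.* f k) ⟨ S ⟩ ≡ x ℚ.* f ⟨ S ⟩
      restrict-* S x f = trans (∑-cong (λ k → go (Vec.lookup S k) (f k))) (∑-* x (λ k → if Vec.lookup S k then f k else 0ℚ))
        where
        go : ∀ b y → (if b then x ℚ.* y else 0ℚ) ≡ x ℚ.* (if b then y else 0ℚ)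
        go true  y = refl
        go false y = sym (ℚ.*-zeroʳ x)

      -- The usage is a sum of i indicator vectors of bases, and each basis meets S in an
      -- independent set.
      usage-ranks : ∀ i → i ≤ N → ∀ S → usage i ⟨ S ⟩ ℚ.≤ fromℕ i ℚ.* fromℕ (rank 𝓜 S)
      usage-ranks zero    _   S = ℚ.≤-reflexive (trans (trans (∑-cong zero-term) (∑-zero n)) (sym (ℚ.*-zeroˡ (fromℕ (rank 𝓜 S)))))
        where
        zero-term : ∀ k → (if Vec.lookup S k then usage 0 k else 0ℚ) ≡ 0ℚ
        zero-term k with Vec.lookup S k | current? k
        ... | true  | true  = refl
        ... | true  | false = refl
        ... | false | _     = refl
      usage-ranks (suc i) i<N S = begin
        usage (suc i) ⟨ S ⟩                              ≡⟨ trans (restrict-cong S (usage-suc i)) (restrict-+ S (basisIndicator i) (usage i)) ⟩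
        basisIndicator i ⟨ S ⟩ ℚ.+ usage i ⟨ S ⟩             ≤⟨ ℚ.+-mono-≤ one (usage-ranks i (<⇒≤ i<N) S) ⟩
        r ℚ.+ fromℕ i ℚ.* r                              ≡⟨ cong (ℚ._+ fromℕ i ℚ.* r) (sym (ℚ.*-identityˡ r)) ⟩
        1ℚ ℚ.* r ℚ.+ fromℕ i ℚ.* r                       ≡⟨ sym (ℚ.*-distribʳ-+ r 1ℚ (fromℕ i)) ⟩
        (1ℚ ℚ.+ fromℕ i) ℚ.* r                           ≡⟨ cong (ℚ._* r) (sym (fromℕ-suc i)) ⟩
        fromℕ (suc i) ℚ.* r                              ∎
        where
        open ℚ.≤-Reasoning
        r : ℚ
        r = fromℕ (rank 𝓜 S)
        I : Subset n
        I = lifted (chosenAt i)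
        meet : ∀ k → (if Vec.lookup S k then basisIndicator i k else 0ℚ) ≡ (if Vec.lookup (I Subset.∩ S) k then 1ℚ else 0ℚ)
        meet k rewrite Vec.lookup-zipWith _∧_ k I S with Vec.lookup S k | Vec.lookup I k
        ... | true  | true  = refl
        ... | true  | false = refl
        ... | false | true  = refl
        ... | false | false = refl
        one : basisIndicator i ⟨ S ⟩ ℚ.≤ r
        one = begin
          basisIndicator i ⟨ S ⟩                               ≡⟨ trans (∑-cong meet) (sym (card-∑ (I Subset.∩ S))) ⟩
          fromℕ Subset.∣ I Subset.∩ S ∣                    ≤⟨ fromℕ-≤ (≤-rank 𝓜 (Subset.p∩q⊆q I S)
                                                               (𝓜.hereditary (Subset.p∩q⊆p I S) (chosen-independent (seq w₀ i)))) ⟩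
          r                                                ∎

      usage-total : ∀ i → i ≤ N → ∑ (usage i) ≡ fromℕ i ℚ.* fromℕ (rank 𝓜 Subset.⊤)
      usage-total zero    _ = trans (trans (∑-cong zero-term) (∑-zero n)) (sym (ℚ.*-zeroˡ (fromℕ (rank 𝓜 Subset.⊤))))
        where
        zero-term : ∀ k → usage 0 k ≡ 0ℚ
        zero-term k with current? k
        ... | true  = refl
        ... | false = refl
      usage-total (suc i) i<N = begin
        ∑ (usage (suc i))                                ≡⟨ trans (∑-cong (usage-suc i)) (∑-+ (basisIndicator i) (usage i)) ⟩
        ∑ (basisIndicator i) ℚ.+ ∑ (usage i)                 ≡⟨ cong₂ ℚ._+_ (trans (sym (card-∑ (lifted (chosenAt i)))) (rank-chosen i<N)) (usage-total i (<⇒≤ i<N)) ⟩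
        r ℚ.+ fromℕ i ℚ.* r                              ≡⟨ cong (ℚ._+ fromℕ i ℚ.* r) (sym (ℚ.*-identityˡ r)) ⟩
        1ℚ ℚ.* r ℚ.+ fromℕ i ℚ.* r                       ≡⟨ sym (ℚ.*-distribʳ-+ r 1ℚ (fromℕ i)) ⟩
        (1ℚ ℚ.+ fromℕ i) ℚ.* r                           ≡⟨ cong (ℚ._* r) (sym (fromℕ-suc i)) ⟩
        fromℕ (suc i) ℚ.* r                              ∎
        where
        open ≡-Reasoning
        r : ℚ
        r = fromℕ (rank 𝓜 Subset.⊤)

      ν : ℚ
      ν = inverse (fromℕ N)

      0≤ν : 0ℚ ℚ.≤ ν
      0≤ν = 0≤inverse N 1≤N

      νN : ∀ q → ν ℚ.* (fromℕ N ℚ.* q) ≡ q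
      νN q = trans (sym (ℚ.*-assoc ν (fromℕ N) q)) (trans (cong (ℚ._* q) (trans (ℚ.*-comm ν (fromℕ N)) (inverse-fromℕ N 1≤N))) (ℚ.*-identityˡ q))

      if-0≤ : ∀ b {x} → 0ℚ ℚ.≤ x → 0ℚ ℚ.≤ (if b then x else 0ℚ)
      if-0≤ true  0≤x = 0≤x
      if-0≤ false _   = ℚ.≤-refl

    average : Fin n → ℚ
    average k = ν ℚ.* usage N k

    average-0≤ : ∀ k → 0ℚ ℚ.≤ average k
    average-0≤ k = *-nonneg 0≤ν (if-0≤ (current? k) (0≤fromℕ (count w₀ N (π k))))

    average-base : average ∈P 𝓜
    average-base = record
      { nonneg = average-0≤
      ; ranks = λ S → ℚ.≤-trans (ℚ.≤-reflexive (restrict-* S ν (usage N)))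
          (ℚ.≤-trans (*-monoˡ 0≤ν (usage-ranks N ≤-refl S)) (ℚ.≤-reflexive (νN (fromℕ (rank 𝓜 S)))))
      ; total = trans (∑-* ν (usage N)) (trans (cong (ν ℚ.*_) (usage-total N ≤-refl)) (νN (fromℕ (rank 𝓜 Subset.⊤))))
      }

    average-off : ∀ k → current? k ≡ false → average k ≡ 0ℚ
    average-off k eq = trans (cong (λ b → ν ℚ.* (if b then fromℕ (count w₀ N (π k)) else 0ℚ)) eq) (ℚ.*-zeroʳ ν)

    average-currentCopy : ∀ e → average (currentCopy e) ≡ ν ℚ.* fromℕ (count w₀ N e)
    average-currentCopy e = cong₂ (λ b e → ν ℚ.* (if b then fromℕ (count w₀ N e) else 0ℚ)) (current-currentCopy e) (π-currentCopy e)

    average-≤1 : ∀ k → average k ℚ.≤ 1ℚ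
    average-≤1 k = ℚ.≤-trans (*-monoˡ 0≤ν (if-≤ (current? k)))
      (ℚ.≤-reflexive (trans (cong (ν ℚ.*_) (sym (ℚ.*-identityʳ (fromℕ N)))) (νN 1ℚ)))
      where
      if-≤ : ∀ b → (if b then fromℕ (count w₀ N (π k)) else 0ℚ) ℚ.≤ fromℕ N
      if-≤ true  = fromℕ-≤ (count≤ w₀ N (π k))
      if-≤ false = 0≤fromℕ N

  truncated-≤ : ∀ {z} y → z ℚ.≤ 1ℚ → z ℚ.≤ y ⊎ 1ℚ ℚ.≤ y → z ℚ.≤ truncated y
  truncated-≤ y z≤1 z≤y⊎1≤y with ≤?-cases y 1ℚ
  ... | inj₂ (eq , _)   rewrite eq = z≤1
  ... | inj₁ (eq , y≤1) rewrite eq with z≤y⊎1≤y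
  ...   | inj₁ z≤y = z≤y
  ...   | inj₂ 1≤y = ℚ.≤-trans z≤1 1≤y

-- Intervals and current copies

lookup-injective : ∀ {A : Set} {xs : List A} → Unique xs → ∀ i j → lookup xs i ≡ lookup xs j → i ≡ j
lookup-injective (_ ∷ _)   zero    zero    _  = refl
lookup-injective (x∉ ∷ _)  zero    (suc j) eq = contradiction eq (All.lookup x∉ (∈-lookup j))
lookup-injective (x∉ ∷ _)  (suc i) zero    eq = contradiction (sym eq) (All.lookup x∉ (∈-lookup i))
lookup-injective (_ ∷ xs!) (suc i) (suc j) eq = cong suc (lookup-injective xs! i j eq)

head-filter : ∀ {A : Set} {P : A → Set} (P? : ∀ x → Dec (P x)) {x} xs → x ∈ xs → P x →
              (∀ {y} → y ∈ xs → P y → y ≡ x) → head (filter P? xs) ≡ just x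
head-filter P? {x} xs x∈ px unique with filter P? xs in eq
... | []    = contradiction (subst (x ∈_) eq (∈-filter⁺ P? x∈ px)) λ ()
... | y ∷ _ with ∈-filter⁻ P? {xs = xs} (subst (y ∈_) (sym eq) (here refl))
...   | y∈ , py = cong just (unique y∈ py)

does-cases : ∀ {A : Set} (d : Dec A) → (does d ≡ true × A) ⊎ (does d ≡ false × ¬ A)
does-cases (yes a) = inj₁ (refl , a)
does-cases (no ¬a) = inj₂ (refl , ¬a)

module Intervals {m : ℕ} (P : Instance m) where
  open Instance P
  open IntervalModel P

  ≤-lastStep : ∀ e s → s ≤ lastStep e s
  ≤-lastStep e s with a e ℚ.≤? c s e
  ... | yes _ = ≤-refl
  ... | no  _ = ⊥≤max s (filter (λ t → holding e s t ℚ.≤? a e) (upTo (suc T)))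

  boundary-< : ∀ e i → boundary e i < boundary e (suc i)
  boundary-< e i = ≤-lastStep e (suc (boundary e i))

  boundary-mono : ∀ e {i j} → i ≤ j → boundary e i ≤ boundary e j
  boundary-mono e {j = zero}  z≤n = ≤-refl
  boundary-mono e {i} {suc j} i≤ with m≤n⇒m<n∨m≡n i≤
  ... | inj₂ refl      = ≤-refl
  ... | inj₁ (s≤s i≤j) = ≤-trans (boundary-mono e i≤j) (<⇒≤ (boundary-< e j))

  ≤-boundary : ∀ e i → i ≤ boundary e i
  ≤-boundary e zero    = z≤n
  ≤-boundary e (suc i) = ≤-trans (s≤s (≤-boundary e i)) (boundary-< e i)

  Covering : Fin m → ℕ → ℕ → Set
  Covering e t i = boundary e i ≤ t × t < boundary e (suc i)

  covering-unique : ∀ {e t i j} → Covering e t i → Covering e t j → i ≡ j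
  covering-unique {e} {t} {i} {j} (i≤t , t<i) (j≤t , t<j) = ≤-antisym (go t<j i≤t) (go t<i j≤t)
    where
    go : ∀ {i j} → t < boundary e (suc j) → boundary e i ≤ t → i ≤ j
    go {i} {j} t<j i≤t with i ≤? j
    ... | yes i≤j = i≤j
    ... | no  i≰j = contradiction (≤-trans (boundary-mono e (≰⇒> i≰j)) i≤t) (<⇒≱ t<j)

  -- Times are shifted by one: the copy with index currentIndex e t is alive
  -- at time t + 1, and born e t says that it is new at that time.
  mutual
    currentIndex : Fin m → ℕ → ℕ
    currentIndex e zero    = 0
    currentIndex e (suc t) = if born e (suc t) then suc (currentIndex e t) else currentIndex e t

    born : Fin m → ℕ → Bool
    born e zero    = true
    born e (suc t) = does (boundary e (suc (currentIndex e t)) ≤? suc t)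

  born-cases : ∀ e t → Covering e t (currentIndex e t) → (born e (suc t) ≡ true × boundary e (suc (currentIndex e t)) ≡ suc t)
                                               ⊎ (born e (suc t) ≡ false × suc t < boundary e (suc (currentIndex e t)))
  born-cases e t (_ , t<) with does-cases (boundary e (suc (currentIndex e t)) ≤? suc t)
  ... | inj₁ (eq , ≤t) = inj₁ (eq , ≤-antisym ≤t t<)
  ... | inj₂ (eq , ≰t) = inj₂ (eq , ≰⇒> ≰t)

  covering : ∀ e t → Covering e t (currentIndex e t)
  covering e zero    = z≤n , boundary-< e 0
  covering e (suc t) with born-cases e t (covering e t)
  ... | inj₁ (eq , b≡) rewrite eq = ≤-reflexive b≡ , ≤-trans (s≤s (≤-reflexive (sym b≡))) (boundary-< e (suc (currentIndex e t)))
  ... | inj₂ (eq , <b) rewrite eq = m≤n⇒m≤1+n (proj₁ (covering e t)) , <b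

  currentIndex-mono : ∀ e t → currentIndex e t ≤ currentIndex e (suc t)
  currentIndex-mono e t with born e (suc t)
  ... | true  = n≤1+n _
  ... | false = ≤-refl

  ∈-copiesOf : ∀ {e i} → boundary e i < T → copy e i ∈ copiesOf e
  ∈-copiesOf {e} {i} b<T = ∈-map⁺ (copy e) (∈-filter⁺ (λ i → boundary e i <? T) (∈-upTo⁺ (≤-<-trans (≤-boundary e i) b<T)) b<T)

  copiesOf⁻ : ∀ {e κ} → κ ∈ copiesOf e → ∃[ i ] (κ ≡ copy e i × boundary e i < T)
  copiesOf⁻ {e} κ∈ with ∈-map⁻ (copy e) κ∈
  ... | i , i∈ , eq = i , eq , proj₂ (∈-filter⁻ (λ i → boundary e i <? T) {xs = upTo T} i∈)

  copies⁻ : ∀ {κ} → κ ∈ copies → ∃[ e ] ∃[ i ] (κ ≡ copy e i × boundary e i < T)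
  copies⁻ {κ} κ∈ with Any.satisfied (∈-concatMap⁻ copiesOf {xs = allFin m} κ∈)
  ... | e , κ∈e = e , copiesOf⁻ κ∈e

  copies-unique : Unique copies
  copies-unique = Unique.concat⁺ (All.map⁺ (All.tabulate (λ {e} _ → copiesOf-unique e)))
    (AllPairs.map⁺ (AllPairs.map disjoint (Unique.allFin⁺ m)))
    where
    copiesOf-unique : ∀ e → Unique (copiesOf e)
    copiesOf-unique e = Unique.map⁺ (cong Copy.index) (Unique.filter⁺ (λ i → boundary e i <? T) (Unique.upTo⁺ T))
    disjoint : ∀ {e f} → e ≢ f → Disjoint (copiesOf e) (copiesOf f)
    disjoint e≢f (κ∈e , κ∈f) with copiesOf⁻ κ∈e | copiesOf⁻ κ∈f
    ... | _ , refl , _ | _ , eq , _ = e≢f (cong Copy.origin eq)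

  element-injective : ∀ {k l} → element k ≡ element l → k ≡ l
  element-injective {k} {l} = lookup-injective copies-unique k l

  origin : Element → Fin m
  origin k = Copy.origin (element k)

  index : Element → ℕ
  index k = Copy.index (element k)

  element-copy : ∀ k → element k ≡ copy (origin k) (index k)
  element-copy k with copies⁻ (∈-lookup {xs = copies} k)
  ... | e , i , eq , _ = trans eq (cong₂ copy (sym (cong Copy.origin eq)) (sym (cong Copy.index eq)))

  private
    currentCopy∈ : ∀ {t} → t < T → ∀ e → copy e (currentIndex e t) ∈ copies
    currentCopy∈ {t} t<T e = ∈-concatMap⁺ copiesOf
      (Any.map (λ { refl → ∈-copiesOf (≤-<-trans (proj₁ (covering e t)) t<T) }) (∈-allFin e))

  currentCopy : ∀ {t} → t < T → Fin m → Element
  currentCopy t<T e = Any.index (currentCopy∈ t<T e)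

  element-currentCopy : ∀ {t} (t<T : t < T) e → element (currentCopy t<T e) ≡ copy e (currentIndex e t)
  element-currentCopy t<T e = sym (Any.lookup-index (currentCopy∈ t<T e))

  origin-currentCopy : ∀ {t} (t<T : t < T) e → origin (currentCopy t<T e) ≡ e
  origin-currentCopy t<T e = cong Copy.origin (element-currentCopy t<T e)

  index-currentCopy : ∀ {t} (t<T : t < T) e → index (currentCopy t<T e) ≡ currentIndex e t
  index-currentCopy t<T e = cong Copy.index (element-currentCopy t<T e)

  currentCopy-unique : ∀ {t} (t<T : t < T) k → index k ≡ currentIndex (origin k) t → k ≡ currentCopy t<T (origin k)
  currentCopy-unique t<T k eq = element-injective (trans (element-copy k) (trans (cong (copy (origin k)) eq) (sym (element-currentCopy t<T (origin k)))))

  alive⇒index : ∀ {t k} → Alive k (suc t) → index k ≡ currentIndex (origin k) t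
  alive⇒index {t} {k} (b≤ , ≤e) = covering-unique (s≤s⁻¹ b≤′ , ≤e′) (covering (origin k) t)
    where
    b≤′ : suc (boundary (origin k) (index k)) ≤ suc t
    b≤′ = subst (λ κ → Copy.birth κ ≤ suc t) (element-copy k) b≤
    ≤e′ : suc t ≤ boundary (origin k) (suc (index k))
    ≤e′ = subst (λ κ → suc t ≤ Copy.end κ) (element-copy k) ≤e

  index⇒alive : ∀ {t k} → index k ≡ currentIndex (origin k) t → Alive k (suc t)
  index⇒alive {t} {k} eq with covering (origin k) t
  ... | b≤ , <e = subst (λ κ → Copy.birth κ ≤ suc t × suc t ≤ Copy.end κ)
    (sym (trans (element-copy k) (cong (copy (origin k)) eq))) (s≤s b≤ , <e)

  news : ℕ → Fin m → Maybe ℚ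
  news t e = if born e t then just (Copy.cost (copy e (currentIndex e t))) else nothing

  open Online P using (message)

  -- Intervals of copies of e do not overlap, so at most one is born at time t + 1, and it is then
  -- the current one. Thus the message, which filters all copies, agrees with the online description
  -- by `born` and `currentIndex`.
  message-news : ∀ {t} → t < T → message (suc t) ≡ list (map (maybe′ num nil ∘ news t) (allFin m))
  message-news {t} t<T = cong list (List.map-cong pointwise (allFin m))
    where
    birth? : ∀ κ → Dec (Copy.birth κ ≡ suc t)
    birth? κ = Copy.birth κ ≟ suc t
    boundary-born : ∀ t e → born e t ≡ true → boundary e (currentIndex e t) ≡ t
    boundary-born zero    e _  = refl
    boundary-born (suc t) e eq with born-cases e t (covering e t)
    ... | inj₁ (_ , b≡) rewrite eq = b≡
    ... | inj₂ (eq′ , _) with trans (sym eq) eq′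
    ...   | ()
    born-boundary : ∀ t e → boundary e (currentIndex e t) ≡ t → born e t ≡ true
    born-boundary zero    e _  = refl
    born-boundary (suc t) e b≡ with born-cases e t (covering e t)
    ... | inj₁ (eq , _) = eq
    ... | inj₂ (eq , _) rewrite eq = contradiction (≤-trans (≤-reflexive (sym b≡)) (proj₁ (covering e t))) (<⇒≱ ≤-refl)
    at-birth : ∀ e {κ} → κ ∈ copiesOf e → Copy.birth κ ≡ suc t → boundary e (currentIndex e t) ≡ t × κ ≡ copy e (currentIndex e t)
    at-birth e κ∈ eq with copiesOf⁻ κ∈
    ... | i , refl , _ = trans (cong (boundary e) (sym i≡)) (suc-injective eq) , cong (copy e) i≡
      where
      i≡ : i ≡ currentIndex e t
      i≡ = covering-unique (≤-reflexive (suc-injective eq) , ≤-trans (≤-reflexive (sym eq)) (boundary-< e i)) (covering e t)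
    pointwise : ∀ e → maybe′ (num ∘ Copy.cost) nil (head (filter birth? (copiesOf e))) ≡ maybe′ num nil (news t e)
    pointwise e with born e t in b
    ... | true  = cong (maybe′ (num ∘ Copy.cost) nil) (head-filter birth? (copiesOf e)
            (∈-copiesOf (≤-<-trans (proj₁ (covering e t)) t<T)) (cong suc (boundary-born t e b)) (λ κ∈ eq → proj₂ (at-birth e κ∈ eq)))
    ... | false = cong (maybe′ (num ∘ Copy.cost) nil ∘ head)
            (List.filter-none birth? (All.tabulate (λ κ∈ eq → false≢true (trans (sym b) (born-boundary t e (proj₁ (at-birth e κ∈ eq)))))))
      where
      false≢true : false ≢ true
      false≢true ()

-- The trajectory of the algorithm

nth-nil : ∀ i → nth nil i ≡ nil
nth-nil zero    = refl
nth-nil (suc i) = nth-nil i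

nth-∷ʳ : ∀ ds d → nth (list (ds List.∷ʳ d)) (length ds) ≡ d
nth-∷ʳ []       d = refl
nth-∷ʳ (_ ∷ ds) d = nth-∷ʳ ds d

nth-< : ∀ ds d {i} → i < length ds → nth (list (ds List.∷ʳ d)) i ≡ nth (list ds) i
nth-< (_ ∷ _)  d {zero}  _         = refl
nth-< (_ ∷ ds) d {suc i} (s≤s i<) = nth-< ds d i<

nth-≥ : ∀ ds {i} → length ds ≤ i → nth (list ds) i ≡ nil
nth-≥ []       {i}     _        = nth-nil i
nth-≥ (_ ∷ ds) {suc i} (s≤s ≤i) = nth-≥ ds ≤i

module Trajectory {m : ℕ} (P : Instance m) where
  open Instance P using (matroid; T; a-nonneg; c-nonneg)
  open IntervalModel P using (Element; element; copy)
  open Intervals P public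

  mq : ℚ
  mq = fromℕ m

  indep : Subset m → Bool
  indep = does ∘ Matroid.independent? matroid

  open Program m mq indep public

  -- Before and after the processing of time t + 1
  mutual
    arrived final : ℕ → Curs
    arrived zero    e = fresh (Copy.cost (copy e 0))
    arrived (suc t) e = if born e (suc t) then fresh (Copy.cost (copy e (currentIndex e (suc t)))) else final t e
    final t = steps (arrived t)

  -- Ended copies, latest first, frozen in the state after their last time step.
  older : ℕ → Histories
  older zero    e = []
  older (suc t) e = if born e (suc t) then final t e ∷ older t e else older t e

  arrive-0 : ∀ e → arrive (news 0) (λ _ → []) e ≡ arrived 0 e ∷ older 0 e
  arrive-0 e = refl

  arrive-suc : ∀ t e → arrive (news (suc t)) (final t ∷ₕ older t) e ≡ arrived (suc t) e ∷ older (suc t) e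
  arrive-suc t e = go (born e (suc t)) (Copy.cost (copy e (currentIndex e (suc t)))) (final t e)
    where
    go : ∀ b q f → maybe′ (λ q → fresh q ∷ f ∷ older t e) (f ∷ older t e) (if b then just q else nothing)
         ≡ (if b then fresh q else f) ∷ (if b then f ∷ older t e else older t e)
    go true  q f = refl
    go false q f = refl

  stateᵈ outᵈ : ℕ → Data
  stateᵈ zero    = num mq
  stateᵈ (suc t) = pair (num mq) (historiesᵈ (final t ∷ₕ older t))
  outᵈ zero    = nil
  outᵈ (suc t) = outputᵈ (final t ∷ₕ older t)

  previous : ℕ → Histories
  previous zero    = λ _ → []
  previous (suc t) = final t ∷ₕ older t

  previous-arrive : ∀ t e → arrive (news t) (previous t) e ≡ arrived t e ∷ older t e
  previous-arrive zero    = arrive-0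
  previous-arrive (suc t) = arrive-suc t

  previous-state : ∀ t → stateᵈ t ≡ pair (num mq) (historiesᵈ (previous t)) ⊎ (stateᵈ t ≡ num mq × (∀ e → previous t e ≡ []))
  previous-state zero    = inj₂ (refl , λ _ → refl)
  previous-state (suc t) = inj₁ refl

  program-step : ∀ t → evalₚ Oracle program (stateᵈ t ∷ newsᵈ (news t) ∷ []) ≡ pair (stateᵈ (suc t)) (outᵈ (suc t))
  program-step t = eval-program (stateᵈ t) (previous t) (news t) (arrived t) (older t) (previous-arrive t) (previous-state t)

  x : ℕ → Element → ℚ
  x t k = value (nth (nth (outᵈ t) (toℕ (origin k))) (index k))

  out : Cur → ℚ
  out c = truncated (amount mq (Cur.lev c))

  private
    entry : List Cur → ℕ → ℚ
    entry h i = value (nth (encode (num ∘ out) (reverse h)) i)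

    encode-reverse : ∀ c h → map (num ∘ out) (reverse (c ∷ h)) ≡ map (num ∘ out) (reverse h) List.∷ʳ num (out c)
    encode-reverse c h = trans (cong (map (num ∘ out)) (List.unfold-reverse c h)) (List.map-++ (num ∘ out) (reverse h) (c ∷ []))

    length-encode : ∀ h → length (map (num ∘ out) (reverse h)) ≡ length h
    length-encode h = trans (List.length-map (num ∘ out) (reverse h)) (List.length-reverse h)

    entry-new : ∀ c h → entry (c ∷ h) (length h) ≡ out c
    entry-new c h = cong value (trans (cong₂ (λ ds i → nth (list ds) i) (encode-reverse c h) (sym (length-encode h)))
      (nth-∷ʳ (map (num ∘ out) (reverse h)) (num (out c))))

    entry-old : ∀ c h {i} → i < length h → entry (c ∷ h) i ≡ entry h i
    entry-old c h {i} i< = cong value (trans (cong (λ ds → nth (list ds) i) (encode-reverse c h))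
      (nth-< (map (num ∘ out) (reverse h)) (num (out c)) (subst (i <_) (sym (length-encode h)) i<)))

    entry-none : ∀ h {i} → length h ≤ i → entry h i ≡ 0ℚ
    entry-none h {i} ≤i = cong value (nth-≥ (map (num ∘ out) (reverse h)) (subst (_≤ i) (sym (length-encode h)) ≤i))

    length-older : ∀ t e → length (older t e) ≡ currentIndex e t
    length-older zero    e = refl
    length-older (suc t) e = go (born e (suc t))
      where
      go : ∀ b → length (if b then final t e ∷ older t e else older t e) ≡ (if b then suc (currentIndex e t) else currentIndex e t)
      go true  = cong suc (length-older t e)
      go false = length-older t e

    x-entry : ∀ t k → x (suc t) k ≡ entry (final t (origin k) ∷ older t (origin k)) (index k)
    x-entry t k = cong (λ d → value (nth d (index k)))
      (nth-encode (λ e → encode (num ∘ out) (reverse (final t e ∷ older t e))) (origin k))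

    x-0 : ∀ k → x 0 k ≡ 0ℚ
    x-0 k = cong value (trans (cong (λ d → nth d (index k)) (nth-nil (toℕ (origin k)))) (nth-nil (index k)))

  cur? : ℕ → Element → Bool
  cur? t k = does (index k ≟ currentIndex (origin k) t)

  x-current : ∀ t k → index k ≡ currentIndex (origin k) t → x (suc t) k ≡ out (final t (origin k))
  x-current t k eq = trans (x-entry t k) (trans (cong (entry (final t e ∷ older t e)) (trans eq (sym (length-older t e))))
    (entry-new (final t e) (older t e)))
    where e = origin k

  -- The output reverses the histories, so a new copy is appended at the end and entry i keeps its
  -- place.
  x-unchanged : ∀ t k → index k ≢ currentIndex (origin k) t → x (suc t) k ≡ x t k
  x-unchanged zero    k ≢0 = trans (x-entry 0 k) (trans (entry-none (final 0 (origin k) ∷ []) (n≢0⇒n>0 ≢0)) (sym (x-0 k)))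
  x-unchanged (suc t) k ≢currentIndex = trans (x-entry (suc t) k) (trans (go (i <? currentIndex e (suc t))) (sym (x-entry t k)))
    where
    e = origin k
    i = index k
    h = final t e ∷ older t e
    go : Dec (i < currentIndex e (suc t)) → entry (final (suc t) e ∷ older (suc t) e) i ≡ entry h i
    go (no i≮)  = trans (entry-none (final (suc t) e ∷ older (suc t) e) (subst (λ n → suc n ≤ i) (sym (length-older (suc t) e)) currentIndex<i))
                    (sym (entry-none h (≤-trans (s≤s (≤-trans (≤-reflexive (length-older t e)) (currentIndex-mono e t))) currentIndex<i)))
      where
      currentIndex<i : currentIndex e (suc t) < i
      currentIndex<i = ≤∧≢⇒< (≮⇒≥ i≮) (λ eq → ≢currentIndex (sym eq))
    go (yes i<) = trans (entry-old (final (suc t) e) (older (suc t) e) (subst (i <_) (sym (length-older (suc t) e)) i<)) (cases (born e (suc t)) refl)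
      where
      cases : ∀ b → born e (suc t) ≡ b → entry (if born e (suc t) then h else older t e) i ≡ entry h i
      cases true  eq = cong (λ b → entry (if b then h else older t e) i) eq
      cases false eq = trans (cong (λ b → entry (if b then h else older t e) i) eq)
        (sym (entry-old (final t e) (older t e) (subst (i <_) (sym (length-older t e)) (subst (λ b → i < (if b then suc (currentIndex e t) else currentIndex e t)) eq i<))))

  -- The state of every copy at every time, so that sums can range over all copies throughout. An
  -- unborn copy counts as fresh, which agrees with its missing output entry since `amount` is 0 at
  -- level 0; an ended copy keeps its last state.
  S : ℕ → Element → Cur
  S zero    k = fresh (Copy.cost (element k))
  S (suc t) k = if cur? t k then final t (origin k) else S t k

  S-unborn : ∀ t k → currentIndex (origin k) t < index k → S (suc t) k ≡ fresh (Copy.cost (element k))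
  S-unborn t k currentIndex< = go (does-cases (index k ≟ currentIndex (origin k) t))
    where
    go : (cur? t k ≡ true × index k ≡ currentIndex (origin k) t) ⊎ (cur? t k ≡ false × index k ≢ currentIndex (origin k) t) →
         S (suc t) k ≡ fresh (Copy.cost (element k))
    earlier : ∀ t → currentIndex (origin k) t < index k → S t k ≡ fresh (Copy.cost (element k))
    go (inj₁ (_ , eq)) = contradiction (sym eq) (<⇒≢ currentIndex<)
    go (inj₂ (eq , _)) = trans (cong (λ b → if b then final t (origin k) else S t k) eq) (earlier t currentIndex<)
    earlier zero    _   = refl
    earlier (suc t) currentIndex< = S-unborn t k (≤-<-trans (currentIndex-mono (origin k) t) currentIndex<)

  S-arrived : ∀ t k → index k ≡ currentIndex (origin k) t → S t k ≡ arrived t (origin k)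
  S-arrived zero    k eq = cong (fresh ∘ Copy.cost) (trans (element-copy k) (cong (copy (origin k)) eq))
  S-arrived (suc t) k eq = go (born (origin k) (suc t)) refl
    where
    e = origin k
    go : ∀ b → born e (suc t) ≡ b →
         S (suc t) k ≡ (if born e (suc t) then fresh (Copy.cost (copy e (currentIndex e (suc t)))) else final t e)
    go true b≡ = trans (S-unborn t k (≤-reflexive (sym (trans eq (cong (λ b → if b then suc (currentIndex e t) else currentIndex e t) b≡)))))
      (trans (cong (fresh ∘ Copy.cost) (trans (element-copy k) (cong (copy e) eq)))
        (cong (λ b → if b then fresh (Copy.cost (copy e (currentIndex e (suc t)))) else final t e) (sym b≡)))
    go false b≡ = trans
      (cong (λ b → if b then final t e else S t k)
        (true-does (index k ≟ currentIndex e t) (trans eq (cong (λ b → if b then suc (currentIndex e t) else currentIndex e t) b≡))))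
      (cong (λ b → if b then fresh (Copy.cost (copy e (currentIndex e (suc t)))) else final t e) (sym b≡))

  x-S : ∀ t k → x t k ≡ out (S t k)
  x-S zero    k = x-0 k
  x-S (suc t) k = go (does-cases (index k ≟ currentIndex (origin k) t))
    where
    go : (cur? t k ≡ true × index k ≡ currentIndex (origin k) t) ⊎ (cur? t k ≡ false × index k ≢ currentIndex (origin k) t) →
         x (suc t) k ≡ out (S (suc t) k)
    go (inj₁ (eq , i≡)) = trans (x-current t k i≡) (cong (λ b → out (if b then final t (origin k) else S t k)) (sym eq))
    go (inj₂ (eq , i≢)) = trans (x-unchanged t k i≢) (trans (x-S t k) (cong (λ b → out (if b then final t (origin k) else S t k)) (sym eq)))

-- Feasibility of the solution

amount-capacity : ∀ q l → amount q l ≡ fromℕ (2 * capacity l) ℚ.* inverse q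
amount-capacity q zero          = sym (ℚ.*-zeroˡ (inverse q))
amount-capacity q (suc zero)    = refl
amount-capacity q (suc (suc i)) = trans (cong (fromℕ 2 ℚ.*_) (amount-capacity q (suc i)))
  (trans (sym (ℚ.*-assoc (fromℕ 2) (fromℕ (2 * 2 ^ i)) (inverse q))) (cong (ℚ._* inverse q) (sym (fromℕ-* 2 (2 * 2 ^ i)))))

capacity-mono : ∀ {k l} → k ≤ l → capacity k ≤ capacity l
capacity-mono {zero}          _         = z≤n
capacity-mono {suc k} {suc l} (s≤s k≤l) = ^-monoʳ-≤ 2 k≤l

truncated-mono : ∀ {p q} → p ℚ.≤ q → truncated p ℚ.≤ truncated q
truncated-mono {p} {q} p≤q with ≤?-cases p 1ℚ | ≤?-cases q 1ℚ
... | inj₁ (eq , _)   | inj₁ (eq′ , _) rewrite eq | eq′ = p≤q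
... | inj₁ (eq , p≤1) | inj₂ (eq′ , _) rewrite eq | eq′ = p≤1
... | inj₂ (eq , 1≤p) | inj₁ (eq′ , q≤1) rewrite eq | eq′ = ℚ.≤-trans 1≤p p≤q
... | inj₂ (eq , _)   | inj₂ (eq′ , _) rewrite eq | eq′ = ℚ.≤-refl

truncated-≤1 : ∀ p → truncated p ℚ.≤ 1ℚ
truncated-≤1 p with ≤?-cases p 1ℚ
... | inj₁ (eq , p≤1) rewrite eq = p≤1
... | inj₂ (eq , _)   rewrite eq = ℚ.≤-refl

truncated-≤id : ∀ p → truncated p ℚ.≤ p
truncated-≤id p with ≤?-cases p 1ℚ
... | inj₁ (eq , _)   rewrite eq = ℚ.≤-refl
... | inj₂ (eq , 1≤p) rewrite eq = 1≤p

true≢false : true ≢ false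
true≢false ()

dens : Data → ℕ
dens nil        = 1
dens (num q)    = ↧ₙ q
dens (pair d e) = dens d * dens e

integral-self : ∀ q → Integral (↧ₙ q) q
integral-self q@record{} = ↥ q , ℚ.toℚᵘ-injective (begin
  ℚ.toℚᵘ (q ℚ.* fromℕ (↧ₙ q))                    ≈⟨ ℚ.toℚᵘ-homo-* q (fromℕ (↧ₙ q)) ⟩
  ℚ.toℚᵘ q ℚᵘ.* ℚ.toℚᵘ (fromℕ (↧ₙ q))            ≈⟨ ℚᵘ.*-congˡ {ℚ.toℚᵘ q} (ℚ.toℚᵘ-fromℚᵘ (ℚᵘ.mkℚᵘ (ℤ.+ ↧ₙ q) 0)) ⟩
  ℚ.toℚᵘ q ℚᵘ.* ℚᵘ.mkℚᵘ (ℤ.+ ↧ₙ q) 0             ≈⟨ ℚᵘ.*≡* (cross (↥ q) (↧ q) (ℤ.+ (↧ₙ q * 1)) (cong ℤ.+_ (*-identityʳ (↧ₙ q)))) ⟩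
  ℚᵘ.mkℚᵘ (↥ q) 0                                ≈⟨ ℚᵘ.≃-sym (ℚ.toℚᵘ-fromℚᵘ (ℚᵘ.mkℚᵘ (↥ q) 0)) ⟩
  ℚ.toℚᵘ (int (↥ q))                             ∎)
  where
  open ℚᵘ.≃-Reasoning
  cross : ∀ n d e → e ≡ d → n ℤ.* d ℤ.* ℤ.+ 1 ≡ n ℤ.* e
  cross n d e refl = ℤ.*-identityʳ (n ℤ.* d)

integral-dens : ∀ {A : Set} (f : A → Data) {x q} xs → x ∈ xs → f x ≡ num q → Integral (dens (encode f xs)) q
integral-dens f {x} {q} (y ∷ xs) (here refl) eq rewrite eq =
  subst (λ D → Integral D q) (*-comm (dens (encode f xs)) (↧ₙ q)) (integral-scale {↧ₙ q} {q} (dens (encode f xs)) (integral-self q))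
integral-dens f {x} {q} (y ∷ xs) (there x∈) eq = integral-scale {dens (encode f xs)} {q} (dens (f y)) (integral-dens f xs x∈ eq)

fresh-good : ∀ m D q → 0ℚ ℚ.≤ q → Integral D q → Good m D (cur q q 0)
fresh-good m D q 0≤q int = record
  { 0≤ρ = 0≤q ; ρ≤a = ℚ.≤-refl
  ; load≤ = ℚ.≤-trans (ℚ.≤-reflexive (trans (cong₂ ℚ._+_ (ℚ.*-zeroʳ q) (ℚ.+-inverseʳ q)) (ℚ.+-identityʳ 0ℚ)))
                      (*-nonneg 0≤q (0≤fromℕ (Λ m)))
  ; lev≤ = z≤n ; capacity≤ = z≤n ; a-int = int ; ρ-int = int }

scale-good : ∀ {m D c} k → Good m D c → Good m (k * D) c
scale-good {m} {D} {c} k g = record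
  { 0≤ρ = 0≤ρ ; ρ≤a = ρ≤a ; load≤ = load≤ ; lev≤ = lev≤ ; capacity≤ = capacity≤
  ; a-int = integral-scale {D} {Cur.a c} k a-int ; ρ-int = integral-scale {D} {Cur.ρ c} k ρ-int }
  where open Good g

module Analysis {m : ℕ} (P : Instance m) (1≤m : 1 ≤ m) where
  open Instance P using (matroid; T; a-nonneg; c-nonneg)
  open IntervalModel P using (Element; element; copy; Alive; FeasibleUpTo; Feasible; cost)
  open Trajectory P hiding (⟨_⟩)
  open Improvement m mq indep 1≤m
  open PackingAnalysis m mq indep 1≤m using (pack-[]; N; count; count-bound; count≤)

  -- A common denominator of all costs announced so far. As a product over the messages, it has no
  -- more bits than the input received.
  D : ℕ → ℕ
  D zero    = dens (newsᵈ (news 0))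
  D (suc t) = dens (newsᵈ (news (suc t))) * D t

  cost-nonneg : ∀ e i → 0ℚ ℚ.≤ Copy.cost (copy e i)
  cost-nonneg e i = ℚ.+-mono-≤ (a-nonneg e) (c-nonneg _ e)

  cost-integral : ∀ t e → born e t ≡ true → Integral (dens (newsᵈ (news t))) (Copy.cost (copy e (currentIndex e t)))
  cost-integral t e eq = integral-dens (maybeᵈ ∘ news t) (allFin m) (∈-allFin e)
    (cong (λ b → maybeᵈ (if b then just (Copy.cost (copy e (currentIndex e t))) else nothing)) eq)

  AllGood : ℕ → Curs → Set
  AllGood t cs = ∀ e → Good m (D t) (cs e)

  steps-good : ∀ {t cs} n → AllGood t cs → AllGood t (repeat n step cs)
  steps-good {t} n = steps-inv {AllGood t} (λ imp g → improved-good imp g) n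

  arrived-good : ∀ t → AllGood t (arrived t)
  final-good : ∀ t → AllGood t (final t)
  final-good t = subst (AllGood t) (sym (steps≡ (arrived t))) (steps-good {t} (suc V) (arrived-good t))
  arrived-good zero    e = fresh-good m (D 0) _ (cost-nonneg e 0) (cost-integral 0 e refl)
  arrived-good (suc t) e = go (born e (suc t)) refl
    where
    q : ℚ
    q = Copy.cost (copy e (currentIndex e (suc t)))
    go : ∀ b → born e (suc t) ≡ b → Good m (D (suc t)) (if b then fresh q else final t e)
    go true  eq = fresh-good m (D (suc t)) q (cost-nonneg e (currentIndex e (suc t)))
      (subst (λ D → Integral D q) (*-comm (D t) (dens (newsᵈ (news (suc t)))))
        (integral-scale {dens (newsᵈ (news (suc t)))} {q} (D t) (cost-integral (suc t) e eq)))
    go false eq = scale-good (dens (newsᵈ (news (suc t)))) (final-good t e)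

  arrived-lev : ∀ t e → Cur.lev (arrived t e) ≤ Cur.lev (final t e)
  arrived-lev t = subst LevelsRaised (sym (steps≡ (arrived t)))
    (steps-inv {LevelsRaised} (λ imp lev≤ e → ≤-trans (lev≤ e) (improved-lev imp e)) (suc V) (λ _ → ≤-refl))
    where
    LevelsRaised : Curs → Set
    LevelsRaised cs = ∀ e → Cur.lev (arrived t e) ≤ Cur.lev (cs e)

  arrived-a : ∀ t e → Cur.a (final t e) ≡ Cur.a (arrived t e)
  arrived-a t = subst SameCosts (sym (steps≡ (arrived t)))
    (steps-inv {SameCosts} (λ imp a≡ e → trans (improved-a imp e) (a≡ e)) (suc V) (λ _ → refl))
    where
    SameCosts : Curs → Set
    SameCosts cs = ∀ e → Cur.a (cs e) ≡ Cur.a (arrived t e)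

  final-packed : ∀ t → proj₁ (pack (final t)) ≡ []
  final-packed t = subst (λ cs → proj₁ (pack cs) ≡ []) (sym (steps≡ (arrived t))) (steps-packed (arrived-good t))

  0≤inv : 0ℚ ℚ.≤ inverse mq
  0≤inv = 0≤inverse m 1≤m

  amount-mono : ∀ {k l} → k ≤ l → amount mq k ℚ.≤ amount mq l
  amount-mono {k} {l} k≤l = subst₂ ℚ._≤_ (sym (amount-capacity mq k)) (sym (amount-capacity mq l))
    (ℚ.*-monoʳ-≤-nonNeg (inverse mq) {{ℚ.nonNegative 0≤inv}} (fromℕ-≤ (*-monoʳ-≤ 2 (capacity-mono k≤l))))

  out-mono : ∀ {c d} → Cur.lev c ≤ Cur.lev d → out c ℚ.≤ out d
  out-mono {c} {d} le = truncated-mono (amount-mono le)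

  raising : ∀ t k → x t k ℚ.≤ x (suc t) k
  raising t k = subst₂ ℚ._≤_ (sym (x-S t k)) (sym (x-S (suc t) k)) (go (does-cases (index k ≟ currentIndex (origin k) t)))
    where
    go : (cur? t k ≡ true × index k ≡ currentIndex (origin k) t) ⊎ (cur? t k ≡ false × index k ≢ currentIndex (origin k) t) →
         out (S t k) ℚ.≤ out (S (suc t) k)
    go (inj₁ (eq , i≡)) = subst₂ (λ c d → out c ℚ.≤ out d) (sym (S-arrived t k i≡))
      (cong (λ b → if b then final t (origin k) else S t k) (sym eq)) (out-mono {arrived t (origin k)} {final t (origin k)} (arrived-lev t (origin k)))
    go (inj₂ (eq , _)) = ℚ.≤-reflexive (cong (λ b → out (if b then final t (origin k) else S t k)) (sym eq))

  x-mono : ∀ {s t} → s ≤ t → ∀ k → x s k ℚ.≤ x t k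
  x-mono {s} {zero}  z≤n k = ℚ.≤-refl
  x-mono {s} {suc t} s≤t k with m≤n⇒m<n∨m≡n s≤t
  ... | inj₂ refl       = ℚ.≤-refl
  ... | inj₁ (s≤s s≤t′) = ℚ.≤-trans (x-mono s≤t′ k) (raising t k)

  module At {t : ℕ} (t<T : t < T) where
    open Lift mq matroid 1≤m origin (currentCopy t<T) (origin-currentCopy t<T) public
      using (current?; ∑-current; cover; average; average-0≤; average-base; average-off; average-currentCopy; average-≤1; truncated-≤)

    current⁺ : ∀ {k} → index k ≡ currentIndex (origin k) t → current? k ≡ true
    current⁺ {k} eq = true-does (k Fin.≟ currentCopy t<T (origin k)) (currentCopy-unique t<T k eq)

    current⁻ : ∀ {k} → current? k ≡ true → index k ≡ currentIndex (origin k) t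
    current⁻ {k} eq = trans (cong index (does-true (k Fin.≟ currentCopy t<T (origin k)) eq)) (index-currentCopy t<T (origin k))

    off⇒dead : ∀ {k} → current? k ≡ false → ¬ Alive k (suc t)
    off⇒dead {k} eq alive = true≢false (trans (sym (current⁺ (alive⇒index {t} {k} alive))) eq)

    dead⇒off : ∀ {k} → ¬ Alive k (suc t) → current? k ≡ false
    dead⇒off {k} dead = go (current? k) refl
      where
      go : ∀ b → current? k ≡ b → b ≡ false
      go false _  = refl
      go true  eq = contradiction (index⇒alive {t} {k} (current⁻ eq)) dead

    z : Element → ℚ
    z = average (final t) (pack-[] (final t) (final-packed t))

    -- An unsaturated copy is used in at most 2m * k of the m * m rounds, a share of 2k / m, which
    -- is `amount`. For a saturated copy `amount` is at least 1, and a share never exceeds 1.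
    z≤x : ∀ k → Alive k (suc t) → z k ℚ.≤ x (suc t) k
    z≤x k alive = subst₂ ℚ._≤_ (cong z (sym k≡)) (sym (x-current t k i≡))
      (truncated-≤ (amount mq l) (average-≤1 (final t) quiet (currentCopy t<T e)) (bound (capacity l <? M)))
      where
      e = origin k
      i≡ : index k ≡ currentIndex e t
      i≡ = alive⇒index {t} {k} alive
      k≡ : k ≡ currentCopy t<T e
      k≡ = currentCopy-unique t<T k i≡
      quiet = pack-[] (final t) (final-packed t)
      l = Cur.lev (final t e)
      ν = inverse (fromℕ N)
      1≤N : 1 ≤ N
      1≤N = *-mono-≤ 1≤m 1≤m
      νm : ν ℚ.* mq ≡ inverse mq
      νm = begin
        ν ℚ.* mq                                    ≡⟨ sym (ℚ.*-identityʳ (ν ℚ.* mq)) ⟩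
        ν ℚ.* mq ℚ.* 1ℚ                             ≡⟨ cong (ν ℚ.* mq ℚ.*_) (sym (inverse-fromℕ m 1≤m)) ⟩
        ν ℚ.* mq ℚ.* (mq ℚ.* inverse mq)            ≡⟨ rearrange ν mq (inverse mq) ⟩
        mq ℚ.* mq ℚ.* ν ℚ.* inverse mq              ≡⟨ cong (λ h → h ℚ.* ν ℚ.* inverse mq) (sym (fromℕ-* m m)) ⟩
        fromℕ N ℚ.* ν ℚ.* inverse mq                ≡⟨ cong (ℚ._* inverse mq) (inverse-fromℕ N 1≤N) ⟩
        1ℚ ℚ.* inverse mq                           ≡⟨ ℚ.*-identityˡ (inverse mq) ⟩
        inverse mq                                  ∎
        where
        open ≡-Reasoning
        rearrange : ∀ n q i → n ℚ.* q ℚ.* (q ℚ.* i) ≡ q ℚ.* q ℚ.* n ℚ.* i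
        rearrange = Ring.solve-∀ ℚ-ring
      bound : Dec (capacity l < M) → z (currentCopy t<T e) ℚ.≤ amount mq l ⊎ 1ℚ ℚ.≤ amount mq l
      bound (yes k<M) = inj₁ (begin
        z (currentCopy t<T e)                                ≡⟨ average-currentCopy (final t) quiet e ⟩
        ν ℚ.* fromℕ (count (loads (final t)) N e)   ≤⟨ *-monoˡ (0≤inverse N 1≤N) (fromℕ-≤ (count-bound (final t) quiet e k<M)) ⟩
        ν ℚ.* fromℕ ((m + m) * capacity l)                ≡⟨ cong (λ n → ν ℚ.* fromℕ n) (regroup m (capacity l)) ⟩
        ν ℚ.* fromℕ (m * (2 * capacity l))                ≡⟨ trans (cong (ν ℚ.*_) (fromℕ-* m (2 * capacity l))) (sym (ℚ.*-assoc ν mq (fromℕ (2 * capacity l)))) ⟩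
        ν ℚ.* mq ℚ.* fromℕ (2 * capacity l)               ≡⟨ trans (cong (ℚ._* fromℕ (2 * capacity l)) νm) (ℚ.*-comm (inverse mq) _) ⟩
        fromℕ (2 * capacity l) ℚ.* inverse mq             ≡⟨ sym (amount-capacity mq l) ⟩
        amount mq l                                     ∎)
        where
        open ℚ.≤-Reasoning
        regroup : ∀ m k → (m + m) * k ≡ m * (2 * k)
        regroup = solve-∀
      bound (no k≮M) = inj₂ (begin
        1ℚ                                          ≡⟨ sym (inverse-fromℕ m 1≤m) ⟩
        mq ℚ.* inverse mq                           ≤⟨ ℚ.*-monoʳ-≤-nonNeg (inverse mq) {{ℚ.nonNegative 0≤inv}}
                                                         (fromℕ-≤ (≤-trans (m≤m+n m m) (≤-trans (≮⇒≥ k≮M) (m≤m+n (capacity l) _)))) ⟩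
        fromℕ (2 * capacity l) ℚ.* inverse mq             ≡⟨ sym (amount-capacity mq l) ⟩
        amount mq l                                     ∎)
        where open ℚ.≤-Reasoning

  private
    zAt : ∀ {s} → Dec (s < T) → Element → ℚ
    zAt (yes s<T) k = At.z s<T k
    zAt (no _)    k = 0ℚ

  -- The point for a time step is fixed when that step is processed. It stays below x because x only
  -- rises, so a single z serves all later times.
  solution : Element → ℕ → ℚ
  solution k zero    = 0ℚ
  solution k (suc s) = zAt (s <? T) k

  feasible : ∀ t → t ≤ T → FeasibleUpTo t (x t) solution
  feasible t t≤T = record
    { base = λ { (suc s) _ s<t → base (s <? T) (≤-trans s<t t≤T) }
    ; z≤x  = λ { k (suc s) _ s<t alive → below (s <? T) (≤-trans s<t t≤T) s<t alive }
    ; z≡0  = λ { k (suc s) _ s<t dead → off (s <? T) (≤-trans s<t t≤T) dead }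
    ; 0≤x  = λ k → ℚ.≤-trans (ℚ.≤-reflexive (sym (cong value (trans (cong (λ d → nth d (index k)) (nth-nil (toℕ (origin k)))) (nth-nil (index k)))))) (x-mono {0} {t} z≤n k)
    ; x≤1  = λ k → subst (ℚ._≤ 1ℚ) (sym (x-S t k)) (truncated-≤1 (amount mq (Cur.lev (S t k))))
    ; 0≤z  = λ { k (suc s) _ s<t → 0≤z (s <? T) (≤-trans s<t t≤T) }
    ; z≤1  = λ { k (suc s) _ s<t → z≤1 (s <? T) (≤-trans s<t t≤T) }
    }
    where
    base : ∀ {s} (d : Dec (s < T)) → s < T → zAt d ∈P IntervalModel.𝓜 P
    base {s} (yes s<T) _ = At.average-base s<T (final s) (pack-[] (final s) (final-packed s))
    base (no s≮T) s<T = contradiction s<T s≮T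
    below : ∀ {s k} (d : Dec (s < T)) → s < T → s < t → Alive k (suc s) → zAt d k ℚ.≤ x t k
    below {s} {k} (yes s<T) _ s<t alive = ℚ.≤-trans (At.z≤x s<T k alive) (x-mono s<t k)
    below (no s≮T) s<T _ _ = contradiction s<T s≮T
    off : ∀ {s k} (d : Dec (s < T)) → s < T → ¬ Alive k (suc s) → zAt d k ≡ 0ℚ
    off {s} {k} (yes s<T) _ dead = At.average-off s<T (final s) (pack-[] (final s) (final-packed s)) k (At.dead⇒off s<T dead)
    off (no s≮T) s<T _ = contradiction s<T s≮T
    0≤z : ∀ {s k} (d : Dec (s < T)) → s < T → 0ℚ ℚ.≤ zAt d k
    0≤z {s} {k} (yes s<T) _ = At.average-0≤ s<T (final s) (pack-[] (final s) (final-packed s)) k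
    0≤z (no s≮T) s<T = contradiction s<T s≮T
    z≤1 : ∀ {s k} (d : Dec (s < T)) → s < T → zAt d k ℚ.≤ 1ℚ
    z≤1 {s} {k} (yes s<T) _ = At.average-≤1 s<T (final s) (pack-[] (final s) (final-packed s)) k
    z≤1 (no s≮T) s<T = contradiction s<T s≮T

-- Competitive ratio

gap-fresh : ∀ μ ξ q → gap μ ξ (cur q q 0) ≡ 0ℚ
gap-fresh = identity
  where
  identity : ∀ μ ξ q → μ ℚ.* (q ℚ.* 0ℚ ℚ.+ (q ℚ.+ ℚ.- q)) ℚ.* ξ ℚ.+ ℚ.- (q ℚ.* 0ℚ ℚ.+ (q ℚ.+ ℚ.- q) ℚ.* 1ℚ) ≡ 0ℚ
  identity = Ring.solve-∀ ℚ-ring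

module Competitive {m : ℕ} (P : Instance m) (1≤m : 1 ≤ m) where
  open Instance P using (matroid; T; a-nonneg; c-nonneg)
  open IntervalModel P using (Element; element; copy; Alive; FeasibleUpTo; Feasible; cost)
  open Trajectory P hiding (⟨_⟩)
  open Improvement m mq indep 1≤m using (Covers; Improved; improved-gap; improved-good; steps-inv)
  open Analysis P 1≤m

  S-a : ∀ t k → Cur.a (S t k) ≡ Copy.cost (element k)
  S-a zero    k = refl
  S-a (suc t) k = go (does-cases (index k ≟ currentIndex (origin k) t))
    where
    go : (cur? t k ≡ true × index k ≡ currentIndex (origin k) t) ⊎ (cur? t k ≡ false × index k ≢ currentIndex (origin k) t) →
         Cur.a (S (suc t) k) ≡ Copy.cost (element k)
    go (inj₁ (eq , i≡)) = trans (cong (λ b → Cur.a (if b then final t (origin k) else S t k)) eq)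
      (trans (arrived-a t (origin k)) (trans (cong Cur.a (sym (S-arrived t k i≡))) (S-a t k)))
    go (inj₂ (eq , _)) = trans (cong (λ b → Cur.a (if b then final t (origin k) else S t k)) eq) (S-a t k)

  -- The part of `Good` that makes sense for unborn copies as well: their costs have not been
  -- announced and need not be integral over `D t`.
  record Sound (c : Cur) : Set where
    field
      0≤ρ   : 0ℚ ℚ.≤ Cur.ρ c
      ρ≤a   : Cur.ρ c ℚ.≤ Cur.a c
      load≤ : dualLoad c ℚ.≤ Cur.a c ℚ.* fromℕ (Λ m)

  good⇒sound : ∀ {D c} → Good m D c → Sound c
  good⇒sound g = record { 0≤ρ = Good.0≤ρ g ; ρ≤a = Good.ρ≤a g ; load≤ = Good.load≤ g }

  cost≥0 : ∀ k → 0ℚ ℚ.≤ Copy.cost (element k)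
  cost≥0 k = subst (λ κ → 0ℚ ℚ.≤ Copy.cost κ) (sym (element-copy k)) (cost-nonneg (origin k) (index k))

  S-sound : ∀ t k → Sound (S t k)
  S-sound zero    k = good⇒sound (fresh-good m (↧ₙ q) q (cost≥0 k) (integral-self q))
    where
    q : ℚ
    q = Copy.cost (element k)
  S-sound (suc t) k = go (cur? t k)
    where
    go : ∀ b → Sound (if b then final t (origin k) else S t k)
    go true  = good⇒sound (final-good t (origin k))
    go false = S-sound t k

  module _ (x* : Element → ℚ) (z* : Element → ℕ → ℚ) (feasible* : Feasible x* z*) where
    open FeasibleUpTo feasible*

    μ : ℚ
    μ = fromℕ (M + M)

    covers : ∀ {t} (t<T : t < T) → Covers (λ e → x* (currentCopy t<T e))
    covers {t} t<T w v v≤V = ℚ.≤-trans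
      (At.cover t<T w v≤V (λ k → z* k (suc t)) (base (suc t) (s≤s z≤n) t<T)
        (λ k off → z≡0 k (suc t) (s≤s z≤n) t<T (At.off⇒dead t<T {k} off)))
      (∑-mono (λ e → go (above? w v e) e))
      where
      go : ∀ b e → (if b then z* (currentCopy t<T e) (suc t) else 0ℚ) ℚ.≤ (if b then x* (currentCopy t<T e) else 0ℚ)
      go true  e = FeasibleUpTo.z≤x feasible* (currentCopy t<T e) (suc t) (s≤s z≤n) t<T (index⇒alive {t} {currentCopy t<T e} (trans (index-currentCopy t<T e) (cong (λ e → currentIndex e t) (sym (origin-currentCopy t<T e)))))
      go false e = ℚ.≤-refl

    gaps : ℕ → ℚ
    gaps t = ∑ (λ k → gap μ (x* k) (S t k))

    final-gap : ∀ {t} (t<T : t < T) →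
                ∑ (λ e → gap μ (x* (currentCopy t<T e)) (arrived t e)) ℚ.≤ ∑ (λ e → gap μ (x* (currentCopy t<T e)) (final t e))
    final-gap {t} t<T = proj₂ (subst Q (sym (steps≡ (arrived t))) (steps-inv {Q} preserve (suc V) (arrived-good t , ℚ.≤-refl)))
      where
      Q : Curs → Set
      Q cs = AllGood t cs × ∑ (λ e → gap μ (x* (currentCopy t<T e)) (arrived t e)) ℚ.≤ ∑ (λ e → gap μ (x* (currentCopy t<T e)) (cs e))
      preserve : ∀ {cs cs′} → Improved cs cs′ → Q cs → Q cs′
      preserve imp (good , le) = improved-good imp good ,
        ℚ.≤-trans le (improved-gap imp (λ e → x* (currentCopy t<T e)) (covers t<T) (λ e → Good.0≤ρ (good e)))

    -- A time step changes only the current copies, so the change of the sum over all copies equals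
    -- that of the sum over E, to which `final-gap` applies.
    gaps-mono : ∀ {t} → t < T → gaps t ℚ.≤ gaps (suc t)
    gaps-mono {t} t<T = 0≤q-p⇒p≤q (subst (0ℚ ℚ.≤_) (sym change) (p≤q⇒0≤q-p (final-gap t<T)))
      where
      open ≡-Reasoning
      new old : Element → ℚ
      new k = gap μ (x* k) (S (suc t) k)
      old k = gap μ (x* k) (S t k)
      ∑-difference : ∀ {n} (f g : Fin n → ℚ) → ∑ (λ i → f i ℚ.- g i) ≡ ∑ f ℚ.- ∑ g
      ∑-difference f g = trans (∑-+ f (λ i → ℚ.- g i)) (cong (∑ f ℚ.+_) (∑-neg g))
      off : ∀ k → At.current? t<T k ≡ false → new k ℚ.- old k ≡ 0ℚ
      off k eq = go (does-cases (index k ≟ currentIndex (origin k) t))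
        where
        go : (cur? t k ≡ true × index k ≡ currentIndex (origin k) t) ⊎ (cur? t k ≡ false × index k ≢ currentIndex (origin k) t) →
             new k ℚ.- old k ≡ 0ℚ
        go (inj₁ (_ , i≡)) = contradiction (trans (sym (At.current⁺ t<T {k} i≡)) eq) true≢false
        go (inj₂ (c≡ , _)) = trans (cong (λ b → gap μ (x* k) (if b then final t (origin k) else S t k) ℚ.- old k) c≡) (ℚ.+-inverseʳ (old k))
      on : ∀ e → new (currentCopy t<T e) ℚ.- old (currentCopy t<T e) ≡ gap μ (x* (currentCopy t<T e)) (final t e) ℚ.- gap μ (x* (currentCopy t<T e)) (arrived t e)
      on e = cong₂ (λ c d → gap μ (x* (currentCopy t<T e)) c ℚ.- gap μ (x* (currentCopy t<T e)) d)
        (trans (cong (λ b → if b then final t (origin (currentCopy t<T e)) else S t (currentCopy t<T e)) (true-does (index (currentCopy t<T e) ≟ currentIndex (origin (currentCopy t<T e)) t) i≡))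
          (cong (final t) (origin-currentCopy t<T e)))
        (trans (S-arrived t (currentCopy t<T e) i≡) (cong (arrived t) (origin-currentCopy t<T e)))
        where
        i≡ : index (currentCopy t<T e) ≡ currentIndex (origin (currentCopy t<T e)) t
        i≡ = trans (index-currentCopy t<T e) (cong (λ e → currentIndex e t) (sym (origin-currentCopy t<T e)))
      change : gaps (suc t) ℚ.- gaps t
               ≡ ∑ (λ e → gap μ (x* (currentCopy t<T e)) (final t e)) ℚ.- ∑ (λ e → gap μ (x* (currentCopy t<T e)) (arrived t e))
      change = begin
        ∑ new ℚ.- ∑ old                                               ≡⟨ sym (∑-difference new old) ⟩
        ∑ (λ k → new k ℚ.- old k)                                     ≡⟨ At.∑-current t<T (λ k → new k ℚ.- old k) off ⟩
        ∑ (λ e → new (currentCopy t<T e) ℚ.- old (currentCopy t<T e))                   ≡⟨ ∑-cong on ⟩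
        ∑ (λ e → gap μ (x* (currentCopy t<T e)) (final t e) ℚ.- gap μ (x* (currentCopy t<T e)) (arrived t e))
                                                                      ≡⟨ ∑-difference (λ e → gap μ (x* (currentCopy t<T e)) (final t e)) (λ e → gap μ (x* (currentCopy t<T e)) (arrived t e)) ⟩
        ∑ (λ e → gap μ (x* (currentCopy t<T e)) (final t e)) ℚ.- ∑ (λ e → gap μ (x* (currentCopy t<T e)) (arrived t e)) ∎

    gaps≥0 : ∀ t → t ≤ T → 0ℚ ℚ.≤ gaps t
    gaps≥0 zero    _   = ℚ.≤-reflexive (sym (trans (∑-cong (λ k → gap-fresh μ (x* k) (Copy.cost (element k)))) (∑-zero (length (IntervalModel.copies P)))))
    gaps≥0 (suc t) t<T = ℚ.≤-trans (gaps≥0 t (<⇒≤ t<T)) (gaps-mono t<T)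

    private
      ι κ : ℚ
      ι = inverse mq
      κ = fromℕ 2 ℚ.* ι

    x-cost : ∀ k → Copy.cost (element k) ℚ.* x T k ℚ.≤ κ ℚ.* Φ (S T k)
    x-cost k = begin
      Copy.cost (element k) ℚ.* x T k               ≡⟨ cong₂ ℚ._*_ (sym (S-a T k)) (x-S T k) ⟩
      a ℚ.* truncated (amount mq lev)                   ≤⟨ *-monoˡ 0≤a (truncated-≤id (amount mq lev)) ⟩
      a ℚ.* amount mq lev                               ≡⟨ cong (a ℚ.*_) (trans (amount-capacity mq lev) (cong (ℚ._* ι) (fromℕ-* 2 (capacity lev)))) ⟩
      a ℚ.* (fromℕ 2 ℚ.* fromℕ (capacity lev) ℚ.* ι)      ≡⟨ rearrange a (fromℕ 2) (fromℕ (capacity lev)) ι ⟩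
      κ ℚ.* (a ℚ.* fromℕ (capacity lev))                  ≤⟨ *-monoˡ (*-nonneg (0≤fromℕ 2) 0≤inv) (ℚ.≤-trans (ℚ.≤-reflexive (sym (ℚ.+-identityʳ _)))
                                                         (ℚ.+-monoʳ-≤ (a ℚ.* fromℕ (capacity lev)) (*-nonneg (p≤q⇒0≤q-p ρ≤a) (0≤fromℕ (increment lev))))) ⟩
      κ ℚ.* Φ (S T k)                               ∎
      where
      open ℚ.≤-Reasoning
      open Cur (S T k)
      open Sound (S-sound T k)
      0≤a : 0ℚ ℚ.≤ a
      0≤a = ℚ.≤-trans 0≤ρ ρ≤a
      rearrange : ∀ a b k i → a ℚ.* (b ℚ.* k ℚ.* i) ≡ b ℚ.* i ℚ.* (a ℚ.* k)
      rearrange = Ring.solve-∀ ℚ-ring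

    -- Nonnegativity of `gaps` bounds the primal by the dual loads weighted with `x*`, and each load
    -- is at most Λ times the cost of its copy.
    Φ-sum : ∑ (λ k → Φ (S T k)) ℚ.≤ μ ℚ.* fromℕ (Λ m) ℚ.* cost x*
    Φ-sum = begin
      ∑ (λ k → Φ (S T k))
        ≤⟨ 0≤q-p⇒p≤q (subst (0ℚ ℚ.≤_) (trans (∑-+ (λ k → μ ℚ.* dualLoad (S T k) ℚ.* x* k) (λ k → ℚ.- Φ (S T k)))
             (cong (∑ (λ k → μ ℚ.* dualLoad (S T k) ℚ.* x* k) ℚ.+_) (∑-neg (λ k → Φ (S T k))))) (gaps≥0 T ≤-refl)) ⟩
      ∑ (λ k → μ ℚ.* dualLoad (S T k) ℚ.* x* k)
        ≤⟨ ∑-mono term ⟩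
      ∑ (λ k → μ ℚ.* fromℕ (Λ m) ℚ.* (Copy.cost (element k) ℚ.* x* k))
        ≡⟨ ∑-* (μ ℚ.* fromℕ (Λ m)) (λ k → Copy.cost (element k) ℚ.* x* k) ⟩
      μ ℚ.* fromℕ (Λ m) ℚ.* cost x* ∎
      where
      open ℚ.≤-Reasoning
      rearrange₁ : ∀ u w y → u ℚ.* w ℚ.* y ≡ u ℚ.* (y ℚ.* w)
      rearrange₁ = Ring.solve-∀ ℚ-ring
      rearrange₂ : ∀ u a l y → u ℚ.* (y ℚ.* (a ℚ.* l)) ≡ u ℚ.* l ℚ.* (a ℚ.* y)
      rearrange₂ = Ring.solve-∀ ℚ-ring
      term : ∀ k → μ ℚ.* dualLoad (S T k) ℚ.* x* k ℚ.≤ μ ℚ.* fromℕ (Λ m) ℚ.* (Copy.cost (element k) ℚ.* x* k)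
      term k = begin
        μ ℚ.* dualLoad (S T k) ℚ.* x* k                        ≡⟨ rearrange₁ μ (dualLoad (S T k)) (x* k) ⟩
        μ ℚ.* (x* k ℚ.* dualLoad (S T k))                      ≤⟨ *-monoˡ (0≤fromℕ (M + M)) (*-monoˡ (0≤x k) (Sound.load≤ (S-sound T k))) ⟩
        μ ℚ.* (x* k ℚ.* (Cur.a (S T k) ℚ.* fromℕ (Λ m)))       ≡⟨ cong (λ a → μ ℚ.* (x* k ℚ.* (a ℚ.* fromℕ (Λ m)))) (S-a T k) ⟩
        μ ℚ.* (x* k ℚ.* (Copy.cost (element k) ℚ.* fromℕ (Λ m))) ≡⟨ rearrange₂ μ (Copy.cost (element k)) (fromℕ (Λ m)) (x* k) ⟩
        μ ℚ.* fromℕ (Λ m) ℚ.* (Copy.cost (element k) ℚ.* x* k) ∎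

    1≤log : 1 ≤ log m
    1≤log = ≤-trans (≤-reflexive (sym (⌈log₂2^n⌉≡n 1))) (⌈log₂⌉-mono-≤ (s≤s 1≤m))

    competitive : cost (x T) ℚ.≤ fromℕ (24 * log m) ℚ.* cost x*
    competitive = begin
      cost (x T)                                            ≤⟨ ∑-mono x-cost ⟩
      ∑ (λ k → κ ℚ.* Φ (S T k))                             ≡⟨ ∑-* κ (λ k → Φ (S T k)) ⟩
      κ ℚ.* ∑ (λ k → Φ (S T k))                             ≤⟨ *-monoˡ (*-nonneg (0≤fromℕ 2) 0≤inv) Φ-sum ⟩
      κ ℚ.* (μ ℚ.* fromℕ (Λ m) ℚ.* cost x*)                 ≡⟨ cong (λ u → κ ℚ.* (u ℚ.* fromℕ (Λ m) ℚ.* cost x*)) (trans (cong fromℕ (four m)) (fromℕ-* m 4)) ⟩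
      κ ℚ.* (mq ℚ.* fromℕ 4 ℚ.* fromℕ (Λ m) ℚ.* cost x*)    ≡⟨ rearrange (fromℕ 2) ι mq (fromℕ 4) (fromℕ (Λ m)) (cost x*) ⟩
      (mq ℚ.* ι) ℚ.* (fromℕ 2 ℚ.* fromℕ 4 ℚ.* fromℕ (Λ m) ℚ.* cost x*)
                                                            ≡⟨ trans (cong (ℚ._* (fromℕ 2 ℚ.* fromℕ 4 ℚ.* fromℕ (Λ m) ℚ.* cost x*)) (inverse-fromℕ m 1≤m)) (ℚ.*-identityˡ _) ⟩
      fromℕ 8 ℚ.* fromℕ (Λ m) ℚ.* cost x*                   ≡⟨ cong (ℚ._* cost x*) (sym (fromℕ-* 8 (Λ m))) ⟩
      fromℕ (8 * Λ m) ℚ.* cost x*                           ≤⟨ ℚ.*-monoʳ-≤-nonNeg (cost x*) {{ℚ.nonNegative (∑-nonneg (λ k → *-nonneg (cost≥0 k) (0≤x k)))}} (fromℕ-≤ 8Λ≤) ⟩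
      fromℕ (24 * log m) ℚ.* cost x*                        ∎
      where
      open ℚ.≤-Reasoning
      four : ∀ m → (m + m) + (m + m) ≡ m * 4
      four = solve-∀
      rearrange : ∀ b i q f l y → b ℚ.* i ℚ.* (q ℚ.* f ℚ.* l ℚ.* y) ≡ (q ℚ.* i) ℚ.* (b ℚ.* f ℚ.* l ℚ.* y)
      rearrange = Ring.solve-∀ ℚ-ring
      -- As m ≥ 1, log m is at least 1, and the 2 in Λ m = 2 + log m is at most 2 * log m.
      8Λ≤ : 8 * Λ m ≤ 24 * log m
      8Λ≤ = ≤-trans (*-monoʳ-≤ 8 (+-monoˡ-≤ (log m) (*-monoʳ-≤ 2 1≤log))) (≤-reflexive (triple (log m)))
        where
        triple : ∀ l → 8 * (2 * l + l) ≡ 24 * l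
        triple = solve-∀

-- Sizes along the run

size-un : ∀ n → size (un n) ≡ 1 + 2 * n
size-un zero    = refl
size-un (suc n) = trans (cong (2 +_) (size-un n)) (cong (1 +_) (shift n))
  where
  shift : ∀ n → 1 + (1 + 2 * n) ≡ 2 * (1 + n)
  shift = solve-∀

size-un-≤ : ∀ {n b} → n ≤ b → size (un n) ≤ 1 + 2 * b
size-un-≤ {n} n≤b = ≤-trans (≤-reflexive (size-un n)) (s≤s (*-monoʳ-≤ 2 n≤b))

size-encode : ∀ {A : Set} (f : A → Data) {b} xs → All (λ x → size (f x) ≤ b) xs → size (encode f xs) ≤ 1 + length xs * (1 + b)
size-encode f []       []         = ≤-refl
size-encode f {b} (x ∷ xs) (fx ∷ fxs) = s≤s (≤-trans (+-mono-≤ fx (size-encode f xs fxs)) (≤-reflexive (shift b (length xs * (1 + b)))))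
  where
  shift : ∀ b n → b + (1 + n) ≡ (1 + b) + n
  shift = solve-∀

length≤size : ∀ {A : Set} (f : A → Data) xs → length xs ≤ size (encode f xs)
length≤size f []       = z≤n
length≤size f (x ∷ xs) = s≤s (≤-trans (length≤size f xs) (m≤n+m _ _))

∈-size : ∀ {A : Set} (f : A → Data) {x} xs → x ∈ xs → size (f x) ≤ size (encode f xs)
∈-size f (y ∷ xs) (here refl) = m≤n⇒m≤1+n (m≤m+n _ _)
∈-size f (y ∷ xs) (there x∈)  = m≤n⇒m≤1+n (≤-trans (∈-size f xs x∈) (m≤n+m _ _))

bits-dens : ∀ d → bits (dens d) ≤ size d
bits-dens nil        = ≤-refl
bits-dens (num q)    = m≤n⇒m≤1+n (m≤n+m _ _)
bits-dens (pair d e) = ≤-trans (bits-* (dens d) (dens e)) (m≤n⇒m≤1+n (+-mono-≤ (bits-dens d) (bits-dens e)))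

1≤dens : ∀ d → 1 ≤ dens d
1≤dens nil        = ≤-refl
1≤dens (num q)    = s≤s z≤n
1≤dens (pair d e) = *-mono-≤ (1≤dens d) (1≤dens e)

integral-/ : ∀ D ρ .{{_ : NonZero D}} → Integral D ρ → ∃[ z ] (ρ ≡ z ℚ./ D)
integral-/ D@(suc D-1) ρ@record{} (z , eq) = z , ℚ.toℚᵘ-injective (ℚᵘ.≃-trans (ℚᵘ.*≡* cross) (ℚᵘ.≃-sym (ℚ.toℚᵘ-fromℚᵘ (ℚᵘ.mkℚᵘ z D-1))))
  where
  scaled : ℚ.toℚᵘ ρ ℚᵘ.* ℚᵘ.mkℚᵘ (ℤ.+ D) 0 ℚᵘ.≃ ℚᵘ.mkℚᵘ z 0
  scaled = begin
    ℚ.toℚᵘ ρ ℚᵘ.* ℚᵘ.mkℚᵘ (ℤ.+ D) 0      ≈⟨ ℚᵘ.*-congˡ {ℚ.toℚᵘ ρ} (ℚᵘ.≃-sym (ℚ.toℚᵘ-fromℚᵘ (ℚᵘ.mkℚᵘ (ℤ.+ D) 0))) ⟩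
    ℚ.toℚᵘ ρ ℚᵘ.* ℚ.toℚᵘ (fromℕ D)       ≈⟨ ℚᵘ.≃-sym (ℚ.toℚᵘ-homo-* ρ (fromℕ D)) ⟩
    ℚ.toℚᵘ (ρ ℚ.* fromℕ D)               ≡⟨ cong ℚ.toℚᵘ eq ⟩
    ℚ.toℚᵘ (int z)                       ≈⟨ ℚ.toℚᵘ-fromℚᵘ (ℚᵘ.mkℚᵘ z 0) ⟩
    ℚᵘ.mkℚᵘ z 0                          ∎
    where open ℚᵘ.≃-Reasoning
  cross : ↥ ρ ℤ.* ℤ.+ D ≡ z ℤ.* ↧ ρ
  cross with scaled
  ... | ℚᵘ.*≡* p = trans (sym (ℤ.*-identityʳ (↥ ρ ℤ.* ℤ.+ D)))
                     (trans p (cong (λ n → z ℤ.* ℤ.+ n) (*-identityʳ (↧ₙ ρ))))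

-- A number between 0 and a that is integral over D has denominator at most D and numerator at most
-- D times that of a. So residual costs stay small however often they are decreased.
size-integral : ∀ D {ρ a} → 1 ≤ D → Integral D ρ → 0ℚ ℚ.≤ ρ → ρ ℚ.≤ a → size (num ρ) ≤ size (num a) + (bits D + bits D)
size-integral D {ρ} {a} 1≤D int 0≤ρ ρ≤a = s≤s (begin
  bits ℤ.∣ ↥ ρ ∣ + bits (↧ₙ ρ)                      ≤⟨ +-mono-≤ (≤-trans (bits-mono num≤) (bits-* ℤ.∣ ↥ a ∣ D)) (bits-mono den≤) ⟩
  (bits ℤ.∣ ↥ a ∣ + bits D) + bits D                ≡⟨ +-assoc (bits ℤ.∣ ↥ a ∣) (bits D) (bits D) ⟩
  bits ℤ.∣ ↥ a ∣ + (bits D + bits D)                ≤⟨ +-monoˡ-≤ (bits D + bits D) (m≤m+n (bits ℤ.∣ ↥ a ∣) (bits (↧ₙ a))) ⟩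
  (bits ℤ.∣ ↥ a ∣ + bits (↧ₙ a)) + (bits D + bits D) ∎)
  where
  open ≤-Reasoning
  instance
    D≢0 : NonZero D
    D≢0 = >-nonZero 1≤D
  den≤ : ↧ₙ ρ ≤ D
  den≤ with integral-/ D ρ int
  ... | z , eq = ≤-trans (≤-reflexive (cong ↧ₙ_ eq)) (↧/≤ z D)
  cross : ∀ ρ a → 0ℚ ℚ.≤ ρ → ρ ℚ.≤ a → ℤ.∣ ↥ ρ ∣ * ↧ₙ a ≤ ℤ.∣ ↥ a ∣ * ↧ₙ ρ
  cross (ℚ.mkℚ ℤ.-[1+ n ] d _) a (ℚ.*≤* ()) _
  cross ρ@(ℚ.mkℚ (ℤ.+ n) d _) a@(ℚ.mkℚ (ℤ.+ p) q _) _ (ℚ.*≤* le) =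
    ℤ.drop‿+≤+ (subst₂ ℤ._≤_ (sym (ℤ.pos-* n (suc q))) (sym (ℤ.pos-* p (suc d))) le)
  cross ρ@(ℚ.mkℚ (ℤ.+ n) d _) a@(ℚ.mkℚ ℤ.-[1+ p ] q _) 0≤ρ ρ≤a with ℚ.≤-trans 0≤ρ ρ≤a
  ... | ℚ.*≤* ()
  num≤ : ℤ.∣ ↥ ρ ∣ ≤ ℤ.∣ ↥ a ∣ * D
  num≤ = ≤-trans (m≤m*n ℤ.∣ ↥ ρ ∣ (↧ₙ a)) (≤-trans (cross ρ a 0≤ρ ρ≤a) (*-monoʳ-≤ ℤ.∣ ↥ a ∣ den≤))

size-fromℕ : ∀ m → size (num (fromℕ m)) ≤ 2 + m
size-fromℕ m = s≤s (≤-trans (+-mono-≤ (≤-trans (bits-mono (∣↥/∣≤ (ℤ.+ m) 1)) (log≤ m)) (≤-trans (bits-mono (↧/≤ (ℤ.+ m) 1)) ≤-refl)) (≤-reflexive (+-comm m 1)))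

size-amount : ∀ q l → size (num (amount q l)) ≤ l * 4 + (2 + size (num q))
size-amount q zero          = m≤m+n 2 _
size-amount q (suc zero)    = ≤-trans (size-mul (fromℕ 2) (inverse q)) (s≤s (s≤s (s≤s (s≤s (≤-trans (size-op₁ inv (num q)) (m≤n+m _ 2))))))
size-amount q (suc (suc i)) = ≤-trans (size-mul (fromℕ 2) (amount q (suc i))) (+-monoʳ-≤ 4 (size-amount q (suc i)))

-- The variable 𝕏 stands for the number of input bits received so far.

curP historyP loadP stateP : Pol
curP = C 1 ⊕ (𝕏 ⊕ (C 1 ⊕ ((𝕏 ⊕ (𝕏 ⊕ 𝕏)) ⊕ (C 1 ⊕ ((C 1 ⊕ C 2 ⊗ (C 1 ⊕ ((𝕏 ⊕ 𝕏) ⊕ (𝕏 ⊕ 𝕏))))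
  ⊕ (C 1 ⊕ ((C 1 ⊕ C 2 ⊗ 𝕏) ⊕ ((C 2 ⊕ 𝕏) ⊗ C 4 ⊕ (C 2 ⊕ (C 2 ⊕ 𝕏))))))))))
historyP = C 1 ⊕ 𝕏 ⊗ (C 1 ⊕ (C 1 ⊕ ((C 1 ⊕ C 2 ⊗ 𝕏) ⊕ (C 1 ⊕ 𝕏 ⊗ (C 1 ⊕ curP)))))
loadP = C 1 ⊕ ((C 1 ⊕ C 2 ⊗ 𝕏) ⊕ (C 1 ⊕ (k ⊕ (C 1 ⊕ ((C 1 ⊕ C 2 ⊗ ((𝕏 ⊕ 𝕏) ⊕ 𝕏 ⊗ 𝕏)) ⊕ k)))))
  where
  k : Pol
  k = C 1 ⊕ C 2 ⊗ (C 1 ⊕ ((𝕏 ⊕ 𝕏) ⊕ (𝕏 ⊕ 𝕏)))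
-- The first summand covers the state and the histories in the improvement loop, the second the
-- accumulator of the packing loop; the sum is the one bound S that `Fits` uses for both.
stateP = (C 1 ⊕ ((C 2 ⊕ 𝕏) ⊕ historyP)) ⊕ (C 1 ⊕ ((C 1 ⊕ 𝕏 ⊗ (C 1 ⊕ (C 1 ⊕ C 2 ⊗ 𝕏))) ⊕ (C 1 ⊕ 𝕏 ⊗ (C 1 ⊕ loadP))))

module Sizes {m : ℕ} (P : Instance m) (1≤m : 1 ≤ m) where
  open Instance P using (T)
  open IntervalModel P using (copy)
  open Trajectory P hiding (⟨_⟩)
  open Online P using (message; inputSize)
  open Improvement m mq indep 1≤m using (steps-inv; improved-good; improved-a)
  open PackingAnalysis m mq indep 1≤m
  open Greedy m indep M V
  open Analysis P 1≤m

  X : ℕ → ℕ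
  X t = inputSize (suc t)

  inputSize-suc : ∀ t → inputSize (suc t) ≡ inputSize t + size (message (suc t))
  inputSize-suc t = trans (cong (λ ts → sumℕ (map f ts)) (sym (List.upTo-∷ʳ t)))
    (trans (cong sumℕ (List.map-++ f (upTo t) (t ∷ [])))
      (trans (sum-++ (map f (upTo t)) (f t ∷ [])) (cong (inputSize t +_) (+-identityʳ (f t)))))
    where
    f : ℕ → ℕ
    f s = size (message (suc s))

  message≤X : ∀ t → size (message (suc t)) ≤ X t
  message≤X t = ≤-trans (m≤n+m _ (inputSize t)) (≤-reflexive (sym (inputSize-suc t)))

  X-mono : ∀ t → X t ≤ X (suc t)
  X-mono t = ≤-trans (m≤m+n (X t) _) (≤-reflexive (sym (inputSize-suc (suc t))))

  t≤inputSize : ∀ t → t ≤ inputSize t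
  t≤inputSize zero    = z≤n
  t≤inputSize (suc t) = ≤-trans (≤-reflexive (+-comm 1 t))
    (≤-trans (+-mono-≤ (t≤inputSize t) (1≤size (message (suc t)))) (≤-reflexive (sym (inputSize-suc t))))

  m≤X : ∀ t → m ≤ X t
  m≤X t = ≤-trans (≤-reflexive (sym (List.length-tabulate {n = m} (λ i → i)))) (≤-trans (length≤size _ (allFin m)) (message≤X t))

  1≤D : ∀ t → 1 ≤ D t
  1≤D zero    = 1≤dens (newsᵈ (news 0))
  1≤D (suc t) = *-mono-≤ (1≤dens (newsᵈ (news (suc t)))) (1≤D t)

  news-size : ∀ {t} → t < T → size (newsᵈ (news t)) ≤ size (message (suc t))
  news-size t<T = ≤-reflexive (cong size (sym (message-news t<T)))

  bits-D : ∀ t → t < T → bits (D t) ≤ X t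
  bits-D zero    t<T = ≤-trans (bits-dens (newsᵈ (news 0))) (≤-trans (news-size t<T) (message≤X 0))
  bits-D (suc t) t<T = begin
    bits (dens (newsᵈ (news (suc t))) * D t)            ≤⟨ bits-* (dens (newsᵈ (news (suc t)))) (D t) ⟩
    bits (dens (newsᵈ (news (suc t)))) + bits (D t)     ≤⟨ +-mono-≤ (≤-trans (bits-dens (newsᵈ (news (suc t)))) (news-size t<T)) (bits-D t (<⇒≤ t<T)) ⟩
    size (message (suc (suc t))) + X t                  ≡⟨ +-comm (size (message (suc (suc t)))) (X t) ⟩
    X t + size (message (suc (suc t)))                  ≡⟨ sym (inputSize-suc (suc t)) ⟩
    X (suc t)                                           ∎
    where open ≤-Reasoning

  Fine : ℕ → Cur → Set
  Fine t c = Good m (D t) c × size (num (Cur.a c)) ≤ X t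

  fine-suc : ∀ {t c} → Fine t c → Fine (suc t) c
  fine-suc {t} (g , a≤) = scale-good (dens (newsᵈ (news (suc t)))) g , ≤-trans a≤ (X-mono t)

  arrived-fine : ∀ t → t < T → ∀ e → Fine t (arrived t e)
  final-fine : ∀ t → t < T → ∀ e → Fine t (final t e)
  final-fine t t<T e = final-good t e , subst (λ q → size (num q) ≤ X t) (sym (arrived-a t e)) (proj₂ (arrived-fine t t<T e))
  arrived-fine t t<T e = arrived-good t e , go t t<T
    where
    newcomer : ∀ t → t < T → born e t ≡ true → size (num (Copy.cost (copy e (currentIndex e t)))) ≤ X t
    newcomer t t<T eq = ≤-trans (≤-trans (≤-reflexive (cong (λ b → size (maybeᵈ (if b then just (Copy.cost (copy e (currentIndex e t))) else nothing))) (sym eq)))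
      (∈-size (maybeᵈ ∘ news t) (allFin m) (∈-allFin e))) (≤-trans (news-size t<T) (message≤X t))
    go : ∀ t → t < T → size (num (Cur.a (arrived t e))) ≤ X t
    go zero    t<T = newcomer 0 t<T refl
    go (suc t) t<T = branch (born e (suc t)) refl
      where
      branch : ∀ b → born e (suc t) ≡ b → size (num (Cur.a (if b then fresh (Copy.cost (copy e (currentIndex e (suc t)))) else final t e))) ≤ X (suc t)
      branch true  eq = newcomer (suc t) t<T eq
      branch false _  = ≤-trans (subst (λ q → size (num q) ≤ X t) (sym (arrived-a t e)) (go t (<⇒≤ t<T))) (X-mono t)

  older-fine : ∀ t → t < T → ∀ e → All (Fine t) (older t e)
  older-fine zero    _   e = []
  older-fine (suc t) t<T e = go (born e (suc t))
    where
    earlier : All (Fine (suc t)) (older t e)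
    earlier = All.map (λ {c} → fine-suc {t} {c}) (older-fine t (<⇒≤ t<T) e)
    go : ∀ b → All (Fine (suc t)) (if b then final t e ∷ older t e else older t e)
    go true  = fine-suc {t} {final t e} (final-fine t (<⇒≤ t<T) e) ∷ earlier
    go false = earlier

  length-older≤ : ∀ t e → length (older t e) ≤ t
  length-older≤ zero    e = z≤n
  length-older≤ (suc t) e = go (born e (suc t))
    where
    go : ∀ b → length (if b then final t e ∷ older t e else older t e) ≤ suc t
    go true  = s≤s (length-older≤ t e)
    go false = m≤n⇒m≤1+n (length-older≤ t e)

  during-fine : ∀ t → t < T → ∀ i e → Fine t (repeat i step (arrived t) e)
  during-fine t t<T i e = steps-good {t} i (arrived-good t) e ,
    subst (λ q → size (num q) ≤ X t) (sym (same-a e)) (proj₂ (arrived-fine t t<T e))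
    where
    same-a : ∀ e → Cur.a (repeat i step (arrived t) e) ≡ Cur.a (arrived t e)
    same-a = steps-inv {λ cs → ∀ e → Cur.a (cs e) ≡ Cur.a (arrived t e)} (λ imp a≡ e → trans (improved-a imp e) (a≡ e)) i (λ _ → refl)

  capacity≤X : ∀ t {l} → capacity l ≤ 1 + (m + m + (m + m)) → capacity l ≤ 1 + (X t + X t + (X t + X t))
  capacity≤X t capacity≤ = ≤-trans capacity≤ (s≤s (+-mono-≤ (+-mono-≤ (m≤X t) (m≤X t)) (+-mono-≤ (m≤X t) (m≤X t))))

  size-cur : ∀ t → t < T → ∀ {c} → Fine t c → size (curᵈ c) ≤ ⟦ curP ⟧ (X t)
  size-cur t t<T {cur a ρ l} (g , a≤) =
    s≤s (+-mono-≤ a≤ (s≤s (+-mono-≤ (≤-trans (size-integral (D t) (1≤D t) ρ-int 0≤ρ ρ≤a) (+-mono-≤ a≤ (+-mono-≤ (bits-D t t<T) (bits-D t t<T))))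
      (s≤s (+-mono-≤ (size-un-≤ (capacity≤X t {l} capacity≤)) (s≤s (+-mono-≤ (size-un-≤ (≤-trans (baseKey≤m l) (m≤X t)))
        (≤-trans (size-amount mq l) (+-mono-≤ (*-monoˡ-≤ 4 (≤-trans lev≤ (+-monoʳ-≤ 2 (≤-trans (log≤ m) (m≤X t)))))
          (+-monoʳ-≤ 2 (≤-trans (size-fromℕ m) (+-monoʳ-≤ 2 (m≤X t)))))))))))))
    where
    open Good g
    baseKey≤m : ∀ l → baseKey m l ≤ m
    baseKey≤m zero    = ≤-refl
    baseKey≤m (suc i) = m∸n≤m m i

  size-histories : ∀ t → t < T → ∀ cs → (∀ e → Fine t (cs e)) → size (historiesᵈ (cs ∷ₕ older t)) ≤ ⟦ historyP ⟧ (X t)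
  size-histories t t<T cs fine = ≤-trans (size-encode (λ e → historyᵈ e (cs e ∷ older t e)) (allFin m) (All.tabulate (λ {e} _ → entry e)))
    (s≤s (*-monoˡ-≤ _ (≤-trans (≤-reflexive (List.length-tabulate {n = m} (λ i → i))) (m≤X t))))
    where
    entry : ∀ e → size (historyᵈ e (cs e ∷ older t e)) ≤ 1 + ((1 + 2 * X t) + (1 + X t * (1 + ⟦ curP ⟧ (X t))))
    entry e = s≤s (+-mono-≤ (size-un-≤ (≤-trans (<⇒≤ (Fin.toℕ<n e)) (m≤X t)))
      (≤-trans (size-encode curᵈ (cs e ∷ older t e) (size-cur t t<T (fine e) ∷ All.map (λ {c} → size-cur t t<T {c}) (older-fine t t<T e)))
        (s≤s (*-monoˡ-≤ _ (≤-trans (s≤s (length-older≤ t e)) (t≤inputSize (suc t)))))))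

  length-above : ∀ w v → length (above w v) ≤ m
  length-above w v = ≤-trans (go (allFin m) []) (≤-reflexive (trans (+-identityʳ _) (List.length-tabulate {n = m} (λ i → i))))
    where
    go : ∀ xs D → length (foldl (λ D e → if above? w v e then e ∷ D else D) D xs) ≤ length xs + length D
    go []       D = ≤-refl
    go (x ∷ xs) D with above? w v x
    ... | true  = ≤-trans (go xs (x ∷ D)) (≤-reflexive (+-suc (length xs) (length D)))
    ... | false = ≤-trans (go xs D) (n≤1+n _)

  size-loads : ∀ t cs i → i ≤ N → Quiet (loads cs) i → (∀ e → capacity (Cur.lev (cs e)) ≤ 1 + (m + m + (m + m))) →
               size (loadsᵈ (seq (loads cs) i)) ≤ 1 + X t * (1 + ⟦ loadP ⟧ (X t))
  size-loads t cs i i≤N quiet capacity≤ = ≤-trans (size-encode (λ e → loadᵈ e (seq (loads cs) i e)) (allFin m) (All.tabulate (λ {e} _ → entry e)))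
    (s≤s (*-monoˡ-≤ _ (≤-trans (≤-reflexive (List.length-tabulate {n = m} (λ i → i))) (m≤X t))))
    where
    V≤ : V ≤ X t + X t + X t * X t
    V≤ = +-mono-≤ (+-mono-≤ (m≤X t) (m≤X t)) (*-mono-≤ (m≤X t) (m≤X t))
    k≤ : ∀ {l n r} → State i l n r → Load.k r ≤ capacity l
    k≤ (unused _ _)  = z≤n
    k≤ (saturated _) = ≤-refl
    k≤ (active _ _ _ _ _ _ _ _ _) = ≤-refl
    c≤ : ∀ {l n r} → State i l n r → Load.c r ≤ capacity l
    c≤ (unused _ _)  = z≤n
    c≤ (saturated _) = z≤n
    c≤ (active _ _ _ _ _ c<k _ _ _) = <⇒≤ c<k
    entry : ∀ e → size (loadᵈ e (seq (loads cs) i e)) ≤ ⟦ loadP ⟧ (X t)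
    entry e = s≤s (+-mono-≤ (size-un-≤ (≤-trans (<⇒≤ (Fin.toℕ<n e)) (m≤X t)))
      (s≤s (+-mono-≤ (size-un-≤ (≤-trans (k≤ st) (capacity≤X t {Cur.lev (cs e)} (capacity≤ e))))
        (s≤s (+-mono-≤ (size-un-≤ (≤-trans (state-key≤ cs i≤N st) V≤)) (size-un-≤ (≤-trans (c≤ st) (capacity≤X t {Cur.lev (cs e)} (capacity≤ e)))))))))
      where
      st : State i (Cur.lev (cs e)) (count (loads cs) i e) (seq (loads cs) i e)
      st = states cs i≤N quiet e

  size-round : ∀ t cs → (∀ e → capacity (Cur.lev (cs e)) ≤ 1 + (m + m + (m + m))) → PackSized (⟦ stateP ⟧ (X t)) cs
  size-round t cs capacity≤ i i≤N = go (rounds-cases (loads cs) i)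
    where
    within : ∀ D {j} → j ≤ N → Quiet (loads cs) j → size (encode idᵈ D) ≤ 1 + X t * (1 + (1 + 2 * X t)) →
             size (roundᵈ (D , seq (loads cs) j)) ≤ ⟦ stateP ⟧ (X t)
    within D j≤N quiet D≤ = ≤-trans (s≤s (+-mono-≤ D≤ (size-loads t cs _ j≤N quiet capacity≤)))
      (m≤n+m _ (⟦ C 1 ⊕ ((C 2 ⊕ 𝕏) ⊕ historyP) ⟧ (X t)))
    size-above : ∀ D w → ∃[ v ] (v ≤ V × demand w v < supply w (basis w) v × D ≡ above w v) →
                 size (encode idᵈ D) ≤ 1 + X t * (1 + (1 + 2 * X t))
    size-above D w (v , _ , _ , D≡) = ≤-trans (size-encode idᵈ D (All.tabulate (λ {e} _ → size-un-≤ (≤-trans (<⇒≤ (Fin.toℕ<n e)) (m≤X t)))))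
      (s≤s (*-monoˡ-≤ _ (≤-trans (≤-trans (≤-reflexive (cong length D≡)) (length-above w v)) (m≤X t))))
    go : (repeat i round ([] , loads cs) ≡ ([] , seq (loads cs) i) × Quiet (loads cs) i)
         ⊎ (∃[ j ] ∃[ d ] ∃[ D ] (j < i × Quiet (loads cs) j × violated (seq (loads cs) j) (bases (loads cs) j) ≡ d ∷ D
                                   × repeat i round ([] , loads cs) ≡ (d ∷ D , seq (loads cs) j))) →
         size (roundᵈ (repeat i round ([] , loads cs))) ≤ ⟦ stateP ⟧ (X t)
    go (inj₁ (eq , quiet)) = ≤-trans (≤-reflexive (cong (size ∘ roundᵈ) eq)) (within [] i≤N quiet (s≤s z≤n))
    go (inj₂ (j , d , D , j<i , quiet , viol , eq)) = ≤-trans (≤-reflexive (cong (size ∘ roundᵈ) eq))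
      (within (d ∷ D) (≤-trans (<⇒≤ j<i) i≤N) quiet
        (size-above (d ∷ D) (seq (loads cs) j) (violated-∷ (seq (loads cs) j) (bases (loads cs) j) viol)))

  size-state : ∀ t → t < T → size (stateᵈ t) ≤ ⟦ stateP ⟧ (X t)
  size-state zero    _   = ≤-trans (≤-trans (size-fromℕ m) (+-monoʳ-≤ 2 (m≤X 0))) (≤-trans (≤-trans (m≤m+n _ _) (n≤1+n _)) (m≤m+n _ _))
  size-state (suc t) t<T = ≤-trans (s≤s (+-mono-≤ (≤-trans (size-fromℕ m) (+-monoʳ-≤ 2 (m≤X t))) (size-histories t (<⇒≤ t<T) (final t) (final-fine t (<⇒≤ t<T)))))
    (≤-trans (m≤m+n _ _) (⟦⟧-mono stateP (X-mono t)))

  message≤state : ∀ t → size (message (suc t)) ≤ ⟦ stateP ⟧ (X t)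
  message≤state t = ≤-trans (message≤X t) (≤-trans (m≤n+m (X t) 2) (≤-trans (≤-trans (m≤m+n _ _) (n≤1+n _)) (m≤m+n _ _)))

  fits : ∀ t → t < T → Fits Oracle (⟦ stateP ⟧ (X t)) program (stateᵈ t ∷ newsᵈ (news t) ∷ [])
  fits t t<T = fits-program (stateᵈ t) (previous t) (news t) (arrived t) (older t) (previous-arrive t) (previous-state t)
    (λ i _ → ≤-trans (size-histories t t<T (repeat i step (arrived t)) (during-fine t t<T i)) (≤-trans (≤-trans (m≤n+m _ (2 + X t)) (n≤1+n _)) (m≤m+n _ _)))
    (λ i _ → size-round t (repeat i step (arrived t)) (λ e → Good.capacity≤ (proj₁ (during-fine t t<T i e))))

-- The exponent is determined by the program text and `stateP` alone, hence uniform in m and in the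
-- instance.
program-degree : ∃[ d ] (∀ n → ⟦ ctₚ program [ stateP ]ᵖ ⟧ n ≤ n ^ d + d)
program-degree = ⟦⟧-monomial (ctₚ program [ stateP ]ᵖ)

-- Assembling the run

module Running {m : ℕ} (P : Instance m) where
  open Instance P using (matroid; T)
  open IntervalModel P using (element)
  open Trajectory P hiding (⟨_⟩; S)
  open Online P using (message; inputSize; Run; _⊢_⇓_∣_)

  -- An interface to the size bounds, which have different proofs for m = 0 and for 1 ≤ m.
  record Bounded : Set where
    field
      state-bound   : ∀ t → t < T → size (stateᵈ t) ≤ ⟦ stateP ⟧ (inputSize (suc t))
      message-bound : ∀ t → size (message (suc t)) ≤ ⟦ stateP ⟧ (inputSize (suc t))
      fits          : ∀ t → t < T → Fits Oracle (⟦ stateP ⟧ (inputSize (suc t))) program (stateᵈ t ∷ newsᵈ (news t) ∷ [])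

  module _ (bounded : Bounded) where
    open Bounded bounded

    private
      Step : ℕ → ℕ → Set
      Step t k = (stateᵈ t ∷ message (suc t) ∷ []) ⊢ ⌜ program ⌝ₚ ⇓ pair (stateᵈ (suc t)) (outᵈ (suc t)) ∣ k

      step-cost : ∀ t → t < T → ∃[ k ] (Step t k × k ≤ ⟦ ctₚ program [ stateP ]ᵖ ⟧ (inputSize (suc t)))
      step-cost t t<T = recast (compileₚ Oracle S program {stateᵈ t ∷ newsᵈ (news t) ∷ []} {S} wf sized ≤-refl (fits t t<T))
        where
        S : ℕ
        S = ⟦ stateP ⟧ (inputSize (suc t))
        sized : Sized Oracle (stateᵈ t ∷ newsᵈ (news t) ∷ []) S
        sized zero       = state-bound t t<T
        sized (suc zero) = subst (λ d → size d ≤ S) (message-news t<T) (message-bound t)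
        recast : ∃[ k ] ((stateᵈ t ∷ newsᵈ (news t) ∷ []) ⊢ ⌜ program ⌝ₚ ⇓ evalₚ Oracle program (stateᵈ t ∷ newsᵈ (news t) ∷ []) ∣ k
                         × k ≤ ⟦ ctₚ program ⟧ S) →
                 ∃[ k ] (Step t k × k ≤ ⟦ ctₚ program [ stateP ]ᵖ ⟧ (inputSize (suc t)))
        recast (k , d , k≤) = k
          , subst₂ (λ msg v → (stateᵈ t ∷ msg ∷ []) ⊢ ⌜ program ⌝ₚ ⇓ v ∣ k) (sym (message-news t<T)) (program-step t) d
          , ≤-trans k≤ (≤-reflexive (sym (⟦[]ᵖ⟧ (ctₚ program) stateP (inputSize (suc t)))))

      timeOf : ∀ {t} → Dec (t < T) → ℕ
      timeOf {t} (yes t<T) = proj₁ (step-cost t t<T)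
      timeOf     (no _)    = 0

      timing : ℕ → ℕ
      timing zero    = 0
      timing (suc t) = timeOf (t <? T)

    run : Run ⌜ program ⌝ₚ
    run = record
      { state = stateᵈ ; output = outᵈ ; time = timing ; state-0 = refl ; output-0 = refl
      ; step = λ t t<T → go (t <? T) t<T }
      where
      go : ∀ {t} (d : Dec (t < T)) → t < T → Step t (timeOf d)
      go {t} (yes t<T) _ = proj₁ (proj₂ (step-cost t t<T))
      go (no t≮T) t<T = contradiction t<T t≮T

    polynomial : Run.PolynomialTime run (proj₁ program-degree)
    polynomial (suc t) _ t<T = go (t <? T) t<T
      where
      go : ∀ (d : Dec (t < T)) → t < T → timeOf d ≤ inputSize (suc t) ^ proj₁ program-degree + proj₁ program-degree
      go (yes t<T) _ = ≤-trans (proj₂ (proj₂ (step-cost t t<T))) (proj₂ program-degree (inputSize (suc t)))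
      go (no t≮T) t<T = contradiction t<T t≮T

theorem4p2 :
    Σ[ A ∈ OnlineAlgorithm ] ∃[ C ] ∃[ d ]
      (∀ (m : ℕ) (P : Instance m) →
        Σ[ R ∈ Online.Run P A ]
          ( Online.Run.PolynomialTime R d
          × Online.Run.Raising R
          × Online.Run.FeasibleOnline R
          × Online.Run.Competitive R (fromℕ (C * log m)) ))
theorem4p2 = ⌜ program ⌝ₚ , 24 , proj₁ program-degree , λ where
    -- The analysis divides by m. For m = 0 there are no copies, and both the cost and the ratio are
    -- 0.
    zero    P → empty P
    (suc n) P → nonempty P (s≤s z≤n)
  where
  Conclusion : ∀ {m} → Instance m → Set
  Conclusion {m} P = Σ[ R ∈ Online.Run P ⌜ program ⌝ₚ ]
    ( Online.Run.PolynomialTime R (proj₁ program-degree)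
    × Online.Run.Raising R
    × Online.Run.FeasibleOnline R
    × Online.Run.Competitive R (fromℕ (24 * log m)) )

  nonempty : ∀ {m} (P : Instance m) → 1 ≤ m → Conclusion P
  nonempty P 1≤m = run bounded , polynomial bounded , (λ t _ → raising t) , (λ t t≤T → solution , feasible t t≤T) , competitive
    where
    open Running P
    open Analysis P 1≤m
    open Competitive P 1≤m
    bounded : Bounded
    bounded = record { state-bound = Sizes.size-state P 1≤m ; message-bound = Sizes.message≤state P 1≤m ; fits = Sizes.fits P 1≤m }

  empty : (P : Instance 0) → Conclusion P
  empty P = run bounded , polynomial bounded , (λ t _ ()) , (λ t t≤T → (λ ()) , record
      { base = λ t _ _ → record
          { nonneg = λ () ; ranks = λ { [] → 0≤fromℕ (rank 𝓜 []) } ; total = cong fromℕ (sym (n≤0⇒n≡0 (rank-≤ 𝓜 {Subset.⊤} (Matroid.empty 𝓜) λ { {()} }))) }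
      ; z≤x = λ () ; z≡0 = λ () ; 0≤x = λ () ; x≤1 = λ () ; 0≤z = λ () ; z≤1 = λ () })
    , λ x* z* _ → ℚ.≤-reflexive (sym (ℚ.*-zeroʳ (fromℕ 0)))
    where
    open IntervalModel P using (𝓜)
    open Running P
    open Trajectory P hiding (⟨_⟩; S)
    stateP≥ : ∀ X → 4 ≤ ⟦ stateP ⟧ X
    stateP≥ X = ≤-trans (s≤s (+-mono-≤ (m≤m+n 2 X) (s≤s z≤n))) (m≤m+n (1 + ((2 + X) + ⟦ historyP ⟧ X)) _)
    X : ℕ → ℕ
    X t = Online.inputSize P (suc t)
    bounded : Bounded
    bounded = record
      { state-bound = λ { zero _ → ≤-trans (s≤s (s≤s z≤n)) (stateP≥ (X 0)) ; (suc t) _ → stateP≥ (X (suc t)) }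
      ; message-bound = λ t → ≤-trans (s≤s z≤n) (stateP≥ (X t))
      ; fits = λ t t<T → fits-program (stateᵈ t) (previous t) (news t) (arrived t) (older t) (previous-arrive t) (previous-state t)
          (λ _ _ → ≤-trans (s≤s z≤n) (stateP≥ (X t))) (λ { _ _ zero _ → ≤-trans (s≤s (s≤s (s≤s z≤n))) (stateP≥ (X t)) })
      }
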